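{- Let $(\alpha_0,\beta_0)\in\mathbb{R}^2$ have an eventually periodic Jacobi multidimensional continued fraction $$(\alpha_0,\beta_0)=[(a_0,\ldots,a_{k-1},\overline{a_k,\ldots,a_{k+h-1}}),(b_0,\ldots,b_{k-1},\overline{b_k,\ldots,b_{k+h-1}})],$$ i.e. $a_{n+h}=a_n$ and $b_{n+h}=b_n$ for all $n\ge k$, where $k\ge 0$ and $h\ge 1$. Then $\alpha_0$ and $\beta_0$ are cubic irrationals. Moreover, if $0<\alpha_0<1$ and $0<\beta_0<1$, then $$H(\alpha_0)\leq 3024\, C_{h+k-1}^9,\qquad H(\beta_0)\leq 3024\, C_{h+k-1}^9 .$$
   Context: Jacobi's algorithm applied to $(\alpha_0,\beta_0)\in\mathbb{R}^2$ produces, for $n\ge 0$, $a_n=\lfloor\alpha_n\rfloor$, $b_n=\lfloor\beta_n\rfloor$, $\alpha_{n+1}=\frac{1}{\beta_n-b_n}$, $\beta_{n+1}=\frac{\alpha_n-a_n}{\beta_n-b_n}$. If no $\beta_n$ is an integer, two infinite integer sequences are obtained and one writes $(\alpha_0,\beta_0)=[(a_0,a_1,\ldots),(b_0,b_1,\ldots)]$, the (infinite) multidimensional continued fraction (MCF) of $(\alpha_0,\beta_0)$. The overline denotes infinite periodic repetition. The denominators of the convergents are defined by $C_{ -3}=1$, $C_{ -2}=C_{ -1}=0$ and $C_n=a_nC_{n-1}+b_nC_{n-2}+C_{n-3}$ for $n\ge 0$. For an algebraic number $\gamma$, let $P_\gamma$ be its minimal polynomial over $\mathbb{Z}$ (integer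 coefficients, vanishing at $\gamma$, irreducible over $\mathbb{Z}$, in particular primitive). The naive height $H(\gamma)$ is the maximum of the absolute values of the coefficients of $P_\gamma$. A cubic irrational is a real algebraic number of degree $3$ over $\mathbb{Q}$. -}

module Defs where

open import Level using (_⊔_; 0ℓ)
open import Algebra.Bundles using (CommutativeRing; RawSemiring)
open import Algebra.Apartness.Bundles using (HeytingField; HeytingCommutativeRing)
import Algebra.Definitions.RawMonoid as Multiple
import Algebra.Definitions.RawSemiring as SemiringDefinitions
open import Data.Integer.Base as ℤ using (ℤ; +_; -[1+_]; ∣_∣)
open import Data.List.Base using (List; []; _∷_; map; foldr)
open import Data.Nat.Base as ℕ using (ℕ; zero; suc)
open import Data.Product.Base using (_×_; ∃-syntax; Σ-syntax; proj₁)
open import Data.Sum.Base using (_⊎_)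
open import Function.Bundles using (_⇔_)
open import Relation.Binary.Core using (Rel)
open import Relation.Binary.Structures using (IsStrictPartialOrder)
open import Relation.Binary.PropositionalEquality.Core using (_≡_; _≢_)
open import Relation.Nullary.Negation.Core using (¬_)

-- The real numbers, as a Cauchy complete Archimedean ordered field.  The order
-- is not assumed decidable, so that both the classical reals and the usual
-- constructive ones (e.g. Bishop's) are instances; classically, any two
-- instances are isomorphic.

record RealNumbers c ℓ₁ ℓ₂ ℓ₃ : Set (Level.suc (c ⊔ ℓ₁ ⊔ ℓ₂ ⊔ ℓ₃)) where
  infix 4 _<_ _≤_

  field
    heytingField : HeytingField c ℓ₁ ℓ₂

  open HeytingField heytingField public

  commutativeRing : CommutativeRing c ℓ₁
  commutativeRing = HeytingCommutativeRing.commutativeRing heytingCommutativeRing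

  open Multiple (CommutativeRing.+-rawMonoid commutativeRing) public
    using () renaming (_×_ to _·_)

  field
    _<_                  : Rel Carrier ℓ₃
    isStrictPartialOrder : IsStrictPartialOrder _≈_ _<_
    #⇔<⊎>                : ∀ {x y} → x # y ⇔ (x < y ⊎ y < x)
    +-monoʳ-<            : ∀ {x y} z → x < y → (z + x) < (z + y)
    *-pos                : ∀ {x y} → 0# < x → 0# < y → 0# < (x * y)
    archimedean          : ∀ x → ∃[ n ] x < (n · 1#)

  _≤_ : Rel Carrier ℓ₃
  x ≤ y = ¬ (y < x)

  -- |s m - s n| < ε for all m , n ≥ N; the other half of the inequality is
  -- obtained by exchanging m and n.
  Cauchy : (ℕ → Carrier) → Set (c ⊔ ℓ₃)
  Cauchy s = ∀ ε → 0# < ε →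
    ∃[ N ] (∀ m n → N ℕ.≤ m → N ℕ.≤ n → s m < (s n + ε))

  _ConvergesTo_ : (ℕ → Carrier) → Carrier → Set (c ⊔ ℓ₃)
  s ConvergesTo l = ∀ ε → 0# < ε →
    ∃[ N ] (∀ n → N ℕ.≤ n → s n < (l + ε) × l < (s n + ε))

  field
    complete : ∀ s → Cauchy s → ∃[ l ] s ConvergesTo l

  fromℤ : ℤ → Carrier
  fromℤ (+ n)    = n · 1#
  fromℤ -[1+ n ] = - (ℕ.suc n · 1#)

-- Polynomials are lists of coefficients, constant term first; trailing zeros
-- are allowed and are disregarded by _≈ₚ_.

ℤ[X] : Set
ℤ[X] = List ℤ

coeff : ℤ[X] → ℕ → ℤ
coeff []      _       = + 0
coeff (a ∷ p) zero    = a
coeff (a ∷ p) (suc n) = coeff p n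

infix  4 _≈ₚ_
infixl 6 _+ₚ_
infixl 7 _*ₚ_

_≈ₚ_ : Rel ℤ[X] 0ℓ
p ≈ₚ q = ∀ n → coeff p n ≡ coeff q n

_+ₚ_ : ℤ[X] → ℤ[X] → ℤ[X]
[]      +ₚ q       = q
(a ∷ p) +ₚ []      = a ∷ p
(a ∷ p) +ₚ (b ∷ q) = (a ℤ.+ b) ∷ (p +ₚ q)

_*ₚ_ : ℤ[X] → ℤ[X] → ℤ[X]
[]      *ₚ q = []
(a ∷ p) *ₚ q = map (a ℤ.*_) q +ₚ ((+ 0) ∷ (p *ₚ q))

ℤ[X]-rawSemiring : RawSemiring 0ℓ 0ℓ
ℤ[X]-rawSemiring = record
  { Carrier = ℤ[X]
  ; _≈_     = _≈ₚ_
  ; _+_     = _+ₚ_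
  ; _*_     = _*ₚ_
  ; 0#      = []
  ; 1#      = (+ 1) ∷ []
  }

-- Irreducibility in the ring ℤ[X]: constant factors count, so an irreducible
-- polynomial of positive degree is primitive.
open SemiringDefinitions ℤ[X]-rawSemiring public using (Irreducible)

HasDegree : ℤ[X] → ℕ → Set
HasDegree p d = coeff p d ≢ + 0 × (∀ n → d ℕ.< n → coeff p n ≡ + 0)

maxAbsCoeff : ℤ[X] → ℕ
maxAbsCoeff p = foldr ℕ._⊔_ 0 (map ∣_∣ p)

-- shiftedDenominator a b n is C_{n-3}, for the indices from -3 on.

shiftedDenominator : (a b : ℕ → ℤ) → ℕ → ℤ
shiftedDenominator a b 0 = + 1
shiftedDenominator a b 1 = + 0
shiftedDenominator a b 2 = + 0
shiftedDenominator a b (suc (suc (suc n))) =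
  a n ℤ.* shiftedDenominator a b (suc (suc n))
    ℤ.+ b n ℤ.* shiftedDenominator a b (suc n)
    ℤ.+ shiftedDenominator a b n

denominator : (a b : ℕ → ℤ) → ℕ → ℤ
denominator a b n = shiftedDenominator a b (3 ℕ.+ n)

PeriodicFrom : (k h : ℕ) → (ℕ → ℤ) → Set
PeriodicFrom k h a = ∀ n → k ℕ.≤ n → a (n ℕ.+ h) ≡ a n

module OverReals {c ℓ₁ ℓ₂ ℓ₃} (R : RealNumbers c ℓ₁ ℓ₂ ℓ₃) where
  open RealNumbers R public

  IsFloorOf : ℤ → Carrier → Set ℓ₃
  IsFloorOf z x = fromℤ z ≤ x × x < fromℤ (ℤ.suc z)

  -- (α₀ , β₀) = [(a 0 , a 1 , …) , (b 0 , b 1 , …)].  That no β n is an integer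
  -- is stated with apartness, as division needs.
  record IsMCF (α₀ β₀ : Carrier) (a b : ℕ → ℤ) : Set (c ⊔ ℓ₁ ⊔ ℓ₂ ⊔ ℓ₃) where
    field
      α β        : ℕ → Carrier
      α-start    : α 0 ≈ α₀
      β-start    : β 0 ≈ β₀
      a-floor    : ∀ n → IsFloorOf (a n) (α n)
      b-floor    : ∀ n → IsFloorOf (b n) (β n)
      nonInteger : ∀ n m → β n # fromℤ m

    1/[β-b] : ℕ → Carrier
    1/[β-b] n = proj₁ (#⇒invertible (nonInteger n (b n)))

    field
      α-step : ∀ n → α (suc n) ≈ 1/[β-b] n
      β-step : ∀ n → β (suc n) ≈ (α n - fromℤ (a n)) * 1/[β-b] n

  eval : ℤ[X] → Carrier → Carrier
  eval []      x = 0#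
  eval (a ∷ p) x = fromℤ a + x * eval p x

  -- The minimal polynomial is determined by γ up to sign, so height and degree
  -- do not depend on the element of IsAlgebraic γ they are computed from.
  record IsAlgebraic (γ : Carrier) : Set ℓ₁ where
    field
      minPoly     : ℤ[X]
      irreducible : Irreducible minPoly
      vanishes    : eval minPoly γ ≈ 0#

  height : ∀ {γ} → IsAlgebraic γ → ℕ
  height A = maxAbsCoeff (IsAlgebraic.minPoly A)

  IsCubicIrrational : Carrier → Set ℓ₁
  IsCubicIrrational γ = Σ[ A ∈ IsAlgebraic γ ] HasDegree (IsAlgebraic.minPoly A) 3

  H : ∀ {γ} → IsCubicIrrational γ → ℕ
  H cubic = height (proj₁ cubic)

{-# OPTIONS --safe #-}
module Submission where

-- An integer linear form x α + y β + z is carried along by Jacobi's algorithm: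
-- x, y, z become three consecutive terms of an integer sequence X satisfying
-- X (n+3) = a n X (n+2) + b n X (n+1) + X n.  If the form vanishes, then so does
-- X (n+2) α n + X (n+1) β n + X n for every n.  As α n > 1 and α n > β n ≥ 0, a
-- term at least as large as the two before it has the opposite sign to both,
-- and the recurrence then shows that no term exceeds the three before it.
-- This has two consequences.  For integers, the maximum over a window drops
-- within six steps, so X vanishes and 1, α, β are linearly independent over ℚ.
-- For reals, X stays bounded, and applied to (1, 0, - α) and (0, 1, - β) this
-- shows that the digits determine α and β; hence α (k+h) = α k, β (k+h) = β k.
--
-- Therefore (α₀ , β₀ , 1) is an eigenvector of the integral matrix
-- N = M (k+h) (M k)⁻¹ of determinant 1.  Eliminating β from the eigenvector
-- equation gives an integral cubic equation for α, whose coefficients are sums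
-- of at most 12 products of three entries of N, each of these at most 6 C³.
-- By independence α satisfies no quadratic equation, so that the cubic divided
-- by its content is irreducible.
open import Defs
open import Algebra.Bundles using (CommutativeRing; RawSemiring)
import Algebra.Apartness.Properties.HeytingCommutativeRing as HeytingProperties
import Algebra.Definitions.RawMagma as Divisibility
import Algebra.Properties.Ring as RingProperties
import Algebra.Properties.Semiring.Mult as SemiringMult
import Algebra.Solver.Ring as RingSolver
open import Algebra.Solver.Ring.AlmostCommutativeRing
  using (AlmostCommutativeRing; fromCommutativeRing; _-Raw-AlmostCommutative⟶_)
open import Data.Empty using (⊥-elim)
open import Data.Integer.Base as ℤ using (ℤ; +_; -[1+_]; _⊖_; ∣_∣)
import Data.Integer.Divisibility.Signed as ℤ∣
import Data.Integer.Properties as ℤₚ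
import Data.Integer.Solver as ℤSolver
open import Data.Integer.Tactic.RingSolver using (solve-∀)
open import Data.List.Base using ([]; _∷_; map)
open import Data.Maybe.Base using (Maybe; just; nothing)
open import Data.Nat.Base as ℕ using (ℕ; zero; suc)
open import Data.Nat.Divisibility as ∣ using (_∣_)
open import Data.Nat.GCD using (gcd; gcd[m,n]∣m; gcd[m,n]∣n; gcd-greatest)
import Data.Nat.Properties as ℕₚ
import Data.Nat.Solver as ℕSolver
open import Data.Product.Base using (_×_; _,_; proj₁; proj₂; ∃-syntax; Σ-syntax)
open import Data.Sum.Base using (_⊎_; inj₁; inj₂; [_,_]′)
open import Data.Vec.Base as Vec using (Vec; []; _∷_)
open import Data.Vec.N-ary using (N-ary; _$ⁿ_)
import Data.Vec.Properties as Vecₚ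
open import Function.Base using (_∘_)
open import Function.Bundles using (Equivalence)
import Level
open import Relation.Binary.PropositionalEquality as ≡ using (_≡_; _≢_)
import Relation.Binary.Reasoning.Setoid as SetoidReasoning
open import Relation.Binary.Structures using (IsStrictPartialOrder)
open import Relation.Nullary using (¬_; yes; no; contradiction)

-- Boundedness of an integer or real solution is one-sided information: it becomes uniqueness of the
-- expansion only because the value of the linear form is multiplied by `α (suc n)` at each step,
-- and three steps more than double it. A bounded sequence therefore pairs to zero with every
-- expansion that has the same digits. The cubic obtained by elimination could still degenerate. Its
-- leading coefficient vanishes if the last row of N has only its third entry; that entry would then
-- be an integral eigenvalue of a unimodular matrix, hence ± 1, whereas the eigenvalue is a
-- non-empty product of numbers greater than 1. In the remaining cases a vanishing leading
-- coefficient would make the eigenvalue quadratic, against independence. In the unit square the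
-- same boundedness shows that the numerators A and B do not exceed the largest C in play, so an
-- entry of N, a determinant with six products, is at most 6 C³. This gives 12 · 6³ = 2592 ≤ 3024.
-- As the order is not decidable, `_≤_` is a negation, and sign distinctions are made by
-- cotransitivity or under a double negation.

module OrderedField {c ℓ₁ ℓ₂ ℓ₃} (R : RealNumbers c ℓ₁ ℓ₂ ℓ₃) where
  open OverReals R public
  open CommutativeRing commutativeRing public using (ring; semiring)
  open RingProperties ring public
    using (-0#≈0#; -‿distribˡ-*; -‿distribʳ-*; -‿involutive; -‿+-comm)
  open SemiringMult semiring using (×-homo-+; ×1-homo-*)
  private module E = SetoidReasoning setoid
  private module < = IsStrictPartialOrder isStrictPartialOrder

  -- The integers inside the real field, and a ring solver with integer coefficients

  fromℤ-neg : ∀ z → fromℤ (ℤ.- z) ≈ - fromℤ z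
  fromℤ-neg (+ zero)  = sym -0#≈0#
  fromℤ-neg (+ suc n) = refl
  fromℤ-neg -[1+ n ]  = sym (-‿involutive _)

  fromℤ-⊖ : ∀ m n → fromℤ (m ⊖ n) ≈ m · 1# - n · 1#
  fromℤ-⊖ m zero = E.begin
    m · 1#        E.≈⟨ +-identityʳ _ ⟨
    m · 1# + 0#   E.≈⟨ +-congˡ -0#≈0# ⟨
    m · 1# - 0#   E.∎
  fromℤ-⊖ zero (suc n) = sym (+-identityˡ _)
  fromℤ-⊖ (suc m) (suc n) = E.begin
    fromℤ (suc m ⊖ suc n)                 E.≡⟨ ≡.cong fromℤ (ℤₚ.[1+m]⊖[1+n]≡m⊖n m n) ⟩
    fromℤ (m ⊖ n)                         E.≈⟨ fromℤ-⊖ m n ⟩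
    m · 1# - n · 1#                       E.≈⟨ +-identityˡ _ ⟨
    0# + (m · 1# - n · 1#)                E.≈⟨ +-congʳ (-‿inverseʳ 1#) ⟨
    (1# - 1#) + (m · 1# - n · 1#)         E.≈⟨ +-assoc _ _ _ ⟩
    1# + (- 1# + (m · 1# - n · 1#))       E.≈⟨ +-congˡ (+-assoc _ _ _) ⟨
    1# + ((- 1# + m · 1#) - n · 1#)       E.≈⟨ +-congˡ (+-congʳ (+-comm _ _)) ⟩
    1# + ((m · 1# - 1#) - n · 1#)         E.≈⟨ +-congˡ (+-assoc _ _ _) ⟩
    1# + (m · 1# + (- 1# - n · 1#))       E.≈⟨ +-assoc _ _ _ ⟨
    (1# + m · 1#) + (- 1# - n · 1#)       E.≈⟨ +-congˡ (-‿+-comm _ _) ⟩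
    (1# + m · 1#) - (1# + n · 1#)         E.∎

  fromℤ-+ : ∀ x y → fromℤ (x ℤ.+ y) ≈ fromℤ x + fromℤ y
  fromℤ-+ (+ m)    (+ n)    = ×-homo-+ 1# m n
  fromℤ-+ (+ m)    -[1+ n ] = fromℤ-⊖ m (suc n)
  fromℤ-+ -[1+ m ] (+ n)    = trans (fromℤ-⊖ n (suc m)) (+-comm _ _)
  fromℤ-+ -[1+ m ] -[1+ n ] = E.begin
    - (suc (suc (m ℕ.+ n)) · 1#)          E.≡⟨ ≡.cong (λ k → - (suc k · 1#)) (≡.sym (ℕₚ.+-suc m n)) ⟩
    - ((suc m ℕ.+ suc n) · 1#)            E.≈⟨ -‿cong (×-homo-+ 1# (suc m) (suc n)) ⟩
    - (suc m · 1# + suc n · 1#)           E.≈⟨ -‿+-comm _ _ ⟨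
    - (suc m · 1#) - suc n · 1#           E.∎

  fromℤ-*ⁿ : ∀ m y → fromℤ (+ m ℤ.* y) ≈ fromℤ (+ m) * fromℤ y
  fromℤ-*ⁿ m (+ n) = E.begin
    fromℤ (+ m ℤ.* + n)          E.≡⟨ ≡.cong fromℤ (ℤₚ.pos-* m n) ⟨
    (m ℕ.* n) · 1#               E.≈⟨ ×1-homo-* m n ⟩
    m · 1# * (n · 1#)            E.∎
  fromℤ-*ⁿ m -[1+ n ] = E.begin
    fromℤ (+ m ℤ.* ℤ.- (+ suc n))      E.≡⟨ ≡.cong fromℤ (ℤₚ.neg-distribʳ-* (+ m) (+ suc n)) ⟨
    fromℤ (ℤ.- (+ m ℤ.* + suc n))      E.≈⟨ fromℤ-neg (+ m ℤ.* + suc n) ⟩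
    - fromℤ (+ m ℤ.* + suc n)          E.≈⟨ -‿cong (fromℤ-*ⁿ m (+ suc n)) ⟩
    - (m · 1# * (suc n · 1#))          E.≈⟨ -‿distribʳ-* _ _ ⟩
    m · 1# * - (suc n · 1#)            E.∎

  fromℤ-* : ∀ x y → fromℤ (x ℤ.* y) ≈ fromℤ x * fromℤ y
  fromℤ-* (+ m)    y = fromℤ-*ⁿ m y
  fromℤ-* -[1+ m ] y = E.begin
    fromℤ (ℤ.- (+ suc m) ℤ.* y)     E.≡⟨ ≡.cong fromℤ (ℤₚ.neg-distribˡ-* (+ suc m) y) ⟨
    fromℤ (ℤ.- (+ suc m ℤ.* y))     E.≈⟨ fromℤ-neg (+ suc m ℤ.* y) ⟩
    - fromℤ (+ suc m ℤ.* y)         E.≈⟨ -‿cong (fromℤ-*ⁿ (suc m) y) ⟩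
    - (suc m · 1# * fromℤ y)        E.≈⟨ -‿distribˡ-* _ _ ⟩
    - (suc m · 1#) * fromℤ y        E.∎

  fromℤ-1 : fromℤ (+ 1) ≈ 1#
  fromℤ-1 = +-identityʳ 1#

  fromℤ-cong : ∀ {x y} → x ≡ y → fromℤ x ≈ fromℤ y
  fromℤ-cong x≡y = reflexive (≡.cong fromℤ x≡y)

  almostCommutativeRing : AlmostCommutativeRing c ℓ₁
  almostCommutativeRing = fromCommutativeRing commutativeRing

  fromℤ-morphism : CommutativeRing.rawRing ℤₚ.+-*-commutativeRing -Raw-AlmostCommutative⟶ almostCommutativeRing
  fromℤ-morphism = record
    { ⟦_⟧    = fromℤ
    ; +-homo = fromℤ-+
    ; *-homo = fromℤ-*
    ; -‿homo = fromℤ-neg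
    ; 0-homo = refl
    ; 1-homo = fromℤ-1
    }

  fromℤ-weaklyDecidable : ∀ x y → Maybe (fromℤ x ≈ fromℤ y)
  fromℤ-weaklyDecidable x y with x ℤₚ.≟ y
  ... | yes x≡y = just (fromℤ-cong x≡y)
  ... | no  _   = nothing

  -- In this solver `con (+ 1)` denotes `fromℤ (+ 1)`, which is `1# + 0#` and only `≈` to `1#`.
  -- Where `1#` itself occurs it is passed as a variable, usually `u`, or adjusted by `fromℤ-1`.
  module Solver = RingSolver (CommutativeRing.rawRing ℤₚ.+-*-commutativeRing)
    almostCommutativeRing fromℤ-morphism fromℤ-weaklyDecidable
  open Solver using (solve; con; _:=_; _:+_; _:*_; _:-_; :-_)


  -- Order arithmetic without decidable comparison

  <-respˡ : ∀ {x y z} → x ≈ y → x < z → y < z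
  <-respˡ = <.<-respˡ-≈

  <-respʳ : ∀ {x y z} → x ≈ y → z < x → z < y
  <-respʳ = <.<-respʳ-≈

  <-trans : ∀ {x y z} → x < y → y < z → x < z
  <-trans = <.trans

  <-irrefl : ∀ {x y} → x ≈ y → ¬ x < y
  <-irrefl = <.irrefl

  <-asym : ∀ {x y} → x < y → ¬ y < x
  <-asym = <.asym

  x<y⇒0<y-x : ∀ {x y} → x < y → 0# < y - x
  x<y⇒0<y-x {x} {y} x<y =
    <-respˡ (-‿inverseˡ x) (<-respʳ (+-comm (- x) y) (+-monoʳ-< (- x) x<y))

  0<y-x⇒x<y : ∀ {x y} → 0# < y - x → x < y
  0<y-x⇒x<y {x} {y} 0<y-x =
    <-respˡ (+-identityʳ x)
      (<-respʳ (solve 2 (λ x y → x :+ (y :- x) := y) refl x y) (+-monoʳ-< x 0<y-x))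

  <-cotrans : ∀ {x z} → x < z → ∀ y → x < y ⊎ y < z
  <-cotrans x<z y with #-cotrans (Equivalence.from #⇔<⊎> (inj₁ x<z)) y
  ... | inj₁ x#y = [ inj₁ , (λ y<x → inj₂ (<-trans y<x x<z)) ]′ (Equivalence.to #⇔<⊎> x#y)
  ... | inj₂ y#z = [ inj₂ , (λ z<y → inj₁ (<-trans x<z z<y)) ]′ (Equivalence.to #⇔<⊎> y#z)

  ≮∧≯⇒≈ : ∀ {x y} → ¬ x < y → ¬ y < x → x ≈ y
  ≮∧≯⇒≈ x≮y y≮x = proj₁ (tight _ _) ([ x≮y , y≮x ]′ ∘ Equivalence.to #⇔<⊎>)

  ≤-respˡ : ∀ {x y z} → x ≈ y → x ≤ z → y ≤ z
  ≤-respˡ x≈y x≤z z<y = x≤z (<-respʳ (sym x≈y) z<y)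

  ≤-respʳ : ∀ {x y z} → x ≈ y → z ≤ x → z ≤ y
  ≤-respʳ x≈y z≤x y<z = z≤x (<-respˡ (sym x≈y) y<z)

  <⇒≤ : ∀ {x y} → x < y → x ≤ y
  <⇒≤ = <-asym

  ≤-refl : ∀ {x} → x ≤ x
  ≤-refl = <-irrefl refl

  <-≤-trans : ∀ {x y z} → x < y → y ≤ z → x < z
  <-≤-trans {z = z} x<y y≤z = [ (λ x<z → x<z) , ⊥-elim ∘ y≤z ]′ (<-cotrans x<y z)

  ≤-<-trans : ∀ {x y z} → x ≤ y → y < z → x < z
  ≤-<-trans {x = x} x≤y y<z = [ ⊥-elim ∘ x≤y , (λ x<z → x<z) ]′ (<-cotrans y<z x)

  ≤-trans : ∀ {x y z} → x ≤ y → y ≤ z → x ≤ z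
  ≤-trans x≤y y≤z z<x = x≤y (≤-<-trans y≤z z<x)

  x≤y⇒0≤y-x : ∀ {x y} → x ≤ y → 0# ≤ y - x
  x≤y⇒0≤y-x {x} {y} x≤y y-x<0 = x≤y
    (0<y-x⇒x<y (<-respʳ (solve 2 (λ x y → con (+ 0) :- (y :- x) := x :- y) refl x y) (x<y⇒0<y-x y-x<0)))

  0≤y-x⇒x≤y : ∀ {x y} → 0# ≤ y - x → x ≤ y
  0≤y-x⇒x≤y {x} {y} 0≤y-x y<x = 0≤y-x
    (0<y-x⇒x<y (<-respʳ (solve 2 (λ x y → x :- y := con (+ 0) :- (y :- x)) refl x y) (x<y⇒0<y-x y<x)))

  +-pos-nonneg : ∀ {x y} → 0# < x → 0# ≤ y → 0# < x + y
  +-pos-nonneg {x} {y} 0<x 0≤y with <-cotrans 0<x (x + y)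
  ... | inj₁ 0<x+y = 0<x+y
  ... | inj₂ x+y<x = contradiction
    (0<y-x⇒x<y (<-respʳ (solve 2 (λ x y → x :- (x :+ y) := con (+ 0) :- y) refl x y) (x<y⇒0<y-x x+y<x))) 0≤y

  +-nonneg-pos : ∀ {x y} → 0# ≤ x → 0# < y → 0# < x + y
  +-nonneg-pos 0≤x 0<y = <-respʳ (+-comm _ _) (+-pos-nonneg 0<y 0≤x)

  +-pos : ∀ {x y} → 0# < x → 0# < y → 0# < x + y
  +-pos 0<x 0<y = +-pos-nonneg 0<x (<⇒≤ 0<y)

  +-nonneg : ∀ {x y} → 0# ≤ x → 0# ≤ y → 0# ≤ x + y
  +-nonneg {x} {y} 0≤x 0≤y x+y<0 = 0≤x
    (0<y-x⇒x<y (<-respʳ (solve 2 (λ x y → y :+ (con (+ 0) :- (x :+ y)) := con (+ 0) :- x) refl x y)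
      (+-nonneg-pos 0≤y (x<y⇒0<y-x x+y<0))))

  -- A non-negative number cannot be sorted into positive or zero outright. The double negation is
  -- enough for goals that are themselves negations, as every `_≤_` is; `x*y≈0⇒¬¬` serves in the
  -- same way.
  nonneg-¬¬ : ∀ {x} → 0# ≤ x → ¬ ¬ (0# < x ⊎ x ≈ 0#)
  nonneg-¬¬ 0≤x ¬either = ¬either (inj₂ (≮∧≯⇒≈ 0≤x (¬either ∘ inj₁)))

  *-nonneg : ∀ {x y} → 0# ≤ x → 0# ≤ y → 0# ≤ x * y
  *-nonneg 0≤x 0≤y xy<0 = nonneg-¬¬ 0≤x λ where
    (inj₂ x≈0) → <-irrefl (trans (*-congʳ x≈0) (zeroˡ _)) xy<0
    (inj₁ 0<x) → nonneg-¬¬ 0≤y λ where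
      (inj₂ y≈0) → <-irrefl (trans (*-congˡ y≈0) (zeroʳ _)) xy<0
      (inj₁ 0<y) → <-asym xy<0 (*-pos 0<x 0<y)

  0<1 : 0# < 1#
  0<1 with Equivalence.to #⇔<⊎> (HeytingProperties.1#0 heytingCommutativeRing)
  ... | inj₂ 0<1 = 0<1
  ... | inj₁ 1<0 = <-respʳ fromℤ-1
    (<-respʳ (solve 0 ((con (+ 0) :- con (+ 1)) :* (con (+ 0) :- con (+ 1)) := con (+ 1)) refl)
      (*-pos 0<-1 0<-1))
    where
    0<-1 : 0# < 0# - fromℤ (+ 1)
    0<-1 = x<y⇒0<y-x (<-respˡ (sym fromℤ-1) 1<0)

  x*y≈0⇒¬¬ : ∀ {x y} → x * y ≈ 0# → ¬ ¬ (x ≈ 0# ⊎ y ≈ 0#)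
  x*y≈0⇒¬¬ xy≈0 ¬either =
    ¬either (inj₁ (proj₁ (tight _ _) λ x#0 →
    ¬either (inj₂ (proj₁ (tight _ _) λ y#0 →
      proj₂ (tight _ _) xy≈0 (HeytingProperties.x#0y#0→xy#0 heytingCommutativeRing x#0 y#0)))))

  *-cancelʳ-pos : ∀ {x y z} → 0# < z → x * z ≈ y * z → x ≈ y
  *-cancelʳ-pos {x} {y} {z} 0<z xz≈yz = proj₁ (tight _ _) λ x#y →
    x*y≈0⇒¬¬ [x-y]z≈0 λ where
      (inj₁ x-y≈0) → proj₂ (tight _ _) (trans (solve 2 (λ x y → x := (x :- y) :+ y) refl x y)
        (trans (+-congʳ x-y≈0) (+-identityˡ y))) x#y
      (inj₂ z≈0)   → <-irrefl (sym z≈0) 0<z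
    where
    [x-y]z≈0 : (x - y) * z ≈ 0#
    [x-y]z≈0 = trans (solve 3 (λ x y z → (x :- y) :* z := x :* z :- y :* z) refl x y z)
      (trans (+-congʳ xz≈yz) (-‿inverseʳ _))

  *-cancel-pos : ∀ {x y} → 0# < x → 0# < x * y → 0# < y
  *-cancel-pos {x} {y} 0<x 0<xy with Equivalence.to #⇔<⊎> y#0
    where
    -- The sign of `y` can be decided only once `y` is known to be apart from `0#`; its inverse is
    -- `x` times the inverse of `x * y`.
    x⁻¹ = #⇒invertible (Equivalence.from #⇔<⊎> (inj₂ 0<xy))
    y#0 : y # 0#
    y#0 = HeytingProperties.invertibleʳ⇒# heytingCommutativeRing (x * proj₁ x⁻¹ ,
      trans (solve 3 (λ x y w → (y :- con (+ 0)) :* (x :* w) := (x :* y :- con (+ 0)) :* w) refl x y (proj₁ x⁻¹))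
      (proj₂ (proj₂ x⁻¹)))
  ... | inj₂ 0<y = 0<y
  ... | inj₁ y<0 = contradiction (+-pos 0<xy (*-pos 0<x (x<y⇒0<y-x y<0)))
    (<-irrefl (solve 2 (λ x y → con (+ 0) := x :* y :+ x :* (con (+ 0) :- y)) refl x y))

  *-cancelʳ-nonneg : ∀ {x y} → 0# < y → 0# ≤ x * y → 0# ≤ x
  *-cancelʳ-nonneg {x} {y} 0<y 0≤xy x<0 = <-irrefl refl (<-respʳ
    (solve 2 (λ x y → x :* y :+ y :* (con (+ 0) :- x) := con (+ 0)) refl x y)
    (+-nonneg-pos 0≤xy (*-pos 0<y (x<y⇒0<y-x x<0))))

  x*y≈1⇒0<y : ∀ {x y} → 0# < x → x * y ≈ 1# → 0# < y
  x*y≈1⇒0<y 0<x xy≈1 = *-cancel-pos 0<x (<-respʳ (sym xy≈1) 0<1)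

  fromℤ-nonneg : ∀ {z} → + 0 ℤ.≤ z → 0# ≤ fromℤ z
  fromℤ-nonneg {+ zero}  _ = ≤-refl
  fromℤ-nonneg {+ suc n} _ = +-nonneg (<⇒≤ 0<1) (fromℤ-nonneg {+ n} (ℤ.+≤+ ℕ.z≤n))

  fromℤ-pos : ∀ {z} → + 0 ℤ.< z → 0# < fromℤ z
  fromℤ-pos {+ suc n} _ = +-pos-nonneg 0<1 (fromℤ-nonneg {+ n} (ℤ.+≤+ ℕ.z≤n))
  fromℤ-pos {+ zero} (ℤ.+<+ ())

  fromℤ-sub : ∀ x y → fromℤ (x ℤ.- y) ≈ fromℤ x - fromℤ y
  fromℤ-sub x y = trans (fromℤ-+ x (ℤ.- y)) (+-congˡ (fromℤ-neg y))

  fromℤ-mono-< : ∀ {x y} → x ℤ.< y → fromℤ x < fromℤ y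
  fromℤ-mono-< {x} {y} x<y = 0<y-x⇒x<y (<-respʳ (fromℤ-sub y x) (fromℤ-pos 
    (≡.subst (ℤ._< y ℤ.- x) (ℤₚ.+-inverseʳ x) (ℤₚ.+-monoˡ-< (ℤ.- x) x<y))))

  fromℤ-mono-≤ : ∀ {x y} → x ℤ.≤ y → fromℤ x ≤ fromℤ y
  fromℤ-mono-≤ {x} {y} x≤y = 0≤y-x⇒x≤y (≤-respʳ (fromℤ-sub y x) (fromℤ-nonneg (ℤₚ.i≤j⇒0≤j-i x≤y)))

  fromℤ-cancel-< : ∀ {x y} → fromℤ x < fromℤ y → x ℤ.< y
  fromℤ-cancel-< x<y = ℤₚ.≰⇒> λ y≤x → fromℤ-mono-≤ y≤x x<y

  fromℤ-cancel-≤ : ∀ {x y} → fromℤ x ≤ fromℤ y → x ℤ.≤ y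
  fromℤ-cancel-≤ x≤y = ℤₚ.≮⇒≥ λ y<x → x≤y (fromℤ-mono-< y<x)

i<1+j⇒i≤j : ∀ {i j} → i ℤ.< ℤ.suc j → i ℤ.≤ j
i<1+j⇒i≤j {i} {j} i<1+j = ≡.subst (i ℤ.≤_) (ℤₚ.pred-suc j) (ℤₚ.i<j⇒i≤pred[j] i<1+j)

-- Jacobi's algorithm in division-free form

module Expansions {c ℓ₁ ℓ₂ ℓ₃} (R : RealNumbers c ℓ₁ ℓ₂ ℓ₃) where
  open OrderedField R
  open Solver using (solve; con; _:=_; _:+_; _:*_; _:-_; :-_)

  -- A Jacobi expansion past its first step, where a and b are known to be
  -- positive and non-negative; the two equations are the recursion for α and β
  -- freed of divisions.
  record Expansion (α β : ℕ → Carrier) (a b : ℕ → ℤ) : Set (c Level.⊔ ℓ₁ Level.⊔ ℓ₃) where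
    field
      1<α    : ∀ n → 1# < α n
      0≤β    : ∀ n → 0# ≤ β n
      β<α    : ∀ n → β n < α n
      1≤a    : ∀ n → + 1 ℤ.≤ a n
      0≤b    : ∀ n → + 0 ℤ.≤ b n
      α-next : ∀ n → α n * α (suc n) ≈ fromℤ (a n) * α (suc n) + β (suc n)
      β-next : ∀ n → β n * α (suc n) ≈ fromℤ (b n) * α (suc n) + 1#

    0<α : ∀ n → 0# < α n
    0<α n = <-trans 0<1 (1<α n)

  shift : ∀ {α β a b} m → Expansion α β a b →
    Expansion (λ n → α (n ℕ.+ m)) (λ n → β (n ℕ.+ m)) (λ n → a (n ℕ.+ m)) (λ n → b (n ℕ.+ m))
  shift m e = record
    { 1<α    = λ n → 1<α (n ℕ.+ m)
    ; 0≤β    = λ n → 0≤β (n ℕ.+ m)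
    ; β<α    = λ n → β<α (n ℕ.+ m)
    ; 1≤a    = λ n → 1≤a (n ℕ.+ m)
    ; 0≤b    = λ n → 0≤b (n ℕ.+ m)
    ; α-next = λ n → α-next (n ℕ.+ m)
    ; β-next = λ n → β-next (n ℕ.+ m)
    }
    where open Expansion e

  module Jacobi {α₀ β₀ a b} (mcf : IsMCF α₀ β₀ a b) where
    open IsMCF mcf public

    0<β-b : ∀ n → 0# < β n - fromℤ (b n)
    0<β-b n with Equivalence.to #⇔<⊎> (nonInteger n (b n))
    ... | inj₁ β<b = contradiction β<b (proj₁ (b-floor n))
    ... | inj₂ b<β = x<y⇒0<y-x b<β

    [x-a]<1 : ∀ {z x} → IsFloorOf z x → 0# < 1# - (x - fromℤ z)
    [x-a]<1 {z} {x} (_ , x<1+z) = <-respʳ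
      (trans (+-congʳ (trans (fromℤ-+ (+ 1) z) (+-congʳ fromℤ-1)))
        (solve 3 (λ u z x → u :+ z :- x := u :- (x :- z)) refl 1# (fromℤ z) x))
      (x<y⇒0<y-x x<1+z)

    [β-b]α≈1 : ∀ n → (β n - fromℤ (b n)) * α (suc n) ≈ 1#
    [β-b]α≈1 n = trans (*-congˡ (α-step n)) (proj₂ (proj₂ (#⇒invertible (nonInteger n (b n)))))

    β≈[α-a]α : ∀ n → β (suc n) ≈ (α n - fromℤ (a n)) * α (suc n)
    β≈[α-a]α n = trans (β-step n) (*-congˡ (sym (α-step n)))

    α-next : ∀ n → α n * α (suc n) ≈ fromℤ (a n) * α (suc n) + β (suc n)
    α-next n = trans
      (solve 3 (λ x z y → x :* y := z :* y :+ (x :- z) :* y) refl (α n) (fromℤ (a n)) (α (suc n)))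
      (+-congˡ (sym (β≈[α-a]α n)))

    β-next : ∀ n → β n * α (suc n) ≈ fromℤ (b n) * α (suc n) + 1#
    β-next n = trans
      (solve 3 (λ x z y → x :* y := z :* y :+ (x :- z) :* y) refl (β n) (fromℤ (b n)) (α (suc n)))
      (+-congˡ ([β-b]α≈1 n))

    0<α : ∀ n → 0# < α (suc n)
    0<α n = x*y≈1⇒0<y (0<β-b n) ([β-b]α≈1 n)

    1<α : ∀ n → 1# < α (suc n)
    1<α n = 0<y-x⇒x<y (<-respʳ
      (trans (solve 3 (λ u x y → y :* (u :- x) := y :* u :- x :* y) refl 1# (β n - fromℤ (b n)) (α (suc n)))
        (+-cong (*-identityʳ _) (-‿cong ([β-b]α≈1 n))))
      (*-pos (0<α n) ([x-a]<1 {b n} (b-floor n))))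

    0≤β : ∀ n → 0# ≤ β (suc n)
    0≤β n = ≤-respʳ (sym (β≈[α-a]α n))
      (*-nonneg (x≤y⇒0≤y-x (proj₁ (a-floor n))) (<⇒≤ (0<α n)))

    β<α : ∀ n → β (suc n) < α (suc n)
    β<α n = 0<y-x⇒x<y (<-respʳ
      (trans (solve 3 (λ u x y → (u :- x) :* y := u :* y :- x :* y) refl 1# (α n - fromℤ (a n)) (α (suc n)))
        (+-cong (*-identityˡ _) (-‿cong (sym (β≈[α-a]α n)))))
      (*-pos ([x-a]<1 {a n} (a-floor n)) (0<α n)))

    tail : Expansion (λ n → α (suc n)) (λ n → β (suc n)) (λ n → a (suc n)) (λ n → b (suc n))
    tail = record
      { 1<α    = 1<α
      ; 0≤β    = 0≤β
      ; β<α    = β<α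
      ; 1≤a    = λ n → i<1+j⇒i≤j (fromℤ-cancel-<
          (≤-<-trans (≤-respˡ (sym fromℤ-1) (<⇒≤ (1<α n))) (proj₂ (a-floor (suc n)))))
      ; 0≤b    = λ n → i<1+j⇒i≤j (fromℤ-cancel-< (≤-<-trans (0≤β n) (proj₂ (b-floor (suc n)))))
      ; α-next = α-next ∘ suc
      ; β-next = β-next ∘ suc
      }

-- Sequences orthogonal to an expansion

module Solutions {c ℓ₁ ℓ₂ ℓ₃} (R : RealNumbers c ℓ₁ ℓ₂ ℓ₃) where
  open OrderedField R
  open Expansions R
  open Solver using (solve; con; _:=_; _:+_; _:*_; _:-_; :-_)

  -- The bound |x| ≤ M, split into its two sides because no absolute value is at hand.
  Within : Carrier → Carrier → Set ℓ₃
  Within M x = 0# ≤ M + x × 0# ≤ M - x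

  Within-neg : ∀ {M x} → Within M x → Within M (- x)
  Within-neg (0≤M+x , 0≤M-x) = 0≤M-x , ≤-respʳ (+-congˡ (sym (-‿involutive _))) 0≤M+x

  ≤0⇒0≤- : ∀ {x} → x ≤ 0# → 0# ≤ - x
  ≤0⇒0≤- x≤0 = ≤-respʳ (+-identityˡ _) (x≤y⇒0≤y-x x≤0)

  module _ {α β x₃ x₂ x₁} (1<α : 1# < α) (0≤β : 0# ≤ β) (β<α : β < α)
    (orthogonal : x₃ * α + x₂ * β + x₁ ≈ 0#) where

    -- The vanishing form is regrouped so that a wrong sign makes it positive: for `0# < x₂` as x₃
    -- (α - 1) + x₂ β + (x₃ + x₁), for `0# < x₁` as x₃ (α - β) + (x₃ + x₂) β + x₁.
    signs : 0# < x₃ → 0# ≤ x₃ + x₂ → 0# ≤ x₃ + x₁ → x₂ ≤ 0# × x₁ ≤ 0#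
    signs 0<x₃ 0≤x₃+x₂ 0≤x₃+x₁ = x₂≤0 , x₁≤0
      where
      x₂≤0 : x₂ ≤ 0#
      x₂≤0 0<x₂ = <-irrefl (sym orthogonal) (<-respʳ
        (trans (solve 6 (λ x₃ x₂ x₁ α β u → x₃ :* (α :- u) :+ x₂ :* β :+ (x₃ :+ x₁) :=
                                           (x₃ :* α :+ x₂ :* β :+ x₁) :+ (x₃ :- x₃ :* u)) refl x₃ x₂ x₁ α β 1#)
          (trans (+-congˡ (trans (+-congˡ (-‿cong (*-identityʳ x₃))) (-‿inverseʳ x₃))) (+-identityʳ _)))
        (+-pos-nonneg (+-pos-nonneg (*-pos 0<x₃ (x<y⇒0<y-x 1<α)) (*-nonneg (<⇒≤ 0<x₂) 0≤β)) 0≤x₃+x₁))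
      x₁≤0 : x₁ ≤ 0#
      x₁≤0 0<x₁ = <-irrefl (sym orthogonal) (<-respʳ
        (solve 5 (λ x₃ x₂ x₁ α β → x₃ :* (α :- β) :+ (x₃ :+ x₂) :* β :+ x₁ :=
                                  x₃ :* α :+ x₂ :* β :+ x₁) refl x₃ x₂ x₁ α β)
        (+-pos (+-pos-nonneg (*-pos 0<x₃ (x<y⇒0<y-x β<α)) (*-nonneg 0≤x₃+x₂ 0≤β)) 0<x₁))

    -- If `x₃` exceeded `M`, it would dominate `x₂` and `x₁`, which would then be non-positive by
    -- `signs`; the recurrence would give x₃ ≤ x₀ ≤ M. The lower bound follows by applying this to
    -- the negated sequence.
    no-record : ∀ {M a b x₀} → 0# ≤ M → 0# ≤ a → 0# ≤ b → x₃ ≈ a * x₂ + b * x₁ + x₀ →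
      Within M x₂ → Within M x₁ → Within M x₀ → 0# ≤ M - x₃
    no-record {M} {a} {b} {x₀} 0≤M 0≤a 0≤b x₃≈ (0≤M+x₂ , _) (0≤M+x₁ , _) (_ , 0≤M-x₀) M-x₃<0 =
      let x₂≤0 , x₁≤0 = signs 0<x₃ (above 0≤M+x₂) (above 0≤M+x₁) in
      ≤-respʳ
        (trans (solve 6 (λ M a b x₂ x₁ x₀ → (M :- x₀) :+ a :* :- x₂ :+ b :* :- x₁ :=
                                         M :- (a :* x₂ :+ b :* x₁ :+ x₀)) refl M a b x₂ x₁ x₀)
          (+-congˡ (-‿cong (sym x₃≈))))
        (+-nonneg (+-nonneg 0≤M-x₀ (*-nonneg 0≤a (≤0⇒0≤- x₂≤0))) (*-nonneg 0≤b (≤0⇒0≤- x₁≤0)))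
        M-x₃<0
      where
      0<x₃-M : 0# < x₃ - M
      0<x₃-M = <-respʳ (solve 2 (λ M x → con (+ 0) :- (M :- x) := x :- M) refl M x₃) (x<y⇒0<y-x M-x₃<0)
      above : ∀ {x} → 0# ≤ M + x → 0# ≤ x₃ + x
      above {x} 0≤M+x = <⇒≤ (<-respʳ (solve 3 (λ M x₃ x → (x₃ :- M) :+ (M :+ x) := x₃ :+ x) refl M x₃ x)
        (+-pos-nonneg 0<x₃-M 0≤M+x))
      0<x₃ : 0# < x₃
      0<x₃ = <-respʳ (solve 2 (λ M x → (x :- M) :+ M := x) refl M x₃) (+-pos-nonneg 0<x₃-M 0≤M)

    -- This is the equality case of `no-record`: in M = a x₂ + b x₁ + x₀ the first two terms are
    -- non-positive and x₀ ≤ M, so nothing may be lost. As `a` is at least 1 this forces `x₂` to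
    -- vanish; `b` may be 0, so `x₁` keeps only its sign.
    peak : ∀ {M a b x₀} → 0# < M → 1# ≤ a → 0# ≤ b → x₃ ≈ a * x₂ + b * x₁ + x₀ → x₃ ≈ M →
      Within M x₂ → Within M x₁ → Within M x₀ → x₂ ≈ 0# × x₁ ≤ 0# × x₀ ≈ M
    peak {M} {a} {b} {x₀} 0<M 1≤a 0≤b x₃≈ x₃≈M (0≤M+x₂ , _) (0≤M+x₁ , _) (_ , 0≤M-x₀)
      with signs (<-respʳ (sym x₃≈M) 0<M) (≤-respʳ (+-congʳ (sym x₃≈M)) 0≤M+x₂)
             (≤-respʳ (+-congʳ (sym x₃≈M)) 0≤M+x₁)
    ... | x₂≤0 , x₁≤0 = ≮∧≯⇒≈ 0≤x₂ x₂≤0 , x₁≤0 , ≮∧≯⇒≈ M≤x₀ (0≤y-x⇒x≤y 0≤M-x₀)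
      where
      M≈ : a * x₂ + b * x₁ + x₀ ≈ M
      M≈ = trans (sym x₃≈) x₃≈M
      0≤-x₂ = ≤0⇒0≤- x₂≤0
      0≤-bx₁ = *-nonneg 0≤b (≤0⇒0≤- x₁≤0)
      0≤x₂ : 0# ≤ x₂
      0≤x₂ = ≤-respʳ
        (trans (solve 7 (λ M a b x₂ x₁ x₀ u → (M :- x₀) :+ (a :- u) :* :- x₂ :+ b :* :- x₁ :=
                                           u :* x₂ :+ (M :- (a :* x₂ :+ b :* x₁ :+ x₀))) refl M a b x₂ x₁ x₀ 1#)
          (trans (+-cong (*-identityˡ x₂) (trans (+-congˡ (-‿cong M≈)) (-‿inverseʳ M))) (+-identityʳ x₂)))
        (+-nonneg (+-nonneg 0≤M-x₀ (*-nonneg (x≤y⇒0≤y-x 1≤a) 0≤-x₂)) 0≤-bx₁)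
      M≤x₀ : M ≤ x₀
      M≤x₀ = 0≤y-x⇒x≤y (≤-respʳ
        (trans (solve 5 (λ a b x₂ x₁ x₀ → a :* :- x₂ :+ b :* :- x₁ :=
                                       x₀ :- (a :* x₂ :+ b :* x₁ :+ x₀)) refl a b x₂ x₁ x₀)
          (+-congˡ (-‿cong M≈)))
        (+-nonneg (*-nonneg (≤-trans (<⇒≤ 0<1) 1≤a) 0≤-x₂) 0≤-bx₁))

  IsSolution : (a b : ℕ → ℤ) → (ℕ → Carrier) → Set ℓ₁
  IsSolution a b X = ∀ n → X (3 ℕ.+ n) ≈ fromℤ (a n) * X (2 ℕ.+ n) + fromℤ (b n) * X (1 ℕ.+ n) + X n

  pairing : (α β X : ℕ → Carrier) → ℕ → Carrier
  pairing α β X n = X (2 ℕ.+ n) * α n + X (1 ℕ.+ n) * β n + X n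

  IsSolution-neg : ∀ {a b X} → IsSolution a b X → IsSolution a b (λ n → - X n)
  IsSolution-neg {a} {b} {X} sol n = trans (-‿cong (sol n))
    (solve 5 (λ a b x₂ x₁ x₀ → :- (a :* x₂ :+ b :* x₁ :+ x₀) := a :* :- x₂ :+ b :* :- x₁ :+ :- x₀) refl
      (fromℤ (a n)) (fromℤ (b n)) (X (2 ℕ.+ n)) (X (1 ℕ.+ n)) (X n))

  pairing-neg : ∀ α β X n → pairing α β (λ n → - X n) n ≈ - pairing α β X n
  pairing-neg α β X n =
    solve 5 (λ α β x₂ x₁ x₀ → :- x₂ :* α :+ :- x₁ :* β :+ :- x₀ := :- (x₂ :* α :+ x₁ :* β :+ x₀)) refl
      (α n) (β n) (X (2 ℕ.+ n)) (X (1 ℕ.+ n)) (X n)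

  -- Only the two equations of an expansion are needed, so this also covers the
  -- first step of the algorithm.
  pairing-next : ∀ {α β a b X} n →
    α n * α (suc n) ≈ fromℤ (a n) * α (suc n) + β (suc n) →
    β n * α (suc n) ≈ fromℤ (b n) * α (suc n) + 1# →
    IsSolution a b X → pairing α β X (suc n) ≈ pairing α β X n * α (suc n)
  pairing-next {α} {β} {a} {b} {X} n α-next β-next sol = begin
    X (3 ℕ.+ n) * α′ + x₂ * β′ + x₁
      ≈⟨ +-congʳ (+-congʳ (*-congʳ (sol n))) ⟩
    (fa * x₂ + fb * x₁ + x₀) * α′ + x₂ * β′ + x₁
      ≈⟨ +-congˡ (sym (*-identityʳ x₁)) ⟩
    (fa * x₂ + fb * x₁ + x₀) * α′ + x₂ * β′ + x₁ * 1#
      ≈⟨ solve 8 (λ fa fb x₂ x₁ x₀ α′ β′ u → (fa :* x₂ :+ fb :* x₁ :+ x₀) :* α′ :+ x₂ :* β′ :+ x₁ :* u :=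
           x₂ :* (fa :* α′ :+ β′) :+ x₁ :* (fb :* α′ :+ u) :+ x₀ :* α′) refl fa fb x₂ x₁ x₀ α′ β′ 1# ⟩
    x₂ * (fa * α′ + β′) + x₁ * (fb * α′ + 1#) + x₀ * α′
      ≈⟨ +-congʳ (+-cong (*-congˡ (sym α-next)) (*-congˡ (sym β-next))) ⟩
    x₂ * (α n * α′) + x₁ * (β n * α′) + x₀ * α′
      ≈⟨ solve 6 (λ x₂ x₁ x₀ α β α′ → x₂ :* (α :* α′) :+ x₁ :* (β :* α′) :+ x₀ :* α′ :=
           (x₂ :* α :+ x₁ :* β :+ x₀) :* α′) refl x₂ x₁ x₀ (α n) (β n) α′ ⟩
    (x₂ * α n + x₁ * β n + x₀) * α′ ∎
    where
    open SetoidReasoning setoid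
    x₂ = X (2 ℕ.+ n)
    x₁ = X (1 ℕ.+ n)
    x₀ = X n
    α′ = α (suc n)
    β′ = β (suc n)
    fa = fromℤ (a n)
    fb = fromℤ (b n)

  module Orthogonal {α β a b} (e : Expansion α β a b) where
    open Expansion e

    orthogonal : ∀ {X} → IsSolution a b X → pairing α β X 0 ≈ 0# → ∀ n → pairing α β X n ≈ 0#
    orthogonal sol start zero    = start
    orthogonal {X} sol start (suc n) = trans (pairing-next {α} {β} {a} {b} {X} n (α-next n) (β-next n) sol)
      (trans (*-congʳ (orthogonal sol start n)) (zeroˡ _))

    bounded : ∀ {X M} → IsSolution a b X → pairing α β X 0 ≈ 0# → 0# ≤ M →
      Within M (X 0) → Within M (X 1) → Within M (X 2) → ∀ n → Within M (X n)
    bounded {X} {M} sol start 0≤M w₀ w₁ w₂ = λ n → proj₁ (window n)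
      where
      window : ∀ n → Within M (X n) × Within M (X (1 ℕ.+ n)) × Within M (X (2 ℕ.+ n))
      window zero    = w₀ , w₁ , w₂
      window (suc n) with window n
      ... | v₀ , v₁ , v₂ = v₁ , v₂ , lower , upper
        where
        0≤a = fromℤ-nonneg (ℤₚ.≤-trans (ℤ.+≤+ ℕ.z≤n) (1≤a n))
        0≤b′ = fromℤ-nonneg (0≤b n)
        upper = no-record (1<α (suc n)) (0≤β (suc n)) (β<α (suc n)) (orthogonal sol start (suc n))
          0≤M 0≤a 0≤b′ (sol n) v₂ v₁ v₀
        lower = ≤-respʳ (+-congˡ (-‿involutive _))
          (no-record (1<α (suc n)) (0≤β (suc n)) (β<α (suc n))
            (trans (pairing-neg α β X (suc n)) (trans (-‿cong (orthogonal sol start (suc n))) -0#≈0#))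
            0≤M 0≤a 0≤b′ (IsSolution-neg {a} {b} {X} sol n) (Within-neg v₂) (Within-neg v₁) (Within-neg v₀))

    -- If X₆ = M, one use of `peak` gives X₅ = 0, X₄ ≤ 0 and X₃ = M, and a second one gives X₂ = 0.
    -- Then X₄ = a₁ M + X₁ ≥ M - M = 0, so X₄ = 0 as well, and the form at 4 reduces to M α₄, which
    -- is positive. Two backward jumps of length three are the source of the index 6.
    not-maximal : ∀ {X M} → IsSolution a b X → pairing α β X 0 ≈ 0# → 0# < M →
      (∀ n → Within M (X n)) → ¬ X 6 ≈ M
    not-maximal {X} {M} sol start 0<M w X₆≈M = <-irrefl (sym Mα≈0) (*-pos 0<M (0<α 4))
      where
      orth = orthogonal sol start
      peak-at : ∀ n → X (3 ℕ.+ n) ≈ M → X (2 ℕ.+ n) ≈ 0# × X (1 ℕ.+ n) ≤ 0# × X n ≈ M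
      peak-at n X≈M = peak (1<α (suc n)) (0≤β (suc n)) (β<α (suc n)) (orth (suc n)) 0<M
        (≤-respˡ fromℤ-1 (fromℤ-mono-≤ (1≤a n))) (fromℤ-nonneg (0≤b n)) (sol n) X≈M (w _) (w _) (w _)
      at₆ = peak-at 3 X₆≈M
      at₃ = peak-at 0 (proj₂ (proj₂ at₆))
      0≤X₄ : 0# ≤ X 4
      0≤X₄ = ≤-respʳ
        (trans (solve 6 (λ a b x₂ x₁ M u → (a :- u) :* M :+ (u :* M :+ x₁) := a :* M :+ b :* con (+ 0) :+ x₁) refl
                 (fromℤ (a 1)) (fromℤ (b 1)) (X 2) (X 1) M 1#)
          (trans (+-congʳ (+-cong (*-congˡ (sym (proj₂ (proj₂ at₆)))) (*-congˡ (sym (proj₁ at₃)))))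
            (sym (sol 1))))
        (+-nonneg (*-nonneg (x≤y⇒0≤y-x (≤-respˡ fromℤ-1 (fromℤ-mono-≤ (1≤a 1)))) (<⇒≤ 0<M))
          (≤-respʳ (+-congʳ (sym (*-identityˡ M))) (proj₁ (w 1))))
      Mα≈0 : M * α 4 ≈ 0#
      Mα≈0 = trans (solve 3 (λ M α β → M :* α := M :* α :+ con (+ 0) :* β :+ con (+ 0)) refl M (α 4) (β 4))
        (trans (+-cong (+-cong (*-congʳ (sym X₆≈M)) (*-congʳ (sym (proj₁ at₆))))
            (sym (≮∧≯⇒≈ 0≤X₄ (proj₁ (proj₂ at₆)))))
          (orth 4))

-- Integer solutions and linear independence of 1, α, β

IsSolutionℤ : (a b X : ℕ → ℤ) → Set
IsSolutionℤ a b X = ∀ n → X (3 ℕ.+ n) ≡ a n ℤ.* X (2 ℕ.+ n) ℤ.+ b n ℤ.* X (1 ℕ.+ n) ℤ.+ X n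

solution : (a b : ℕ → ℤ) (x₀ x₁ x₂ : ℤ) → ℕ → ℤ
solution a b x₀ x₁ x₂ 0 = x₀
solution a b x₀ x₁ x₂ 1 = x₁
solution a b x₀ x₁ x₂ 2 = x₂
solution a b x₀ x₁ x₂ (suc (suc (suc n))) =
  a n ℤ.* solution a b x₀ x₁ x₂ (suc (suc n)) ℤ.+ b n ℤ.* solution a b x₀ x₁ x₂ (suc n)
    ℤ.+ solution a b x₀ x₁ x₂ n

∣∣≤-pred : ∀ {m} x → ∣ x ∣ ℕ.≤ suc m → x ≢ + suc m → ℤ.- x ≢ + suc m → ∣ x ∣ ℕ.≤ m
∣∣≤-pred (+ n)    n≤ x≢ -x≢ = ℕₚ.≤-pred (ℕₚ.≤∧≢⇒< n≤ (x≢ ∘ ≡.cong (λ i → + i)))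
∣∣≤-pred -[1+ n ] n≤ x≢ -x≢ = ℕₚ.≤-pred (ℕₚ.≤∧≢⇒< n≤ (-x≢ ∘ ≡.cong (λ i → + i)))

-- The recurrence also runs backwards over ℤ, because its oldest term has coefficient 1.
solution-zeroˡ : ∀ {a b X} → IsSolutionℤ a b X → ∀ n →
  X (1 ℕ.+ n) ≡ + 0 → X (2 ℕ.+ n) ≡ + 0 → X (3 ℕ.+ n) ≡ + 0 → X n ≡ + 0
solution-zeroˡ {a} {b} {X} sol n X₁≡0 X₂≡0 X₃≡0 = ≡.sym (begin
  + 0             ≡⟨ X₃≡0 ⟨
  X (3 ℕ.+ n)     ≡⟨ sol n ⟩
  a n ℤ.* X (2 ℕ.+ n) ℤ.+ b n ℤ.* X (1 ℕ.+ n) ℤ.+ X n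
    ≡⟨ ≡.cong₂ (λ x y → a n ℤ.* x ℤ.+ b n ℤ.* y ℤ.+ X n) X₂≡0 X₁≡0 ⟩
  a n ℤ.* + 0 ℤ.+ b n ℤ.* + 0 ℤ.+ X n
    ≡⟨ ≡.cong₂ (λ x y → x ℤ.+ y ℤ.+ X n) (ℤₚ.*-zeroʳ (a n)) (ℤₚ.*-zeroʳ (b n)) ⟩
  + 0 ℤ.+ X n     ≡⟨ ℤₚ.+-identityˡ (X n) ⟩
  X n             ∎)
  where open ≡.≡-Reasoning

module Independence {c ℓ₁ ℓ₂ ℓ₃} (R : RealNumbers c ℓ₁ ℓ₂ ℓ₃) where
  open OrderedField R
  open Expansions R
  open Solutions R
  open Solver using (solve; con; _:=_; _:+_; _:*_; _:-_; :-_)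

  embed : ∀ {a b X} → IsSolutionℤ a b X → IsSolution a b (fromℤ ∘ X)
  embed {a} {b} {X} sol n = trans (fromℤ-cong (sol n))
    (trans (fromℤ-+ (aX ℤ.+ bX) (X n)) (+-congʳ (trans (fromℤ-+ aX bX)
      (+-cong (fromℤ-* (a n) (X (2 ℕ.+ n))) (fromℤ-* (b n) (X (1 ℕ.+ n)))))))
    where
    aX = a n ℤ.* X (2 ℕ.+ n)
    bX = b n ℤ.* X (1 ℕ.+ n)

  ∣∣≤⇒Within : ∀ {m} x → ∣ x ∣ ℕ.≤ m → Within (fromℤ (+ m)) (fromℤ x)
  ∣∣≤⇒Within {m} (+ n) n≤m =
    +-nonneg (fromℤ-nonneg {+ m} (ℤ.+≤+ ℕ.z≤n)) (fromℤ-nonneg {+ n} (ℤ.+≤+ ℕ.z≤n)) ,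
    x≤y⇒0≤y-x (fromℤ-mono-≤ (ℤ.+≤+ n≤m))
  ∣∣≤⇒Within {m} -[1+ n ] n<m = Within-neg (∣∣≤⇒Within (+ suc n) n<m)

  Within⇒∣∣≤ : ∀ {m} x → Within (fromℤ (+ m)) (fromℤ x) → ∣ x ∣ ℕ.≤ m
  Within⇒∣∣≤ (+ n)    (_ , 0≤m-n) = ℤₚ.drop‿+≤+ (fromℤ-cancel-≤ (0≤y-x⇒x≤y 0≤m-n))
  Within⇒∣∣≤ -[1+ n ] (0≤m-n , _) = ℤₚ.drop‿+≤+ (fromℤ-cancel-≤ {+ suc n} (0≤y-x⇒x≤y 0≤m-n))

  -- Induction on the bound. By `not-maximal`, applied to `X` and to its negative from the offsets
  -- 0, 1 and 2, the window at 6 has absolute values below `suc m`. The expansion is universally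
  -- quantified because the induction hypothesis is used for the one shifted by 6.
  IsSolutionℤ-vanishes : ∀ m {α β a b X} → Expansion α β a b → IsSolutionℤ a b X →
    pairing α β (fromℤ ∘ X) 0 ≈ 0# → ∣ X 0 ∣ ℕ.≤ m → ∣ X 1 ∣ ℕ.≤ m → ∣ X 2 ∣ ℕ.≤ m →
    X 0 ≡ + 0 × X 1 ≡ + 0 × X 2 ≡ + 0
  IsSolutionℤ-vanishes zero e sol start b₀ b₁ b₂ = zero-of b₀ , zero-of b₁ , zero-of b₂
    where
    zero-of : ∀ {x} → ∣ x ∣ ℕ.≤ 0 → x ≡ + 0
    zero-of = ℤₚ.∣i∣≡0⇒i≡0 ∘ ℕₚ.n≤0⇒n≡0
  IsSolutionℤ-vanishes (suc m) {α} {β} {a} {b} {X} e sol start b₀ b₁ b₂ = descend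
    (IsSolutionℤ-vanishes m (shift 6 e) (λ n → sol (n ℕ.+ 6)) (orth 6) (smaller 0) (smaller 1) (smaller 2))
    where
    open Orthogonal e
    sol′ = embed {a} {b} {X} sol
    orth = orthogonal {fromℤ ∘ X} sol′ start
    within = bounded {fromℤ ∘ X} sol′ start (fromℤ-nonneg {+ suc m} (ℤ.+≤+ ℕ.z≤n))
      (∣∣≤⇒Within (X 0) b₀) (∣∣≤⇒Within (X 1) b₁) (∣∣≤⇒Within (X 2) b₂)
    0<m = fromℤ-pos {+ suc m} (ℤ.+<+ (ℕ.s≤s ℕ.z≤n))
    smaller : ∀ n → ∣ X (n ℕ.+ 6) ∣ ℕ.≤ m
    smaller n = ∣∣≤-pred (X (n ℕ.+ 6)) (Within⇒∣∣≤ (X (n ℕ.+ 6)) (within (n ℕ.+ 6)))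
      (λ X≡m → Orthogonal.not-maximal (shift n e) {λ i → fromℤ (X (i ℕ.+ n))} (λ i → sol′ (i ℕ.+ n)) (orth n) 0<m
        (λ i → within (i ℕ.+ n)) (fromℤ-cong (≡.trans (≡.cong X (ℕₚ.+-comm 6 n)) X≡m)))
      (λ -X≡m → Orthogonal.not-maximal (shift n e) {λ i → - fromℤ (X (i ℕ.+ n))}
        (λ i → IsSolution-neg {a} {b} {fromℤ ∘ X} sol′ (i ℕ.+ n))
        (trans (pairing-neg α β (fromℤ ∘ X) n) (trans (-‿cong (orth n)) -0#≈0#)) 0<m
        (λ i → Within-neg (within (i ℕ.+ n)))
        (trans (-‿cong (fromℤ-cong (≡.cong X (ℕₚ.+-comm 6 n))))
          (trans (sym (fromℤ-neg (X (n ℕ.+ 6)))) (fromℤ-cong -X≡m))))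
    back = solution-zeroˡ {a} {b} {X} sol
    descend : X 6 ≡ + 0 × X 7 ≡ + 0 × X 8 ≡ + 0 → X 0 ≡ + 0 × X 1 ≡ + 0 × X 2 ≡ + 0
    descend (X₆ , X₇ , X₈) =
      let X₅ = back 5 X₆ X₇ X₈
          X₄ = back 4 X₅ X₆ X₇
          X₃ = back 3 X₄ X₅ X₆
          X₂ = back 2 X₃ X₄ X₅
          X₁ = back 1 X₂ X₃ X₄
      in back 0 X₁ X₂ X₃ , X₁ , X₂

  Independent : Carrier → Carrier → Set ℓ₁
  Independent x y = ∀ u v w → fromℤ u * x + fromℤ v * y + fromℤ w ≈ 0# → u ≡ + 0 × v ≡ + 0 × w ≡ + 0

  Expansion⇒Independent : ∀ {α β a b} → Expansion α β a b → Independent (α 0) (β 0)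
  Expansion⇒Independent {a = a} {b} e u v w eq =
    let w≡0 , v≡0 , u≡0 = IsSolutionℤ-vanishes m {X = solution a b w v u} e (λ _ → ≡.refl) eq
          (ℕₚ.m≤n⊔m _ _)
          (ℕₚ.≤-trans (ℕₚ.m≤n⊔m ∣ u ∣ _) (ℕₚ.m≤m⊔n _ _))
          (ℕₚ.≤-trans (ℕₚ.m≤m⊔n _ ∣ v ∣) (ℕₚ.m≤m⊔n _ _))
    in u≡0 , v≡0 , w≡0
    where
    m = ∣ u ∣ ℕ.⊔ ∣ v ∣ ℕ.⊔ ∣ w ∣

  Jacobi⇒Independent : ∀ {α₀ β₀ a b} → IsMCF α₀ β₀ a b → Independent α₀ β₀
  Jacobi⇒Independent {a = a} {b} mcf u v w eq = v≡0′ , w≡0′ , w≡0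
    where
    open Jacobi mcf
    X = solution a b w v u
    start : pairing α β (fromℤ ∘ X) 0 ≈ 0#
    start = trans (+-congʳ (+-cong (*-congˡ α-start) (*-congˡ β-start))) eq
    next : pairing α β (fromℤ ∘ X) 1 ≈ 0#
    next = trans (pairing-next {α} {β} {a} {b} {fromℤ ∘ X} 0 (α-next 0) (β-next 0)
        (embed {a} {b} {X} (λ _ → ≡.refl)))
      (trans (*-congʳ start) (zeroˡ _))
    zeros = Expansion⇒Independent tail (X 3) (X 2) (X 1) next
    -- The names refer to the form carried to the tail, whose coefficients are X₃, X₂, X₁. Its
    -- middle coefficient X₂ is the original `u` and its last one X₁ the original `v`, while `w` is
    -- recovered by stepping back.
    v≡0′ = proj₁ (proj₂ zeros)
    w≡0′ = proj₂ (proj₂ zeros)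
    w≡0 = solution-zeroˡ {a} {b} {X} (λ _ → ≡.refl) 0 w≡0′ v≡0′ (proj₁ zeros)

  -- Growth of the linear form, and uniqueness of the expansion

  realSolution : (a b : ℕ → ℤ) (x₀ x₁ x₂ : Carrier) → ℕ → Carrier
  realSolution a b x₀ x₁ x₂ 0 = x₀
  realSolution a b x₀ x₁ x₂ 1 = x₁
  realSolution a b x₀ x₁ x₂ 2 = x₂
  realSolution a b x₀ x₁ x₂ (suc (suc (suc n))) =
    fromℤ (a n) * realSolution a b x₀ x₁ x₂ (suc (suc n)) + fromℤ (b n) * realSolution a b x₀ x₁ x₂ (suc n)
      + realSolution a b x₀ x₁ x₂ n

  module Growth {α β a b} (e : Expansion α β a b) where
    open Expansion e

    0≤a-1 : ∀ n → 0# ≤ fromℤ (a n) - fromℤ (+ 1)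
    0≤a-1 n = x≤y⇒0≤y-x (fromℤ-mono-≤ (1≤a n))

    -- That each factor exceeds 1 does not yet force products to be unbounded. Expanding by the
    -- recursion, α₀ α₁ α₂ = a₀ (a₁ α₂ + β₂) + b₁ α₂ + 1 ≥ α₂ + 1 > 2, which is a uniform gain.
    2<ααα : 0# < α 0 * α 1 * α 2 - fromℤ (+ 2)
    2<ααα = <-respʳ (trans
        (solve 5 (λ a b α₂ β₂ a′ →
            (a :- con (+ 1)) :* (a′ :* α₂ :+ β₂) :+ (a′ :- con (+ 1)) :* α₂ :+ β₂ :+ b :* α₂ :+ (α₂ :- con (+ 1)) :=
            a :* (a′ :* α₂ :+ β₂) :+ (b :* α₂ :+ con (+ 1)) :- con (+ 2)) refl
          (fromℤ (a 0)) (fromℤ (b 1)) (α 2) (β 2) (fromℤ (a 1)))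
        (+-congʳ (trans (+-cong (*-congˡ (sym (α-next 1))) (trans (+-congˡ fromℤ-1) (sym (β-next 1))))
          (trans (solve 4 (λ a α₁ α₂ β₁ → a :* (α₁ :* α₂) :+ β₁ :* α₂ := (a :* α₁ :+ β₁) :* α₂) refl
              (fromℤ (a 0)) (α 1) (α 2) (β 1))
            (*-congʳ (sym (α-next 0)))))))
      (+-nonneg-pos
        (+-nonneg (+-nonneg (+-nonneg
          (*-nonneg (0≤a-1 0) (+-nonneg (*-nonneg (0≤a 1) (<⇒≤ (0<α 2))) (0≤β 2)))
          (*-nonneg (0≤a-1 1) (<⇒≤ (0<α 2))))
          (0≤β 2))
          (*-nonneg (fromℤ-nonneg (0≤b 1)) (<⇒≤ (0<α 2))))
        (x<y⇒0<y-x (<-respˡ (sym fromℤ-1) (1<α 2))))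
      where
      0≤a : ∀ n → 0# ≤ fromℤ (a n)
      0≤a n = fromℤ-nonneg (ℤₚ.≤-trans (ℤ.+≤+ ℕ.z≤n) (1≤a n))

  module _ {α β a b} (e : Expansion α β a b) {X} (sol : IsSolution a b X) where
    open Expansion e

    pairing-suc : ∀ n → pairing α β X (suc n) ≈ pairing α β X n * α (suc n)
    pairing-suc n = pairing-next {α} {β} {a} {b} {X} n (α-next n) (β-next n) sol

    pairing-pos : 0# < pairing α β X 0 → ∀ n → 0# < pairing α β X n
    pairing-pos 0<t zero    = 0<t
    pairing-pos 0<t (suc n) = <-respʳ (sym (pairing-suc n)) (*-pos (pairing-pos 0<t n) (0<α (suc n)))

    -- Three steps more than double the value, and 2 (n + 1) ≥ n + 2. Linear growth is claimed
    -- rather than exponential because it is what the Archimedean property is matched against.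
    pairing-grows : 0# < pairing α β X 0 → ∀ n →
      ∃[ i ] 0# ≤ pairing α β X i - fromℤ (+ suc n) * pairing α β X 0
    pairing-grows 0<t zero = 0 , ≤-respʳ
      (solve 1 (λ t → con (+ 0) := t :- con (+ 1) :* t) refl (pairing α β X 0)) ≤-refl
    pairing-grows 0<t (suc n) with pairing-grows 0<t n
    ... | i , 0≤Tᵢ-nT = 3 ℕ.+ i , ≤-respʳ
      (trans (solve 4 (λ T p t N → T :* (p :- con (+ 2)) :+ con (+ 2) :* (T :- (con (+ 1) :+ N) :* t) :+ N :* t :=
                T :* p :- (con (+ 1) :+ (con (+ 1) :+ N)) :* t) refl T p t (fromℤ (+ n)))
        (+-cong (sym T₃≈) (-‿cong (*-congʳ (+-cong fromℤ-1 (+-congʳ fromℤ-1))))))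
      (+-nonneg (+-nonneg (*-nonneg (<⇒≤ (pairing-pos 0<t i)) (<⇒≤ p-2>0))
        (*-nonneg (fromℤ-nonneg {+ 2} (ℤ.+≤+ ℕ.z≤n))
          (≤-respʳ (+-congˡ (-‿cong (*-congʳ (+-congʳ (sym fromℤ-1))))) 0≤Tᵢ-nT)))
        (*-nonneg (fromℤ-nonneg {+ n} (ℤ.+≤+ ℕ.z≤n)) (<⇒≤ 0<t)))
      where
      T = pairing α β X i
      t = pairing α β X 0
      p = α (1 ℕ.+ i) * α (2 ℕ.+ i) * α (3 ℕ.+ i)
      p-2>0 : 0# < p - fromℤ (+ 2)
      p-2>0 = Growth.2<ααα (shift (suc i) e)
      T₃≈ : pairing α β X (3 ℕ.+ i) ≈ T * p
      T₃≈ = trans (pairing-suc (2 ℕ.+ i)) (trans (*-congʳ (trans (pairing-suc (1 ℕ.+ i)) (*-congʳ (pairing-suc i))))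
        (solve 4 (λ T x y z → T :* x :* y :* z := T :* (x :* y :* z)) refl T _ _ _))

    -- Estimating the form at n directly gives only 3 M αₙ, which is not uniform. Instead the form
    -- at n + 1 is at most 3 M αₙ₊₁, and it equals the form at n times αₙ₊₁, which cancels.
    pairing-bounded : ∀ {M} → 0# ≤ M → (∀ n → Within M (X n)) → ∀ n → 0# ≤ fromℤ (+ 3) * M - pairing α β X n
    pairing-bounded {M} 0≤M w n = *-cancelʳ-nonneg (0<α (suc n)) (≤-respʳ
      (trans (solve 6 (λ M α β x₂ x₁ x₀ →
          (M :- x₂) :* α :+ (M :- x₁) :* β :+ M :* (α :- β) :+ (M :- x₀) :+ M :* (α :- con (+ 1)) :=
          con (+ 3) :* M :* α :- (x₂ :* α :+ x₁ :* β :+ x₀)) refl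
          M (α (suc n)) (β (suc n)) (X (3 ℕ.+ n)) (X (2 ℕ.+ n)) (X (1 ℕ.+ n)))
        (trans (+-congˡ (-‿cong (pairing-suc n)))
          (solve 3 (λ M T α → con (+ 3) :* M :* α :- T :* α := (con (+ 3) :* M :- T) :* α) refl
            M (pairing α β X n) (α (suc n)))))
      (+-nonneg (+-nonneg (+-nonneg (+-nonneg
        (*-nonneg (proj₂ (w _)) (<⇒≤ (0<α (suc n))))
        (*-nonneg (proj₂ (w _)) (0≤β (suc n))))
        (*-nonneg 0≤M (<⇒≤ (x<y⇒0<y-x (β<α (suc n))))))
        (proj₂ (w _)))
        (*-nonneg 0≤M (<⇒≤ (x<y⇒0<y-x (<-respˡ (sym fromℤ-1) (1<α (suc n))))))))

    pairing≤0 : ∀ {M} → 0# ≤ M → (∀ n → Within M (X n)) → pairing α β X 0 ≤ 0#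
    pairing≤0 {M} 0≤M w 0<t = <-irrefl refl (<-respʳ
        (solve 4 (λ M t T N → N :* t :- con (+ 3) :* M :+ (con (+ 3) :* M :- T) :+ (T :- (con (+ 1) :+ N) :* t) :+ t :=
          con (+ 0)) refl M t (pairing α β X i) (fromℤ (+ n)))
        (+-pos (+-pos-nonneg (+-pos-nonneg 0<nt-3M (pairing-bounded 0≤M w i))
          (≤-respʳ (+-congˡ (-‿cong (*-congʳ (+-congʳ (sym fromℤ-1))))) 0≤Tᵢ-nt)) 0<t))
      where
      t = pairing α β X 0
      t⁻¹ = #⇒invertible (Equivalence.from #⇔<⊎> (inj₂ 0<t))
      -- The quotient of the bound 3 M by `t`: beyond `r` multiples of `t`, growth contradicts
      -- `pairing-bounded`.
      r = fromℤ (+ 3) * M * proj₁ t⁻¹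
      n = proj₁ (archimedean r)
      growth = pairing-grows 0<t n
      i = proj₁ growth
      0≤Tᵢ-nt = proj₂ growth
      0<nt-3M : 0# < fromℤ (+ n) * t - fromℤ (+ 3) * M
      0<nt-3M = <-respʳ
        (trans (solve 4 (λ N M t v →
              t :* (N :- con (+ 3) :* M :* v) := N :* t :- con (+ 3) :* M :* (v :* (t :- con (+ 0)))) refl
            (fromℤ (+ n)) M t (proj₁ t⁻¹))
          (+-congˡ (-‿cong (trans (*-congˡ (proj₁ (proj₂ t⁻¹))) (*-identityʳ _)))))
        (*-pos 0<t (x<y⇒0<y-x (proj₂ (archimedean r))))

  module _ {α β α′ β′ a b} (e : Expansion α β a b) (e′ : Expansion α′ β′ a b) where
    open Expansion e
    open Orthogonal e

    -- Being a solution depends on the digits alone, so `X` is one for both expansions.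
    -- Orthogonality to the first bounds it, and a bounded solution, like its negative, cannot have
    -- a positive form with respect to the second.
    orthogonal-transfers : ∀ {X M} → IsSolution a b X → pairing α β X 0 ≈ 0# → 0# ≤ M →
      Within M (X 0) → Within M (X 1) → Within M (X 2) → pairing α′ β′ X 0 ≈ 0#
    orthogonal-transfers {X} {M} sol start 0≤M w₀ w₁ w₂ = ≮∧≯⇒≈
      (λ t<0 → pairing≤0 e′ (IsSolution-neg {a} {b} {X} sol) 0≤M (Within-neg ∘ w)
        (<-respʳ (trans (+-identityˡ _) (sym (pairing-neg α′ β′ X 0))) (x<y⇒0<y-x t<0)))
      (pairing≤0 e′ {X} sol 0≤M w)
      where
      w : ∀ n → Within M (X n)
      w = bounded {X} sol start 0≤M w₀ w₁ w₂

    within-β : Within (α 0) (- β 0)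
    within-β = <⇒≤ (x<y⇒0<y-x (β<α 0)) , ≤-respʳ (+-congˡ (sym (-‿involutive _))) (+-nonneg (<⇒≤ (0<α 0)) (0≤β 0))

    within-0 : Within (α 0) 0#
    within-0 = ≤-respʳ (sym (+-identityʳ _)) (<⇒≤ (0<α 0)) ,
      ≤-respʳ (sym (trans (+-congˡ -0#≈0#) (+-identityʳ _))) (<⇒≤ (0<α 0))

    within-1 : Within (α 0) 1#
    within-1 = +-nonneg (<⇒≤ (0<α 0)) (<⇒≤ 0<1) , <⇒≤ (x<y⇒0<y-x (1<α 0))

    within-α : Within (α 0) (- α 0)
    within-α = ≤-respʳ (sym (-‿inverseʳ _)) ≤-refl ,
      ≤-respʳ (+-congˡ (sym (-‿involutive _))) (+-nonneg (<⇒≤ (0<α 0)) (<⇒≤ (0<α 0)))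

    α-unique : α 0 ≈ α′ 0
    α-unique = sym (trans (solve 2 (λ x y → x := x :- y :+ y) refl (α′ 0) (α 0))
      (trans (+-congʳ (trans
          (trans (+-congʳ (sym (*-identityˡ _)))
            (solve 4 (λ u x y z → u :* x :- y := u :* x :+ con (+ 0) :* z :+ :- y) refl 1# (α′ 0) (α 0) (β′ 0)))
          (orthogonal-transfers {realSolution a b (- α 0) 0# 1#} (λ _ → refl)
            (trans (solve 3 (λ u x z → u :* x :+ con (+ 0) :* z :+ :- x := u :* x :- x) refl 1# (α 0) (β 0))
              (trans (+-congʳ (*-identityˡ _)) (-‿inverseʳ _)))
            (<⇒≤ (0<α 0)) within-α within-0 within-1)))
        (+-identityˡ _)))

    β-unique : β 0 ≈ β′ 0
    β-unique = sym (trans (solve 2 (λ x y → x := x :- y :+ y) refl (β′ 0) (β 0))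
      (trans (+-congʳ (trans
          (trans (+-congʳ (sym (*-identityˡ _)))
            (solve 4 (λ u x y z → u :* x :- y := con (+ 0) :* z :+ u :* x :+ :- y) refl 1# (β′ 0) (β 0) (α′ 0)))
          (orthogonal-transfers {realSolution a b (- β 0) 1# 0#} (λ _ → refl)
            (trans (solve 3 (λ u x z → con (+ 0) :* z :+ u :* x :+ :- x := u :* x :- x) refl 1# (β 0) (α 0))
              (trans (+-congʳ (*-identityˡ _)) (-‿inverseʳ _)))
            (<⇒≤ (0<α 0)) within-β within-1 within-0)))
        (+-identityˡ _)))

-- The cubic equation satisfied by an eigenvector

record Matrix : Set where
  constructor matrix
  field
    a₁ a₂ a₃ b₁ b₂ b₃ c₁ c₂ c₃ : ℤ

-- Conjugation by the exchange of the first two coordinates, through which β inherits the results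
-- for α.
swap : Matrix → Matrix
swap (matrix a₁ a₂ a₃ b₁ b₂ b₃ c₁ c₂ c₃) = matrix b₂ b₁ b₃ a₂ a₁ a₃ c₂ c₁ c₃

-- The leading coefficient is the determinant with rows (c₁, c₂) and (c₁, c₂) K, where K is the
-- upper left 2 × 2 block: it vanishes exactly when (c₁, c₂) and its image under K are linearly
-- dependent.
cubic₃ cubic₂ cubic₁ cubic₀ : Matrix → ℤ
cubic₃ (matrix a₁ a₂ a₃ b₁ b₂ b₃ c₁ c₂ c₃) =
  c₁ ℤ.* c₂ ℤ.* (b₂ ℤ.- a₁) ℤ.+ a₂ ℤ.* c₁ ℤ.* c₁ ℤ.- b₁ ℤ.* c₂ ℤ.* c₂
cubic₂ (matrix a₁ a₂ a₃ b₁ b₂ b₃ c₁ c₂ c₃) =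
  c₂ ℤ.* (c₃ ℤ.- a₁) ℤ.* (b₂ ℤ.- a₁) ℤ.- c₂ ℤ.* c₁ ℤ.* a₃
    ℤ.+ c₁ ℤ.* a₂ ℤ.* (c₃ ℤ.+ c₃ ℤ.- a₁ ℤ.- b₂) ℤ.- b₃ ℤ.* c₂ ℤ.* c₂ ℤ.+ (b₁ ℤ.+ b₁) ℤ.* c₂ ℤ.* a₂
cubic₁ (matrix a₁ a₂ a₃ b₁ b₂ b₃ c₁ c₂ c₃) =
  a₂ ℤ.* (c₃ ℤ.- a₁) ℤ.* (c₃ ℤ.- b₂) ℤ.+ a₃ ℤ.* c₂ ℤ.* (a₁ ℤ.+ a₁ ℤ.- b₂ ℤ.- c₃)
    ℤ.- a₃ ℤ.* a₂ ℤ.* c₁ ℤ.+ (b₃ ℤ.+ b₃) ℤ.* c₂ ℤ.* a₂ ℤ.- b₁ ℤ.* a₂ ℤ.* a₂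
cubic₀ (matrix a₁ a₂ a₃ b₁ b₂ b₃ c₁ c₂ c₃) =
  c₂ ℤ.* a₃ ℤ.* a₃ ℤ.- a₃ ℤ.* a₂ ℤ.* (c₃ ℤ.- b₂) ℤ.- b₃ ℤ.* a₂ ℤ.* a₂

cubic₃-swap : ∀ N → cubic₃ N ≡ ℤ.- cubic₃ (swap N)
cubic₃-swap (matrix a₁ a₂ a₃ b₁ b₂ b₃ c₁ c₂ c₃) = identity a₁ a₂ b₁ b₂ c₁ c₂
  where
  identity : ∀ a₁ a₂ b₁ b₂ c₁ c₂ →
    c₁ ℤ.* c₂ ℤ.* (b₂ ℤ.- a₁) ℤ.+ a₂ ℤ.* c₁ ℤ.* c₁ ℤ.- b₁ ℤ.* c₂ ℤ.* c₂ ≡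
    ℤ.- (c₂ ℤ.* c₁ ℤ.* (a₁ ℤ.- b₂) ℤ.+ b₁ ℤ.* c₂ ℤ.* c₂ ℤ.- a₂ ℤ.* c₁ ℤ.* c₁)
  identity = solve-∀

*≡0⇒ʳ : ∀ {i} j → i ≢ + 0 → i ℤ.* j ≡ + 0 → j ≡ + 0
*≡0⇒ʳ {i} j i≢0 ij≡0 = [ (λ i≡0 → contradiction i≡0 i≢0) , (λ j≡0 → j≡0) ]′ (ℤₚ.i*j≡0⇒i≡0∨j≡0 i ij≡0)

module Cubic {c ℓ₁ ℓ₂ ℓ₃} (R : RealNumbers c ℓ₁ ℓ₂ ℓ₃) where
  open OrderedField R
  open Independence R using (Independent)
  open Solver using (solve; con; _:=_; _:+_; _:*_; _:-_; :-_; _:^_; var; op; [+]; [*]; Polynomial; ⟦_⟧)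

  -- The solver's syntax is evaluated in ℤ too, so that `hom` can distribute `fromℤ` over a compound
  -- expression at one stroke, given its shape.
  ⟦_⟧ℤ : ∀ {n} → Polynomial n → Vec ℤ n → ℤ
  ⟦ op [+] p q ⟧ℤ ρ = ⟦ p ⟧ℤ ρ ℤ.+ ⟦ q ⟧ℤ ρ
  ⟦ op [*] p q ⟧ℤ ρ = ⟦ p ⟧ℤ ρ ℤ.* ⟦ q ⟧ℤ ρ
  ⟦ con k ⟧ℤ      ρ = k
  ⟦ var i ⟧ℤ      ρ = Vec.lookup ρ i
  ⟦ p :^ zero ⟧ℤ  ρ = + 1
  ⟦ p :^ suc n ⟧ℤ ρ = ⟦ p ⟧ℤ ρ ℤ.* ⟦ p :^ n ⟧ℤ ρ
  ⟦ :- p ⟧ℤ       ρ = ℤ.- ⟦ p ⟧ℤ ρ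

  fromℤ-⟦_⟧ : ∀ {n} (p : Polynomial n) (ρ : Vec ℤ n) → fromℤ (⟦ p ⟧ℤ ρ) ≈ ⟦ p ⟧ (Vec.map fromℤ ρ)
  fromℤ-⟦ op [+] p q ⟧ ρ = trans (fromℤ-+ (⟦ p ⟧ℤ ρ) (⟦ q ⟧ℤ ρ)) (+-cong (fromℤ-⟦ p ⟧ ρ) (fromℤ-⟦ q ⟧ ρ))
  fromℤ-⟦ op [*] p q ⟧ ρ = trans (fromℤ-* (⟦ p ⟧ℤ ρ) (⟦ q ⟧ℤ ρ)) (*-cong (fromℤ-⟦ p ⟧ ρ) (fromℤ-⟦ q ⟧ ρ))
  fromℤ-⟦ con k ⟧      ρ = refl
  fromℤ-⟦ var i ⟧      ρ = sym (reflexive (Vecₚ.lookup-map i fromℤ ρ))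
  fromℤ-⟦ p :^ zero ⟧  ρ = fromℤ-1
  fromℤ-⟦ p :^ suc n ⟧ ρ = trans (fromℤ-* (⟦ p ⟧ℤ ρ) (⟦ p :^ n ⟧ℤ ρ)) (*-cong (fromℤ-⟦ p ⟧ ρ) (fromℤ-⟦ p :^ n ⟧ ρ))
  fromℤ-⟦ :- p ⟧       ρ = trans (fromℤ-neg (⟦ p ⟧ℤ ρ)) (-‿cong (fromℤ-⟦ p ⟧ ρ))

  hom : ∀ n (f : N-ary n (Polynomial n) (Polynomial n)) (ρ : Vec ℤ n) →
    let p = f $ⁿ Vec.map var (Vec.allFin n) in fromℤ (⟦ p ⟧ℤ ρ) ≈ ⟦ p ⟧ (Vec.map fromℤ ρ)
  hom n f = fromℤ-⟦ f $ⁿ Vec.map var (Vec.allFin n) ⟧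

  ≈0-combination : ∀ {x y z p q r} → p ≈ 0# → q ≈ 0# → z ≈ x * p + y * q → r ≈ z → r ≈ 0#
  ≈0-combination {x} {y} p≈0 q≈0 z≈ r≈z = trans r≈z (trans z≈ (trans (+-cong (*-congˡ p≈0) (*-congˡ q≈0))
    (solve 2 (λ x y → x :* con (+ 0) :+ y :* con (+ 0) := con (+ 0)) refl x y)))

  quadratic : ℤ → ℤ → ℤ → Carrier → Carrier
  quadratic u v w x = fromℤ u * (x * x) + fromℤ v * x + fromℤ w

  NotQuadratic : Carrier → Set ℓ₁
  NotQuadratic x = ∀ u v w → quadratic u v w x ≈ 0# → u ≡ + 0 × v ≡ + 0 × w ≡ + 0

  -- A quadratic x would make y = (a x² + b x + d) / (p x + r) a linear function
  -- of x: multiply the denominator by its conjugate.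
  independent⇒notQuadratic : ∀ {x y} p r a b d → Independent x y → ¬ (p ≡ + 0 × r ≡ + 0) →
    y * (fromℤ p * x + fromℤ r) - quadratic a b d x ≈ 0# → NotQuadratic x
  independent⇒notQuadratic {x} {y} p r a b d independent pr≢0 relation u v w Q≈0 with u ℤₚ.≟ + 0
  ... | yes u≡0 =
    let v≡0 , _ , w≡0 = independent v (+ 0) w (trans
          (solve 4 (λ v x y w → v :* x :+ con (+ 0) :* y :+ w := con (+ 0) :* (x :* x) :+ v :* x :+ w) refl
            (fromℤ v) x y (fromℤ w))
          (trans (+-congʳ (+-congʳ (*-congʳ (sym (fromℤ-cong u≡0))))) Q≈0))
    in u≡0 , v≡0 , w≡0
  ... | no u≢0 = ⊥-elim (x*y≈0⇒¬¬ ℓℓ̄≈0 [ ℓ≉0 , ℓ̄≉0 ]′)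
    where
    -- With x′ = - v / u - x, the other root of the quadratic, `ℓ̄` is u (p x′ + r), the conjugate
    -- of `ℓ` freed of denominators, and `norm` is the product of `ℓ` and `ℓ̄`. The coefficients
    -- `s₁` and `s₀` are those of u (a x² + b x + d) reduced modulo the quadratic.
    norm s₁ s₀ l₁ l₀ : ℤ
    norm = p ℤ.* p ℤ.* w ℤ.+ ℤ.- (p ℤ.* r ℤ.* v) ℤ.+ r ℤ.* r ℤ.* u
    s₁ = u ℤ.* b ℤ.+ ℤ.- (a ℤ.* v)
    s₀ = u ℤ.* d ℤ.+ ℤ.- (a ℤ.* w)
    l₁ = ℤ.- (p ℤ.* u)
    l₀ = u ℤ.* r ℤ.+ ℤ.- (p ℤ.* v)
    ℓ ℓ̄ : Carrier
    ℓ = fromℤ p * x + fromℤ r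
    ℓ̄ = fromℤ l₁ * x + fromℤ l₀

    hom-norm = hom 5 (λ p r u v w → p :* p :* w :- p :* r :* v :+ r :* r :* u) (p ∷ r ∷ u ∷ v ∷ w ∷ [])
    hom-s : ∀ d w → _
    hom-s d w = hom 4 (λ u d a w → u :* d :- a :* w) (u ∷ d ∷ a ∷ w ∷ [])
    hom-l₁ = hom 2 (λ p u → :- (p :* u)) (p ∷ u ∷ [])
    hom-l₀ = hom 4 (λ u r p v → u :* r :- p :* v) (u ∷ r ∷ p ∷ v ∷ [])

    ℓℓ̄≈norm : ℓ * ℓ̄ ≈ fromℤ norm - fromℤ p * fromℤ p * quadratic u v w x
    ℓℓ̄≈norm = trans (*-congˡ (+-cong (*-congʳ hom-l₁) hom-l₀)) (trans
      (solve 6 (λ p r u v w x → (p :* x :+ r) :* (:- (p :* u) :* x :+ (u :* r :- p :* v)) :=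
          p :* p :* w :- p :* r :* v :+ r :* r :* u :- p :* p :* (u :* (x :* x) :+ v :* x :+ w)) refl
        (fromℤ p) (fromℤ r) (fromℤ u) (fromℤ v) (fromℤ w) x)
      (+-congʳ (sym hom-norm)))

    s = fromℤ s₁ * x + fromℤ s₀

    us≈ : fromℤ u * quadratic a b d x ≈ s
    us≈ = trans
      (solve 7 (λ u v w a b d x → u :* (a :* (x :* x) :+ b :* x :+ d) :=
          (u :* b :- a :* v) :* x :+ (u :* d :- a :* w) :+ a :* (u :* (x :* x) :+ v :* x :+ w)) refl
        (fromℤ u) (fromℤ v) (fromℤ w) (fromℤ a) (fromℤ b) (fromℤ d) x)
      (trans (+-cong (+-cong (*-congʳ (sym (hom-s b v))) (sym (hom-s d w))) (trans (*-congˡ Q≈0) (zeroʳ _)))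
        (+-identityʳ _))

    yℓ≈ : y * ℓ ≈ quadratic a b d x
    yℓ≈ = trans (solve 2 (λ x y → x := x :- y :+ y) refl _ _) (trans (+-congʳ relation) (+-identityˡ _))

    norm≈ℓℓ̄ : fromℤ norm ≈ ℓ * ℓ̄
    norm≈ℓℓ̄ = sym (trans ℓℓ̄≈norm (trans (+-congˡ (trans (-‿cong (trans (*-congˡ Q≈0) (zeroʳ _))) -0#≈0#)) (+-identityʳ _)))

    e₁ e₂ e₃ : ℤ
    e₁ = s₁ ℤ.* (u ℤ.* r) ℤ.+ l₁ ℤ.* s₀
    e₂ = u ℤ.* norm
    e₃ = p ℤ.* s₁ ℤ.* w ℤ.+ s₀ ℤ.* l₀

    sℓ̄≈ : s * ℓ̄ ≈ fromℤ e₁ * x + fromℤ e₃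
    sℓ̄≈ = begin
      s * ℓ̄
        ≈⟨ *-congˡ (+-cong (*-congʳ hom-l₁) hom-l₀) ⟩
      s * (- (fromℤ p * fromℤ u) * x + (fromℤ u * fromℤ r - fromℤ p * fromℤ v))
        ≈⟨ solve 8 (λ p r u v w x s₁ s₀ → (s₁ :* x :+ s₀) :* (:- (p :* u) :* x :+ (u :* r :- p :* v)) :=
             (s₁ :* (u :* r) :+ (:- (p :* u)) :* s₀) :* x :+ (p :* s₁ :* w :+ s₀ :* (u :* r :- p :* v))
               :- p :* s₁ :* (u :* (x :* x) :+ v :* x :+ w)) refl
             (fromℤ p) (fromℤ r) (fromℤ u) (fromℤ v) (fromℤ w) x (fromℤ s₁) (fromℤ s₀) ⟩
      (fromℤ s₁ * (fromℤ u * fromℤ r) + - (fromℤ p * fromℤ u) * fromℤ s₀) * x +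
        (fromℤ p * fromℤ s₁ * fromℤ w + fromℤ s₀ * (fromℤ u * fromℤ r - fromℤ p * fromℤ v))
        - fromℤ p * fromℤ s₁ * quadratic u v w x
        ≈⟨ +-cong (+-cong (*-congʳ (+-congˡ (*-congʳ (sym hom-l₁)))) (+-congˡ (*-congˡ (sym hom-l₀))))
             (trans (-‿cong (trans (*-congˡ Q≈0) (zeroʳ _))) -0#≈0#) ⟩
      (fromℤ s₁ * (fromℤ u * fromℤ r) + fromℤ l₁ * fromℤ s₀) * x +
        (fromℤ p * fromℤ s₁ * fromℤ w + fromℤ s₀ * fromℤ l₀) + 0#
        ≈⟨ +-identityʳ _ ⟩
      (fromℤ s₁ * (fromℤ u * fromℤ r) + fromℤ l₁ * fromℤ s₀) * x +
        (fromℤ p * fromℤ s₁ * fromℤ w + fromℤ s₀ * fromℤ l₀)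
        ≈⟨ +-cong (*-congʳ (hom 5 (λ s₁ u r l₁ s₀ → s₁ :* (u :* r) :+ l₁ :* s₀) (s₁ ∷ u ∷ r ∷ l₁ ∷ s₀ ∷ [])))
             (hom 5 (λ p s₁ w s₀ l₀ → p :* s₁ :* w :+ s₀ :* l₀) (p ∷ s₁ ∷ w ∷ s₀ ∷ l₀ ∷ [])) ⟨
      fromℤ e₁ * x + fromℤ e₃ ∎
      where open SetoidReasoning setoid

    e₂y≈ : fromℤ e₂ * y ≈ fromℤ e₁ * x + fromℤ e₃
    e₂y≈ = begin
      fromℤ e₂ * y                         ≈⟨ *-congʳ (fromℤ-* u norm) ⟩
      fromℤ u * fromℤ norm * y             ≈⟨ *-congʳ (*-congˡ norm≈ℓℓ̄) ⟩
      fromℤ u * (ℓ * ℓ̄) * y                ≈⟨ solve 4 (λ u ℓ ℓ̄ y → u :* (ℓ :* ℓ̄) :* y := u :* (y :* ℓ) :* ℓ̄) refl (fromℤ u) ℓ ℓ̄ y ⟩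
      fromℤ u * (y * ℓ) * ℓ̄                ≈⟨ *-congʳ (*-congˡ yℓ≈) ⟩
      fromℤ u * quadratic a b d x * ℓ̄      ≈⟨ *-congʳ us≈ ⟩
      s * ℓ̄                                ≈⟨ sℓ̄≈ ⟩
      fromℤ e₁ * x + fromℤ e₃              ∎
      where open SetoidReasoning setoid

    -- The relation e₂ y = e₁ x + e₃ is linear, so independence kills `e₂`, which is `u` times
    -- `norm`. One of `ℓ` and `ℓ̄` would then have to vanish, again a forbidden linear relation.
    norm≡0 : norm ≡ + 0
    norm≡0 = *≡0⇒ʳ norm u≢0 (proj₁ (proj₂ (independent (ℤ.- e₁) e₂ (ℤ.- e₃)
      (trans (+-cong (+-cong (*-congʳ (fromℤ-neg e₁)) e₂y≈) (fromℤ-neg e₃))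
        (solve 3 (λ e x d → :- e :* x :+ (e :* x :+ d) :- d := con (+ 0)) refl (fromℤ e₁) x (fromℤ e₃))))))

    ℓℓ̄≈0 : ℓ * ℓ̄ ≈ 0#
    ℓℓ̄≈0 = ≈0-combination {1#} {(- (fromℤ p * fromℤ p))} (fromℤ-cong norm≡0) Q≈0
      (trans (+-congʳ (sym (*-identityˡ _))) (+-congˡ (-‿distribˡ-* _ _))) ℓℓ̄≈norm

    ℓ≉0 : ¬ ℓ ≈ 0#
    ℓ≉0 ℓ≈0 =
      let p≡0 , _ , r≡0 = independent p (+ 0) r (trans
            (solve 4 (λ p x y r → p :* x :+ con (+ 0) :* y :+ r := p :* x :+ r) refl (fromℤ p) x y (fromℤ r)) ℓ≈0)
      in pr≢0 (p≡0 , r≡0)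

    ℓ̄≉0 : ¬ ℓ̄ ≈ 0#
    ℓ̄≉0 ℓ̄≈0 =
      let l₁≡0 , _ , l₀≡0 = independent l₁ (+ 0) l₀ (trans
            (solve 4 (λ p x y r → p :* x :+ con (+ 0) :* y :+ r := p :* x :+ r) refl (fromℤ l₁) x y (fromℤ l₀)) ℓ̄≈0)
          p≡0 = *≡0⇒ʳ p u≢0 (≡.trans (ℤₚ.*-comm u p) (≡.trans (≡.sym (ℤₚ.neg-involutive _)) (≡.cong ℤ.-_ l₁≡0)))
          r≡0 = *≡0⇒ʳ r u≢0 (≡.trans (≡.sym (ℤₚ.+-identityʳ _)) (≡.trans
            (≡.cong (λ p → u ℤ.* r ℤ.+ ℤ.- (p ℤ.* v)) (≡.sym p≡0)) l₀≡0))
      in pr≢0 (p≡0 , r≡0)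

  -- The third coordinate of the eigenvector is 1, so the third row of the matrix yields the
  -- eigenvalue itself.
  eigenvalue : Matrix → Carrier → Carrier → Carrier
  eigenvalue N x y = fromℤ c₁ * x + fromℤ c₂ * y + fromℤ c₃
    where open Matrix N

  record IsEigenvector (N : Matrix) (x y : Carrier) : Set ℓ₁ where
    open Matrix N
    field
      row-a : x * eigenvalue N x y ≈ fromℤ a₁ * x + fromℤ a₂ * y + fromℤ a₃
      row-b : y * eigenvalue N x y ≈ fromℤ b₁ * x + fromℤ b₂ * y + fromℤ b₃

  Independent-swap : ∀ {x y} → Independent x y → Independent y x
  Independent-swap independent u v w eq =
    let v≡0 , u≡0 , w≡0 = independent v u w (trans (+-congʳ (+-comm _ _)) eq) in u≡0 , v≡0 , w≡0

  IsEigenvector-swap : ∀ {N x y} → IsEigenvector N x y → IsEigenvector (swap N) y x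
  IsEigenvector-swap eigen = record
    { row-a = trans (*-congˡ (+-congʳ (+-comm _ _))) (trans row-b (+-congʳ (+-comm _ _)))
    ; row-b = trans (*-congˡ (+-congʳ (+-comm _ _))) (trans row-a (+-congʳ (+-comm _ _)))
    }
    where open IsEigenvector eigen

  cubic : Matrix → Carrier → Carrier
  cubic N x = fromℤ (cubic₀ N) + x * (fromℤ (cubic₁ N) + x * (fromℤ (cubic₂ N) + x * fromℤ (cubic₃ N)))

  -- With ℓ = c₂ x - a₂ and q = c₁ x² + (c₃ - a₁) x - a₃, the first row of the
  -- eigenvector equation reads y ℓ = - q; the second, multiplied by ℓ², then
  -- becomes an equation in x alone, in which the terms of degree 4 cancel.
  cubic-vanishes : ∀ {N x y} → IsEigenvector N x y → cubic N x ≈ 0#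
  cubic-vanishes {matrix a₁ a₂ a₃ b₁ b₂ b₃ c₁ c₂ c₃} {x} {y} eigen =
    -- Here E₁ = y ℓ + q, so y ℓ = E₁ - q is substituted in ℓ² E₂; the second coefficient collects
    -- everything that this leaves divisible by `E₁`.
    ≈0-combination {ℓ * ℓ} {(- (fromℤ c₂ * (E₁ - (q + q)) + ℓ * (fromℤ c₁ * x + (fromℤ c₃ - fromℤ b₂))))}
      (trans (+-congʳ row-b) (-‿inverseʳ _)) (trans (+-congʳ row-a) (-‿inverseʳ _))
      (solve 11 (λ a₁ a₂ a₃ b₁ b₂ b₃ c₁ c₂ c₃ x y →
        let f₃ = c₁ :* c₂ :* (b₂ :- a₁) :+ a₂ :* c₁ :* c₁ :- b₁ :* c₂ :* c₂
            f₂ = c₂ :* (c₃ :- a₁) :* (b₂ :- a₁) :- c₂ :* c₁ :* a₃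
                   :+ c₁ :* a₂ :* (c₃ :+ c₃ :- a₁ :- b₂) :- b₃ :* c₂ :* c₂ :+ (b₁ :+ b₁) :* c₂ :* a₂
            f₁ = a₂ :* (c₃ :- a₁) :* (c₃ :- b₂) :+ a₃ :* c₂ :* (a₁ :+ a₁ :- b₂ :- c₃)
                   :- a₃ :* a₂ :* c₁ :+ (b₃ :+ b₃) :* c₂ :* a₂ :- b₁ :* a₂ :* a₂
            f₀ = c₂ :* a₃ :* a₃ :- a₃ :* a₂ :* (c₃ :- b₂) :- b₃ :* a₂ :* a₂
            L  = c₁ :* x :+ c₂ :* y :+ c₃
            E₁ = x :* L :- (a₁ :* x :+ a₂ :* y :+ a₃)
            E₂ = y :* L :- (b₁ :* x :+ b₂ :* y :+ b₃)
            ℓ  = c₂ :* x :- a₂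
            q  = c₁ :* x :* x :+ (c₃ :- a₁) :* x :- a₃
        in f₀ :+ x :* (f₁ :+ x :* (f₂ :+ x :* f₃)) :=
           ℓ :* ℓ :* E₂ :+ :- (c₂ :* (E₁ :- (q :+ q)) :+ ℓ :* (c₁ :* x :+ (c₃ :- b₂))) :* E₁)
        refl (fromℤ a₁) (fromℤ a₂) (fromℤ a₃) (fromℤ b₁) (fromℤ b₂) (fromℤ b₃) (fromℤ c₁) (fromℤ c₂) (fromℤ c₃) x y)
      (+-cong f₀≈ (*-congˡ (+-cong f₁≈ (*-congˡ (+-cong f₂≈ (*-congˡ f₃≈))))))
    where
    open IsEigenvector eigen
    N = matrix a₁ a₂ a₃ b₁ b₂ b₃ c₁ c₂ c₃
    ℓ = fromℤ c₂ * x - fromℤ a₂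
    q = fromℤ c₁ * x * x + (fromℤ c₃ - fromℤ a₁) * x - fromℤ a₃
    E₁ = x * eigenvalue N x y - (fromℤ a₁ * x + fromℤ a₂ * y + fromℤ a₃)
    entries = a₁ ∷ a₂ ∷ a₃ ∷ b₁ ∷ b₂ ∷ b₃ ∷ c₁ ∷ c₂ ∷ c₃ ∷ []
    f₃≈ = hom 9 (λ a₁ a₂ a₃ b₁ b₂ b₃ c₁ c₂ c₃ →
      c₁ :* c₂ :* (b₂ :- a₁) :+ a₂ :* c₁ :* c₁ :- b₁ :* c₂ :* c₂) entries
    f₂≈ = hom 9 (λ a₁ a₂ a₃ b₁ b₂ b₃ c₁ c₂ c₃ →
      c₂ :* (c₃ :- a₁) :* (b₂ :- a₁) :- c₂ :* c₁ :* a₃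
        :+ c₁ :* a₂ :* (c₃ :+ c₃ :- a₁ :- b₂) :- b₃ :* c₂ :* c₂ :+ (b₁ :+ b₁) :* c₂ :* a₂) entries
    f₁≈ = hom 9 (λ a₁ a₂ a₃ b₁ b₂ b₃ c₁ c₂ c₃ →
      a₂ :* (c₃ :- a₁) :* (c₃ :- b₂) :+ a₃ :* c₂ :* (a₁ :+ a₁ :- b₂ :- c₃)
        :- a₃ :* a₂ :* c₁ :+ (b₃ :+ b₃) :* c₂ :* a₂ :- b₁ :* a₂ :* a₂) entries
    f₀≈ = hom 9 (λ a₁ a₂ a₃ b₁ b₂ b₃ c₁ c₂ c₃ →
      c₂ :* a₃ :* a₃ :- a₃ :* a₂ :* (c₃ :- b₂) :- b₃ :* a₂ :* a₂) entries

  module _ {a₁ a₂ a₃ b₁ b₂ b₃ c₁ c₂ c₃} {x y} (independent : Independent x y)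
    (eigen : IsEigenvector (matrix a₁ a₂ a₃ b₁ b₂ b₃ c₁ c₂ c₃) x y) where
    open IsEigenvector eigen

    private
      N : Matrix
      N = matrix a₁ a₂ a₃ b₁ b₂ b₃ c₁ c₂ c₃

      λ′ E₁ E₂ : Carrier
      λ′ = eigenvalue N x y
      E₁ = x * λ′ - (fromℤ a₁ * x + fromℤ a₂ * y + fromℤ a₃)
      E₂ = y * λ′ - (fromℤ b₁ * x + fromℤ b₂ * y + fromℤ b₃)

      E₁≈0 : E₁ ≈ 0#
      E₁≈0 = trans (+-congʳ row-a) (-‿inverseʳ _)

      E₂≈0 : E₂ ≈ 0#
      E₂≈0 = trans (+-congʳ row-b) (-‿inverseʳ _)

    first-row : ¬ (c₂ ≡ + 0 × ℤ.- a₂ ≡ + 0) → NotQuadratic x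
    first-row c₂a₂≢0 = independent⇒notQuadratic c₂ (ℤ.- a₂) (ℤ.- c₁) (a₁ ℤ.- c₃) a₃ independent c₂a₂≢0
      (trans (+-cong (*-congˡ (+-congˡ (fromℤ-neg a₂)))
          (-‿cong (+-congʳ (+-cong (*-congʳ (fromℤ-neg c₁)) (*-congʳ (fromℤ-sub a₁ c₃))))))
        (trans (solve 8 (λ x y a₁ a₂ a₃ c₁ c₂ c₃ →
            y :* (c₂ :* x :- a₂) :- (:- c₁ :* (x :* x) :+ (a₁ :- c₃) :* x :+ a₃) :=
            x :* (c₁ :* x :+ c₂ :* y :+ c₃) :- (a₁ :* x :+ a₂ :* y :+ a₃)) refl
            x y (fromℤ a₁) (fromℤ a₂) (fromℤ a₃) (fromℤ c₁) (fromℤ c₂) (fromℤ c₃)) E₁≈0))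

    -- The first row has the form y (c₂ x - a₂) = quadratic in x, which suffices unless c₂ = a₂ = 0.
    -- In that case c₁ ≠ 0, and the second row reads y (c₁ x + c₃ - b₂) = b₁ x + b₃.
    x-notQuadratic : ¬ (c₁ ≡ + 0 × c₂ ≡ + 0) → NotQuadratic x
    x-notQuadratic c≢0 with c₂ ℤₚ.≟ + 0 | a₂ ℤₚ.≟ + 0
    ... | yes c₂≡0 | yes a₂≡0 = independent⇒notQuadratic c₁ (c₃ ℤ.- b₂) (+ 0) b₁ b₃ independent
      (λ c₁≡0 → c≢0 (proj₁ c₁≡0 , c₂≡0))
      (≈0-combination {1#} {(- (y * y))} E₂≈0 (fromℤ-cong c₂≡0)
        (+-congʳ (sym (*-identityˡ _)))
        (trans (+-congʳ (*-congˡ (+-congˡ (fromℤ-sub c₃ b₂))))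
          (solve 8 (λ x y b₁ b₂ b₃ c₁ c₂ c₃ →
            y :* (c₁ :* x :+ (c₃ :- b₂)) :- (con (+ 0) :* (x :* x) :+ b₁ :* x :+ b₃) :=
            y :* (c₁ :* x :+ c₂ :* y :+ c₃) :- (b₁ :* x :+ b₂ :* y :+ b₃) :+ :- (y :* y) :* c₂) refl
            x y (fromℤ b₁) (fromℤ b₂) (fromℤ b₃) (fromℤ c₁) (fromℤ c₂) (fromℤ c₃))))
    ... | yes c₂≡0 | no a₂≢0 = first-row (λ (_ , -a₂≡0) → a₂≢0 (ℤₚ.neg-injective -a₂≡0))
    ... | no c₂≢0  | _       = first-row (c₂≢0 ∘ proj₁)

    -- As c₁ ≠ 0, the pair of λ and y is again independent. Replacing c₁ x by λ - c₂ y - c₃ in c₁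
    -- times the second row cancels the y² terms and expresses y as a quotient of linear functions
    -- of λ.
    eigenvalue-notQuadratic : c₁ ≢ + 0 → NotQuadratic λ′
    eigenvalue-notQuadratic c₁≢0 = independent⇒notQuadratic c₁ r (+ 0) b₁ t independent-λ (c₁≢0 ∘ proj₁)
      (trans (+-cong (*-congˡ (+-congˡ (hom 4 (λ b₁ c₂ c₁ b₂ → b₁ :* c₂ :- c₁ :* b₂) (b₁ ∷ c₂ ∷ c₁ ∷ b₂ ∷ []))))
          (-‿cong (+-congˡ (hom 4 (λ c₁ b₃ b₁ c₃ → c₁ :* b₃ :- b₁ :* c₃) (c₁ ∷ b₃ ∷ b₁ ∷ c₃ ∷ [])))))
        (trans (solve 8 (λ x y b₁ b₂ b₃ c₁ c₂ c₃ →
            let L = c₁ :* x :+ c₂ :* y :+ c₃ in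
            y :* (c₁ :* L :+ (b₁ :* c₂ :- c₁ :* b₂)) :- (con (+ 0) :* (L :* L) :+ b₁ :* L :+ (c₁ :* b₃ :- b₁ :* c₃)) :=
            c₁ :* (y :* L :- (b₁ :* x :+ b₂ :* y :+ b₃))) refl
            x y (fromℤ b₁) (fromℤ b₂) (fromℤ b₃) (fromℤ c₁) (fromℤ c₂) (fromℤ c₃))
          (trans (*-congˡ E₂≈0) (zeroʳ _))))
      where
      r t : ℤ
      r = b₁ ℤ.* c₂ ℤ.- c₁ ℤ.* b₂
      t = c₁ ℤ.* b₃ ℤ.- b₁ ℤ.* c₃
      independent-λ : Independent λ′ y
      independent-λ u v w eq = u≡0 , v≡0 , w≡0
        where
        zeros = independent (u ℤ.* c₁) (u ℤ.* c₂ ℤ.+ v) (u ℤ.* c₃ ℤ.+ w)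
          (trans (+-cong (+-cong (*-congʳ (fromℤ-* u c₁))
              (*-congʳ (hom 3 (λ u c v → u :* c :+ v) (u ∷ c₂ ∷ v ∷ []))))
              (hom 3 (λ u c v → u :* c :+ v) (u ∷ c₃ ∷ w ∷ [])))
            (trans (solve 8 (λ x y u v w c₁ c₂ c₃ →
                u :* c₁ :* x :+ (u :* c₂ :+ v) :* y :+ (u :* c₃ :+ w) :=
                u :* (c₁ :* x :+ c₂ :* y :+ c₃) :+ v :* y :+ w) refl
                x y (fromℤ u) (fromℤ v) (fromℤ w) (fromℤ c₁) (fromℤ c₂) (fromℤ c₃)) eq))
        u≡0 : u ≡ + 0
        u≡0 = *≡0⇒ʳ u c₁≢0 (≡.trans (ℤₚ.*-comm c₁ u) (proj₁ zeros))
        drop : ∀ c v → u ℤ.* c ℤ.+ v ≡ + 0 → v ≡ + 0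
        drop c v eq = ≡.trans (≡.sym (ℤₚ.+-identityˡ v)) (≡.trans (≡.cong (λ u → u ℤ.* c ℤ.+ v) (≡.sym u≡0)) eq)
        v≡0 = drop c₂ v (proj₁ (proj₂ zeros))
        w≡0 = drop c₃ w (proj₂ (proj₂ zeros))

    -- c₁ λ² is the sum of cubic₃ N · y and a linear function of λ.
    c₁≢0⇒cubic₃≢0 : c₁ ≢ + 0 → cubic₃ N ≢ + 0
    c₁≢0⇒cubic₃≢0 c₁≢0 f₃≡0 = c₁≢0 (proj₁ (eigenvalue-notQuadratic c₁≢0 c₁ (ℤ.- s₁) (s₁ ℤ.* c₃ ℤ.- c₁ ℤ.* s₃)
      (trans (+-cong (+-congˡ (*-congʳ (trans (fromℤ-neg s₁) (-‿cong s₁≈))))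
          (trans (hom 4 (λ s₁ c₃ c₁ s₃ → s₁ :* c₃ :- c₁ :* s₃) (s₁ ∷ c₃ ∷ c₁ ∷ s₃ ∷ []))
            (+-cong (*-congʳ s₁≈) (-‿cong (*-congˡ s₃≈)))))
        (trans (solve 11 (λ a₁ a₂ a₃ b₁ b₂ b₃ c₁ c₂ c₃ x y →
            let L  = c₁ :* x :+ c₂ :* y :+ c₃
                E₁ = x :* L :- (a₁ :* x :+ a₂ :* y :+ a₃)
                E₂ = y :* L :- (b₁ :* x :+ b₂ :* y :+ b₃)
                s₁ = c₁ :* a₁ :+ c₂ :* b₁ :+ c₃ :* c₁
                s₃ = c₁ :* a₃ :+ c₂ :* b₃ :+ c₃ :* c₃
            in c₁ :* (L :* L) :+ :- s₁ :* L :+ (s₁ :* c₃ :- c₁ :* s₃) :=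
               c₁ :* c₁ :* E₁ :+ c₁ :* c₂ :* E₂ :+
               (c₁ :* c₂ :* (b₂ :- a₁) :+ a₂ :* c₁ :* c₁ :- b₁ :* c₂ :* c₂) :* y)
            refl (fromℤ a₁) (fromℤ a₂) (fromℤ a₃) (fromℤ b₁) (fromℤ b₂) (fromℤ b₃) (fromℤ c₁) (fromℤ c₂) (fromℤ c₃) x y)
          (trans (+-cong (≈0-combination {fromℤ c₁ * fromℤ c₁} {fromℤ c₁ * fromℤ c₂} E₁≈0 E₂≈0 refl refl)
              (*-congʳ (trans (sym f₃≈) (fromℤ-cong f₃≡0))))
            (trans (+-identityˡ _) (zeroˡ y)))))))
      where
      s₁ s₃ : ℤ
      s₁ = c₁ ℤ.* a₁ ℤ.+ c₂ ℤ.* b₁ ℤ.+ c₃ ℤ.* c₁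
      s₃ = c₁ ℤ.* a₃ ℤ.+ c₂ ℤ.* b₃ ℤ.+ c₃ ℤ.* c₃
      s₁≈ = hom 5 (λ c₁ c₂ c₃ a b → c₁ :* a :+ c₂ :* b :+ c₃ :* c₁) (c₁ ∷ c₂ ∷ c₃ ∷ a₁ ∷ b₁ ∷ [])
      s₃≈ = hom 5 (λ c₁ c₂ c₃ a b → c₁ :* a :+ c₂ :* b :+ c₃ :* c₃) (c₁ ∷ c₂ ∷ c₃ ∷ a₃ ∷ b₃ ∷ [])
      f₃≈ = hom 6 (λ a₁ a₂ b₁ b₂ c₁ c₂ → c₁ :* c₂ :* (b₂ :- a₁) :+ a₂ :* c₁ :* c₁ :- b₁ :* c₂ :* c₂)
              (a₁ ∷ a₂ ∷ b₁ ∷ b₂ ∷ c₁ ∷ c₂ ∷ [])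

  cubic₃≢0 : ∀ {N x y} → Independent x y → IsEigenvector N x y →
    ¬ (Matrix.c₁ N ≡ + 0 × Matrix.c₂ N ≡ + 0) → cubic₃ N ≢ + 0
  cubic₃≢0 {N} independent eigen c≢0 f₃≡0 with Matrix.c₁ N ℤₚ.≟ + 0
  ... | no c₁≢0  = c₁≢0⇒cubic₃≢0 independent eigen c₁≢0 f₃≡0
  -- Now c₂ ≠ 0, and it becomes the first entry of the last row after exchanging the coordinates,
  -- which only changes the sign of the leading coefficient.
  ... | yes c₁≡0 = c₁≢0⇒cubic₃≢0 (Independent-swap independent) (IsEigenvector-swap eigen) (c≢0 ∘ (c₁≡0 ,_))
    (ℤₚ.neg-injective (≡.trans (≡.sym (cubic₃-swap N)) f₃≡0))

-- Degree, content and units in ℤ[X]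

coeff-+ₚ : ∀ p q n → coeff (p +ₚ q) n ≡ coeff p n ℤ.+ coeff q n
coeff-+ₚ []      q       n       = ≡.sym (ℤₚ.+-identityˡ _)
coeff-+ₚ (a ∷ p) []      n       = ≡.sym (ℤₚ.+-identityʳ _)
coeff-+ₚ (a ∷ p) (b ∷ q) zero    = ≡.refl
coeff-+ₚ (a ∷ p) (b ∷ q) (suc n) = coeff-+ₚ p q n

coeff-map : ∀ a p n → coeff (map (a ℤ.*_) p) n ≡ a ℤ.* coeff p n
coeff-map a []      n       = ≡.sym (ℤₚ.*-zeroʳ a)
coeff-map a (b ∷ p) zero    = ≡.refl
coeff-map a (b ∷ p) (suc n) = coeff-map a p n

coeff-∷*ₚ : ∀ a p q n → coeff ((a ∷ p) *ₚ q) n ≡ a ℤ.* coeff q n ℤ.+ coeff (+ 0 ∷ (p *ₚ q)) n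
coeff-∷*ₚ a p q n = ≡.trans (coeff-+ₚ (map (a ℤ.*_) q) _ n) (≡.cong (ℤ._+ _) (coeff-map a q n))

Degree≤ : ℤ[X] → ℕ → Set
Degree≤ p d = ∀ n → d ℕ.< n → coeff p n ≡ + 0

zero-shift : ∀ {p} → p ≈ₚ [] → (+ 0 ∷ p) ≈ₚ []
zero-shift p≈0 zero    = ≡.refl
zero-shift p≈0 (suc n) = p≈0 n

zero-tail : ∀ {a p} → Degree≤ (a ∷ p) 0 → p ≈ₚ []
zero-tail deg n = deg (suc n) (ℕ.s≤s ℕ.z≤n)

a*0+0≡0 : ∀ a {x y} → x ≡ + 0 → y ≡ + 0 → a ℤ.* x ℤ.+ y ≡ + 0
a*0+0≡0 a ≡.refl ≡.refl = ≡.trans (ℤₚ.+-identityʳ _) (ℤₚ.*-zeroʳ a)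

*ₚ-zeroˡ : ∀ p q → p ≈ₚ [] → p *ₚ q ≈ₚ []
*ₚ-zeroˡ []      q p≈0 n = ≡.refl
*ₚ-zeroˡ (a ∷ p) q p≈0 n = ≡.trans (coeff-∷*ₚ a p q n)
  (≡.cong₂ (λ a x → a ℤ.* coeff q n ℤ.+ x) (p≈0 0) (zero-shift (*ₚ-zeroˡ p q (p≈0 ∘ suc)) n))

*ₚ-zeroʳ : ∀ p q → q ≈ₚ [] → p *ₚ q ≈ₚ []
*ₚ-zeroʳ []      q q≈0 n = ≡.refl
*ₚ-zeroʳ (a ∷ p) q q≈0 n = ≡.trans (coeff-∷*ₚ a p q n)
  (a*0+0≡0 a (q≈0 n) (zero-shift (*ₚ-zeroʳ p q q≈0) n))

*ₚ-constantˡ : ∀ p q → Degree≤ p 0 → ∀ n → coeff (p *ₚ q) n ≡ coeff p 0 ℤ.* coeff q n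
*ₚ-constantˡ []      q deg n = ≡.refl
*ₚ-constantˡ (a ∷ p) q deg n = ≡.trans (coeff-∷*ₚ a p q n)
  (≡.trans (≡.cong (λ x → a ℤ.* coeff q n ℤ.+ x) (zero-shift (*ₚ-zeroˡ p q (zero-tail deg)) n)) (ℤₚ.+-identityʳ _))

*ₚ-constantʳ : ∀ p q → Degree≤ q 0 → ∀ n → coeff (p *ₚ q) n ≡ coeff p n ℤ.* coeff q 0
*ₚ-constantʳ []      q deg n       = ≡.refl
*ₚ-constantʳ (a ∷ p) q deg zero    = ≡.trans (coeff-∷*ₚ a p q 0) (ℤₚ.+-identityʳ _)
*ₚ-constantʳ (a ∷ p) q deg (suc n) = ≡.trans (coeff-∷*ₚ a p q (suc n))
  (≡.trans (≡.cong (λ x → a ℤ.* x ℤ.+ coeff (p *ₚ q) n) (deg (suc n) (ℕ.s≤s ℕ.z≤n)))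
    (≡.trans (≡.cong (ℤ._+ coeff (p *ₚ q) n) (ℤₚ.*-zeroʳ a))
      (≡.trans (ℤₚ.+-identityˡ _) (*ₚ-constantʳ p q deg n))))

Degree≤-* : ∀ p q {d e} → Degree≤ p d → Degree≤ q e → Degree≤ (p *ₚ q) (d ℕ.+ e)
Degree≤-* []      q degp degq n d+e<n = ≡.refl
Degree≤-* (a ∷ p) q {zero} degp degq n e<n =
  ≡.trans (*ₚ-constantˡ (a ∷ p) q degp n) (≡.trans (≡.cong (a ℤ.*_) (degq n e<n)) (ℤₚ.*-zeroʳ a))
Degree≤-* (a ∷ p) q {suc d} degp degq (suc n) (ℕ.s≤s d+e<n) = ≡.trans (coeff-∷*ₚ a p q (suc n))
  (a*0+0≡0 a (degq (suc n) (ℕₚ.≤-trans (ℕₚ.m≤n+m _ d) (ℕₚ.≤-trans (ℕₚ.≤-reflexive (ℕₚ.+-suc d _)) (ℕₚ.m≤n⇒m≤1+n d+e<n))))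
    (Degree≤-* p q {d} (λ n d<n → degp (suc n) (ℕ.s≤s d<n)) degq n d+e<n))

leading-* : ∀ p q {d e} → Degree≤ p d → Degree≤ q e →
  coeff (p *ₚ q) (d ℕ.+ e) ≡ coeff p d ℤ.* coeff q e
leading-* []      q degp degq = ≡.refl
leading-* (a ∷ p) q {zero} degp degq = *ₚ-constantˡ (a ∷ p) q degp _
leading-* (a ∷ p) q {suc d} {e} degp degq = ≡.trans (coeff-∷*ₚ a p q (suc (d ℕ.+ e)))
  (≡.trans (≡.cong (λ x → a ℤ.* x ℤ.+ coeff (p *ₚ q) (d ℕ.+ e)) (degq _ (ℕ.s≤s (ℕₚ.m≤n+m e d))))
    (≡.trans (≡.cong (ℤ._+ coeff (p *ₚ q) (d ℕ.+ e)) (ℤₚ.*-zeroʳ a))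
      (≡.trans (ℤₚ.+-identityˡ _)
        (leading-* p q (λ n d<n → degp (suc n) (ℕ.s≤s d<n)) degq))))

HasDegree-* : ∀ p q {d e} → HasDegree p d → HasDegree q e → HasDegree (p *ₚ q) (d ℕ.+ e)
HasDegree-* p q {d} {e} (p≢0 , degp) (q≢0 , degq) =
  (λ pq≡0 → [ p≢0 , q≢0 ]′ (ℤₚ.i*j≡0⇒i≡0∨j≡0 (coeff p d) (≡.trans (≡.sym (leading-* p q degp degq)) pq≡0))) ,
  Degree≤-* p q degp degq

HasDegree-≈ : ∀ {p q d} → p ≈ₚ q → HasDegree p d → HasDegree q d
HasDegree-≈ p≈q (p≢0 , deg) = p≢0 ∘ ≡.trans (p≈q _) , λ n d<n → ≡.trans (≡.sym (p≈q n)) (deg n d<n)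

HasDegree-unique : ∀ {p d e} → HasDegree p d → HasDegree p e → d ≡ e
HasDegree-unique (d≢0 , degd) (e≢0 , dege) = ℕₚ.≤-antisym
  (ℕₚ.≮⇒≥ (d≢0 ∘ dege _)) (ℕₚ.≮⇒≥ (e≢0 ∘ degd _))

zero-or-degree : ∀ p → p ≈ₚ [] ⊎ ∃[ d ] HasDegree p d
zero-or-degree [] = inj₁ λ _ → ≡.refl
zero-or-degree (a ∷ p) with zero-or-degree p
... | inj₂ (d , p≢0 , deg) = inj₂ (suc d , p≢0 , λ { (suc n) (ℕ.s≤s d<n) → deg n d<n })
... | inj₁ p≈0 with a ℤₚ.≟ + 0
...   | yes a≡0 = inj₁ λ { zero → a≡0 ; (suc n) → p≈0 n }
...   | no a≢0  = inj₂ (0 , a≢0 , λ { (suc n) _ → p≈0 n })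

content : ℤ[X] → ℕ
content []      = 0
content (a ∷ p) = gcd ∣ a ∣ (content p)

content∣coeff : ∀ p n → content p ∣ ∣ coeff p n ∣
content∣coeff []      n       = ∣.∣-refl
content∣coeff (a ∷ p) zero    = gcd[m,n]∣m ∣ a ∣ (content p)
content∣coeff (a ∷ p) (suc n) = ∣.∣-trans (gcd[m,n]∣n ∣ a ∣ (content p)) (content∣coeff p n)

content-greatest : ∀ {g} p → (∀ n → g ∣ ∣ coeff p n ∣) → g ∣ content p
content-greatest []      g∣p = g∣p 0
content-greatest (a ∷ p) g∣p = gcd-greatest (g∣p 0) (content-greatest p (g∣p ∘ suc))

divide : ∀ g p → (∀ n → g ∣ ∣ coeff p n ∣) → ∃[ q ] p ≡ map (+ g ℤ.*_) q
divide g []      g∣p = [] , ≡.refl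
divide g (a ∷ p) g∣p with divide g p (g∣p ∘ suc) | ℤ∣.∣ᵤ⇒∣ {+ g} {a} (g∣p 0)
... | q , p≡gq | ℤ∣.divides b a≡bg = b ∷ q , ≡.cong₂ _∷_ (≡.trans a≡bg (ℤₚ.*-comm b (+ g))) p≡gq

Primitive : ℤ[X] → Set
Primitive p = ∀ g → (∀ n → g ∣ ∣ coeff p n ∣) → g ≡ 1

-- A common divisor of `q` multiplied by the content of `p` divides all coefficients of `p`, hence
-- the content, which is non-zero and cancels.
primitive-quotient : ∀ p {d} q → HasDegree p d → p ≡ map (+ content p ℤ.*_) q → Primitive q
primitive-quotient p {d} q (p≢0 , _) p≡gq g g∣q = ∣.∣1⇒≡1
  (∣.*-cancelʳ-∣ (content p) {{ℕ.≢-nonZero content≢0}}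
    (≡.subst (g ℕ.* content p ∣_) (≡.sym (ℕₚ.*-identityˡ _)) (content-greatest p gc∣p)))
  where
  coeff-p : ∀ n → ∣ coeff p n ∣ ≡ ∣ coeff q n ∣ ℕ.* content p
  coeff-p n = ≡.trans (≡.cong ∣_∣ (≡.trans (≡.cong (λ p → coeff p n) p≡gq) (coeff-map (+ content p) q n)))
    (≡.trans (ℤₚ.abs-* (+ content p) (coeff q n)) (ℕₚ.*-comm (content p) _))
  gc∣p : ∀ n → g ℕ.* content p ∣ ∣ coeff p n ∣
  gc∣p n = ≡.subst (g ℕ.* content p ∣_) (≡.sym (coeff-p n)) (∣.*-monoˡ-∣ (content p) (g∣q n))
  content≢0 : content p ≢ 0
  content≢0 c≡0 = p≢0 (ℤₚ.∣i∣≡0⇒i≡0 (∣.0∣⇒≡0 (≡.subst (_∣ ∣ coeff p d ∣) c≡0 (content∣coeff p d))))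

Unit : ℤ[X] → Set
Unit p = Divisibility._∣_ (RawSemiring.*-rawMagma ℤ[X]-rawSemiring) p (+ 1 ∷ [])

constant-unit : ∀ p → Degree≤ p 0 → ∣ coeff p 0 ∣ ≡ 1 → Unit p
constant-unit p deg ∣p∣≡1 = (coeff p 0 ∷ []) Divisibility., λ n →
  ≡.trans (*ₚ-constantˡ (coeff p 0 ∷ []) p (λ { (suc n) _ → ≡.refl }) n) (square n)
  where
  square≡1 : ∀ i → ∣ i ∣ ≡ 1 → i ℤ.* i ≡ + 1
  square≡1 (+ 1)    ≡.refl = ≡.refl
  square≡1 -[1+ 0 ] ≡.refl = ≡.refl
  square : ∀ n → coeff p 0 ℤ.* coeff p n ≡ coeff (+ 1 ∷ []) n
  square zero    = square≡1 (coeff p 0) ∣p∣≡1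
  square (suc n) = ≡.trans (≡.cong (coeff p 0 ℤ.*_) (deg (suc n) (ℕ.s≤s ℕ.z≤n))) (ℤₚ.*-zeroʳ (coeff p 0))

primitive-constantˡ : ∀ {p} q r → Primitive p → p ≈ₚ q *ₚ r → Degree≤ q 0 → Unit q
primitive-constantˡ q r prim p≈qr deg = constant-unit q deg (prim _ λ n →
  ≡.subst (λ x → ∣ coeff q 0 ∣ ∣ ∣ x ∣) (≡.sym (≡.trans (p≈qr n) (*ₚ-constantˡ q r deg n)))
    (≡.subst (∣ coeff q 0 ∣ ∣_) (≡.sym (ℤₚ.abs-* (coeff q 0) (coeff r n))) (∣.m∣m*n _)))

primitive-constantʳ : ∀ {p} q r → Primitive p → p ≈ₚ q *ₚ r → Degree≤ r 0 → Unit r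
primitive-constantʳ q r prim p≈qr deg = constant-unit r deg (prim _ λ n →
  ≡.subst (λ x → ∣ coeff r 0 ∣ ∣ ∣ x ∣) (≡.sym (≡.trans (p≈qr n) (*ₚ-constantʳ q r deg n)))
    (≡.subst (∣ coeff r 0 ∣ ∣_) (≡.sym (ℤₚ.abs-* (coeff q n) (coeff r 0))) (∣.n∣m*n ∣ coeff q n ∣)))

maxAbsCoeff-quotient : ∀ {g} q → g ≢ 0 → maxAbsCoeff q ℕ.≤ maxAbsCoeff (map (+ g ℤ.*_) q)
maxAbsCoeff-quotient []      g≢0 = ℕₚ.≤-refl
maxAbsCoeff-quotient {g} (a ∷ q) g≢0 = ℕₚ.⊔-mono-≤
  (ℕₚ.≤-trans (ℕₚ.m≤n*m ∣ a ∣ g {{ℕ.≢-nonZero g≢0}}) (ℕₚ.≤-reflexive (≡.sym (ℤₚ.abs-* (+ g) a))))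
  (maxAbsCoeff-quotient q g≢0)

split-3 : ∀ d e → 3 ≡ d ℕ.+ e → d ≡ 0 ⊎ e ≡ 0 ⊎ (d ℕ.≤ 2 × e ℕ.≤ 2)
split-3 0 e _ = inj₁ ≡.refl
split-3 1 .2 ≡.refl = inj₂ (inj₂ (ℕ.s≤s ℕ.z≤n , ℕₚ.≤-refl))
split-3 2 .1 ≡.refl = inj₂ (inj₂ (ℕₚ.≤-refl , ℕ.s≤s ℕ.z≤n))
split-3 3 .0 ≡.refl = inj₂ (inj₁ ≡.refl)

-- Irreducibility of the cubic and passage to the minimal polynomial

module MinimalPolynomial {c ℓ₁ ℓ₂ ℓ₃} (R : RealNumbers c ℓ₁ ℓ₂ ℓ₃) where
  open OrderedField R
  open Cubic R
  open Solver using (solve; con; _:=_; _:+_; _:*_; _:-_; :-_)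

  eval-+ₚ : ∀ p q x → eval (p +ₚ q) x ≈ eval p x + eval q x
  eval-+ₚ []      q       x = sym (+-identityˡ _)
  eval-+ₚ (a ∷ p) []      x = sym (+-identityʳ _)
  eval-+ₚ (a ∷ p) (b ∷ q) x = trans (+-cong (fromℤ-+ a b) (*-congˡ (eval-+ₚ p q x)))
    (solve 5 (λ a b x p q → a :+ b :+ x :* (p :+ q) := a :+ x :* p :+ (b :+ x :* q)) refl
      (fromℤ a) (fromℤ b) x (eval p x) (eval q x))

  eval-map : ∀ a p x → eval (map (a ℤ.*_) p) x ≈ fromℤ a * eval p x
  eval-map a []      x = sym (zeroʳ _)
  eval-map a (b ∷ p) x = trans (+-cong (fromℤ-* a b) (*-congˡ (eval-map a p x)))
    (solve 4 (λ a b x p → a :* b :+ x :* (a :* p) := a :* (b :+ x :* p)) refl (fromℤ a) (fromℤ b) x (eval p x))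

  eval-*ₚ : ∀ p q x → eval (p *ₚ q) x ≈ eval p x * eval q x
  eval-*ₚ []      q x = sym (zeroˡ _)
  eval-*ₚ (a ∷ p) q x = trans (eval-+ₚ (map (a ℤ.*_) q) _ x)
    (trans (+-cong (eval-map a q x) (+-congˡ (*-congˡ (eval-*ₚ p q x))))
      (solve 4 (λ a x p q → a :* q :+ (con (+ 0) :+ x :* (p :* q)) := (a :+ x :* p) :* q) refl
        (fromℤ a) x (eval p x) (eval q x)))

  eval-zero : ∀ p x → p ≈ₚ [] → eval p x ≈ 0#
  eval-zero []      x p≈0 = refl
  eval-zero (a ∷ p) x p≈0 = trans (+-cong (fromℤ-cong (p≈0 0)) (*-congˡ (eval-zero p x (p≈0 ∘ suc))))
    (trans (+-identityˡ _) (zeroʳ x))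

  eval-cong : ∀ p q x → p ≈ₚ q → eval p x ≈ eval q x
  eval-cong []      q       x p≈q = sym (eval-zero q x (≡.sym ∘ p≈q))
  eval-cong (a ∷ p) []      x p≈q = eval-zero (a ∷ p) x p≈q
  eval-cong (a ∷ p) (b ∷ q) x p≈q = +-cong (fromℤ-cong (p≈q 0)) (*-congˡ (eval-cong p q x (p≈q ∘ suc)))

  eval-quadratic : ∀ p x → Degree≤ p 2 → eval p x ≈ quadratic (coeff p 2) (coeff p 1) (coeff p 0) x
  eval-quadratic p x deg = trans (eval-cong p (coeff p 0 ∷ coeff p 1 ∷ coeff p 2 ∷ []) x λ where
      0 → ≡.refl
      1 → ≡.refl
      2 → ≡.refl
      (suc (suc (suc n))) → deg (3 ℕ.+ n) (ℕ.s≤s (ℕ.s≤s (ℕ.s≤s ℕ.z≤n))))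
    (solve 4 (λ a b d x → d :+ x :* (b :+ x :* (a :+ x :* con (+ 0))) := a :* (x :* x) :+ b :* x :+ d) refl
      (fromℤ (coeff p 2)) (fromℤ (coeff p 1)) (fromℤ (coeff p 0)) x)

  notQuadratic-eval : ∀ {x d} p → NotQuadratic x → HasDegree p d → d ℕ.≤ 2 → ¬ eval p x ≈ 0#
  notQuadratic-eval {x} {d} p notQ (p≢0 , deg) d≤2 p≈0 = p≢0 (vanishing d d≤2)
    where
    zeros = notQ (coeff p 2) (coeff p 1) (coeff p 0)
      (trans (sym (eval-quadratic p x λ n 2<n → deg n (ℕₚ.≤-<-trans d≤2 2<n))) p≈0)
    vanishing : ∀ d → d ℕ.≤ 2 → coeff p d ≡ + 0
    vanishing 0 _ = proj₂ (proj₂ zeros)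
    vanishing 1 _ = proj₁ (proj₂ zeros)
    vanishing 2 _ = proj₁ zeros
    vanishing (suc (suc (suc _))) (ℕ.s≤s (ℕ.s≤s ()))

  -- In a factorisation either one factor is constant, and primitivity makes it a unit, or both
  -- degrees are at most 2. In the latter case one factor would vanish at `x`; this is known only
  -- under a double negation, which is enough for a contradiction.
  cubic-irreducible : ∀ {x} p → NotQuadratic x → eval p x ≈ 0# → HasDegree p 3 → Primitive p → Irreducible p
  cubic-irreducible {x} p notQ p≈0 deg@(p₃≢0 , _) prim = record { p∤1 = p∤1 ; split-∣1 = λ {q} {r} → split q r }
    where
    p∤1 : ¬ Unit p
    p∤1 (q Divisibility., qp≈1) with zero-or-degree q
    ... | inj₁ q≈0 = contradiction (≡.trans (≡.sym (*ₚ-zeroˡ q p q≈0 0)) (qp≈1 0)) λ ()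
    ... | inj₂ (d , degq) with HasDegree-unique {+ 1 ∷ []} {e = 0}
                                 (HasDegree-≈ {q *ₚ p} {+ 1 ∷ []} qp≈1 (HasDegree-* q p degq deg))
                                 ((λ ()) , λ { (suc n) _ → ≡.refl })
    ...   | d+3≡0 = contradiction (≡.trans (≡.sym (ℕₚ.+-suc d 2)) d+3≡0) λ ()
    split : ∀ q r → p ≈ₚ q *ₚ r → Unit q ⊎ Unit r
    split q r p≈qr with zero-or-degree q | zero-or-degree r
    ... | inj₁ q≈0 | _ = contradiction (≡.trans (p≈qr 3) (*ₚ-zeroˡ q r q≈0 3)) p₃≢0
    ... | _ | inj₁ r≈0 = contradiction (≡.trans (p≈qr 3) (*ₚ-zeroʳ q r r≈0 3)) p₃≢0
    ... | inj₂ (d , degq) | inj₂ (e , degr)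
      with split-3 d e (HasDegree-unique {q *ₚ r} (HasDegree-≈ {p} {q *ₚ r} p≈qr deg) (HasDegree-* q r degq degr))
    ...   | inj₁ ≡.refl        = inj₁ (primitive-constantˡ {p} q r prim p≈qr (proj₂ degq))
    ...   | inj₂ (inj₁ ≡.refl) = inj₂ (primitive-constantʳ {p} q r prim p≈qr (proj₂ degr))
    ...   | inj₂ (inj₂ (d≤2 , e≤2)) = ⊥-elim (x*y≈0⇒¬¬
      (trans (sym (eval-*ₚ q r x)) (trans (sym (eval-cong p (q *ₚ r) x p≈qr)) p≈0))
      [ notQuadratic-eval q notQ degq d≤2 , notQuadratic-eval r notQ degr e≤2 ]′)

  cubicIrrational : ∀ {x} p → NotQuadratic x → eval p x ≈ 0# → HasDegree p 3 →
    Σ[ cubic ∈ IsCubicIrrational x ] H cubic ℕ.≤ maxAbsCoeff p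
  cubicIrrational {x} p notQ p≈0 deg@(p₃≢0 , p>3) with divide (content p) p (content∣coeff p)
  ... | q , p≡gq = (record { minPoly     = q
                           ; irreducible = cubic-irreducible q notQ q≈0 degq (primitive-quotient p q deg p≡gq)
                           ; vanishes    = q≈0 } , degq) ,
        ≡.subst (λ p → maxAbsCoeff q ℕ.≤ maxAbsCoeff p) (≡.sym p≡gq) (maxAbsCoeff-quotient q g≢0)
    where
    g = content p
    coeff-p : ∀ n → coeff p n ≡ + g ℤ.* coeff q n
    coeff-p n = ≡.trans (≡.cong (λ p → coeff p n) p≡gq) (coeff-map (+ g) q n)
    g≢0 : g ≢ 0
    g≢0 g≡0 = p₃≢0 (≡.trans (coeff-p 3) (≡.cong (λ g → + g ℤ.* coeff q 3) g≡0))
    degq : HasDegree q 3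
    degq = (λ q₃≡0 → p₃≢0 (≡.trans (coeff-p 3) (≡.trans (≡.cong (+ g ℤ.*_) q₃≡0) (ℤₚ.*-zeroʳ (+ g))))) ,
      λ n 3<n → *≡0⇒ʳ (coeff q n) (g≢0 ∘ ℤₚ.+-injective) (≡.trans (≡.sym (coeff-p n)) (p>3 n 3<n))
    q≈0 : eval q x ≈ 0#
    q≈0 = *-cancelʳ-pos (fromℤ-pos {+ g} (ℤ.+<+ (ℕₚ.n≢0⇒n>0 g≢0)))
      (trans (*-comm _ _) (trans (sym (eval-map (+ g) q x))
        (trans (sym (reflexive (≡.cong (λ p → eval p x) p≡gq))) (trans p≈0 (sym (zeroˡ _))))))

-- Determinants, Cramer's rule and bounds on integer expressions

det : (x₂ x₁ x₀ y₂ y₁ y₀ z₂ z₁ z₀ : ℤ) → ℤ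
det x₂ x₁ x₀ y₂ y₁ y₀ z₂ z₁ z₀ =
  x₂ ℤ.* (y₁ ℤ.* z₀ ℤ.- y₀ ℤ.* z₁) ℤ.- x₁ ℤ.* (y₂ ℤ.* z₀ ℤ.- y₀ ℤ.* z₂) ℤ.+ x₀ ℤ.* (y₂ ℤ.* z₁ ℤ.- y₁ ℤ.* z₂)

module _ where
  open ℤSolver.+-*-Solver
  open ≡ using (refl)

  private
    detₚ : ∀ {n} (x₂ x₁ x₀ y₂ y₁ y₀ z₂ z₁ z₀ : Polynomial n) → Polynomial n
    detₚ x₂ x₁ x₀ y₂ y₁ y₀ z₂ z₁ z₀ =
      x₂ :* (y₁ :* z₀ :- y₀ :* z₁) :- x₁ :* (y₂ :* z₀ :- y₀ :* z₂) :+ x₀ :* (y₂ :* z₁ :- y₁ :* z₂)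

  -- The step adds multiples of two columns to the third and then permutes the columns cyclically,
  -- which is an even permutation for three of them.
  det-step : ∀ a b x₂ x₁ x₀ y₂ y₁ y₀ z₂ z₁ z₀ →
    det (a ℤ.* x₂ ℤ.+ b ℤ.* x₁ ℤ.+ x₀) x₂ x₁
        (a ℤ.* y₂ ℤ.+ b ℤ.* y₁ ℤ.+ y₀) y₂ y₁
        (a ℤ.* z₂ ℤ.+ b ℤ.* z₁ ℤ.+ z₀) z₂ z₁ ≡ det x₂ x₁ x₀ y₂ y₁ y₀ z₂ z₁ z₀
  det-step = solve 11 (λ a b x₂ x₁ x₀ y₂ y₁ y₀ z₂ z₁ z₀ →
    detₚ (a :* x₂ :+ b :* x₁ :+ x₀) x₂ x₁ (a :* y₂ :+ b :* y₁ :+ y₀) y₂ y₁ (a :* z₂ :+ b :* z₁ :+ z₀) z₂ z₁ :=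
    detₚ x₂ x₁ x₀ y₂ y₁ y₀ z₂ z₁ z₀) refl

  cramer₂ : ∀ u₂ u₁ u₀ x₂ x₁ x₀ y₂ y₁ y₀ z₂ z₁ z₀ →
    det u₂ u₁ u₀ y₂ y₁ y₀ z₂ z₁ z₀ ℤ.* x₂ ℤ.+ det x₂ x₁ x₀ u₂ u₁ u₀ z₂ z₁ z₀ ℤ.* y₂
      ℤ.+ det x₂ x₁ x₀ y₂ y₁ y₀ u₂ u₁ u₀ ℤ.* z₂ ≡ det x₂ x₁ x₀ y₂ y₁ y₀ z₂ z₁ z₀ ℤ.* u₂
  cramer₂ = solve 12 (λ u₂ u₁ u₀ x₂ x₁ x₀ y₂ y₁ y₀ z₂ z₁ z₀ →
    detₚ u₂ u₁ u₀ y₂ y₁ y₀ z₂ z₁ z₀ :* x₂ :+ detₚ x₂ x₁ x₀ u₂ u₁ u₀ z₂ z₁ z₀ :* y₂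
      :+ detₚ x₂ x₁ x₀ y₂ y₁ y₀ u₂ u₁ u₀ :* z₂ := detₚ x₂ x₁ x₀ y₂ y₁ y₀ z₂ z₁ z₀ :* u₂) refl

  cramer₁ : ∀ u₂ u₁ u₀ x₂ x₁ x₀ y₂ y₁ y₀ z₂ z₁ z₀ →
    det u₂ u₁ u₀ y₂ y₁ y₀ z₂ z₁ z₀ ℤ.* x₁ ℤ.+ det x₂ x₁ x₀ u₂ u₁ u₀ z₂ z₁ z₀ ℤ.* y₁
      ℤ.+ det x₂ x₁ x₀ y₂ y₁ y₀ u₂ u₁ u₀ ℤ.* z₁ ≡ det x₂ x₁ x₀ y₂ y₁ y₀ z₂ z₁ z₀ ℤ.* u₁
  cramer₁ = solve 12 (λ u₂ u₁ u₀ x₂ x₁ x₀ y₂ y₁ y₀ z₂ z₁ z₀ →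
    detₚ u₂ u₁ u₀ y₂ y₁ y₀ z₂ z₁ z₀ :* x₁ :+ detₚ x₂ x₁ x₀ u₂ u₁ u₀ z₂ z₁ z₀ :* y₁
      :+ detₚ x₂ x₁ x₀ y₂ y₁ y₀ u₂ u₁ u₀ :* z₁ := detₚ x₂ x₁ x₀ y₂ y₁ y₀ z₂ z₁ z₀ :* u₁) refl

  cramer₀ : ∀ u₂ u₁ u₀ x₂ x₁ x₀ y₂ y₁ y₀ z₂ z₁ z₀ →
    det u₂ u₁ u₀ y₂ y₁ y₀ z₂ z₁ z₀ ℤ.* x₀ ℤ.+ det x₂ x₁ x₀ u₂ u₁ u₀ z₂ z₁ z₀ ℤ.* y₀
      ℤ.+ det x₂ x₁ x₀ y₂ y₁ y₀ u₂ u₁ u₀ ℤ.* z₀ ≡ det x₂ x₁ x₀ y₂ y₁ y₀ z₂ z₁ z₀ ℤ.* u₀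
  cramer₀ = solve 12 (λ u₂ u₁ u₀ x₂ x₁ x₀ y₂ y₁ y₀ z₂ z₁ z₀ →
    detₚ u₂ u₁ u₀ y₂ y₁ y₀ z₂ z₁ z₀ :* x₀ :+ detₚ x₂ x₁ x₀ u₂ u₁ u₀ z₂ z₁ z₀ :* y₀
      :+ detₚ x₂ x₁ x₀ y₂ y₁ y₀ u₂ u₁ u₀ :* z₀ := detₚ x₂ x₁ x₀ y₂ y₁ y₀ z₂ z₁ z₀ :* u₀) refl

-- A record, because `x` could not be inferred from the inequality on its absolute value. The
-- operations below then build the bound of an expression by mirroring its syntax.
record Bounded (t : ℕ) (x : ℤ) : Set where
  constructor bounded
  field
    bound : ∣ x ∣ ℕ.≤ t

weaken : ∀ {s t x} → s ℕ.≤ t → Bounded s x → Bounded t x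
weaken s≤t (bounded x≤s) = bounded (ℕₚ.≤-trans x≤s s≤t)

infixl 6 _⊞_ _⊟_
infixl 7 _⊠_

_⊞_ : ∀ {s t x y} → Bounded s x → Bounded t y → Bounded (s ℕ.+ t) (x ℤ.+ y)
_⊞_ {x = x} {y} (bounded x≤s) (bounded y≤t) = bounded
  (ℕₚ.≤-trans (ℤₚ.∣i+j∣≤∣i∣+∣j∣ x y) (ℕₚ.+-mono-≤ x≤s y≤t))

_⊟_ : ∀ {s t x y} → Bounded s x → Bounded t y → Bounded (s ℕ.+ t) (x ℤ.- y)
_⊟_ {x = x} {y} (bounded x≤s) (bounded y≤t) = bounded
  (ℕₚ.≤-trans (ℤₚ.∣i-j∣≤∣i∣+∣j∣ x y) (ℕₚ.+-mono-≤ x≤s y≤t))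

_⊠_ : ∀ {s t x y} → Bounded s x → Bounded t y → Bounded (s ℕ.* t) (x ℤ.* y)
_⊠_ {x = x} {y} (bounded x≤s) (bounded y≤t) = bounded
  (ℕₚ.≤-trans (ℕₚ.≤-reflexive (ℤₚ.abs-* x y)) (ℕₚ.*-mono-≤ x≤s y≤t))

module _ where
  open ℕSolver.+-*-Solver
  open ≡ using (refl)

  det-bounded : ∀ {t x₂ x₁ x₀ y₂ y₁ y₀ z₂ z₁ z₀} → Bounded t x₂ → Bounded t x₁ → Bounded t x₀ →
    Bounded t y₂ → Bounded t y₁ → Bounded t y₀ → Bounded t z₂ → Bounded t z₁ → Bounded t z₀ →
    Bounded (6 ℕ.* t ℕ.^ 3) (det x₂ x₁ x₀ y₂ y₁ y₀ z₂ z₁ z₀)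
  det-bounded {t} x₂ x₁ x₀ y₂ y₁ y₀ z₂ z₁ z₀ = weaken
    (ℕₚ.≤-reflexive (solve 1 (λ t → let m = t :* (t :* t :+ t :* t) in m :+ m :+ m := con 6 :* t :^ 3) refl t))
    (x₂ ⊠ (y₁ ⊠ z₀ ⊟ y₀ ⊠ z₁) ⊟ x₁ ⊠ (y₂ ⊠ z₀ ⊟ y₀ ⊠ z₂) ⊞ x₀ ⊠ (y₂ ⊠ z₁ ⊟ y₁ ⊠ z₂))

  record BoundedMatrix (t : ℕ) (N : Matrix) : Set where
    open Matrix N
    field
      a₁≤ : Bounded t a₁
      a₂≤ : Bounded t a₂
      a₃≤ : Bounded t a₃
      b₁≤ : Bounded t b₁
      b₂≤ : Bounded t b₂
      b₃≤ : Bounded t b₃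
      c₁≤ : Bounded t c₁
      c₂≤ : Bounded t c₂
      c₃≤ : Bounded t c₃

  4e³≤12e³ : ∀ e → 4 ℕ.* e ℕ.^ 3 ℕ.≤ 12 ℕ.* e ℕ.^ 3
  4e³≤12e³ e = ℕₚ.*-monoˡ-≤ (e ℕ.^ 3) (ℕₚ.m≤m+n 4 8)

  -- The constant 3024 is 14 · 6³; the cubic above needs at most 12 products per coefficient, and 2
  -- · 6³ = 432 is slack.
  12[6t³]³≤3024t⁹ : ∀ t → 12 ℕ.* (6 ℕ.* t ℕ.^ 3) ℕ.^ 3 ℕ.≤ 3024 ℕ.* t ℕ.^ 9
  12[6t³]³≤3024t⁹ t = ℕₚ.≤-trans
    (ℕₚ.≤-reflexive (solve 1 (λ t → con 12 :* (con 6 :* t :^ 3) :^ 3 := con 2592 :* t :^ 9) refl t))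
    (ℕₚ.*-monoˡ-≤ (t ℕ.^ 9) (ℕₚ.m≤m+n 2592 432))

  module _ {e N} (bounds : BoundedMatrix e N) where
    open BoundedMatrix bounds

    cubic₃-bounded : Bounded (12 ℕ.* e ℕ.^ 3) (cubic₃ N)
    cubic₃-bounded = weaken (ℕₚ.≤-trans
      (ℕₚ.≤-reflexive (solve 1 (λ e → e :* e :* (e :+ e) :+ e :* e :* e :+ e :* e :* e := con 4 :* e :^ 3) refl e))
      (4e³≤12e³ e))
      (c₁≤ ⊠ c₂≤ ⊠ (b₂≤ ⊟ a₁≤) ⊞ a₂≤ ⊠ c₁≤ ⊠ c₁≤ ⊟ b₁≤ ⊠ c₂≤ ⊠ c₂≤)

    cubic₂-bounded : Bounded (12 ℕ.* e ℕ.^ 3) (cubic₂ N)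
    cubic₂-bounded = weaken
      (ℕₚ.≤-reflexive (solve 1 (λ e →
        e :* (e :+ e) :* (e :+ e) :+ e :* e :* e :+ e :* e :* (e :+ e :+ e :+ e) :+ e :* e :* e :+ (e :+ e) :* e :* e
        := con 12 :* e :^ 3) refl e))
      (c₂≤ ⊠ (c₃≤ ⊟ a₁≤) ⊠ (b₂≤ ⊟ a₁≤) ⊟ c₂≤ ⊠ c₁≤ ⊠ a₃≤
        ⊞ c₁≤ ⊠ a₂≤ ⊠ (c₃≤ ⊞ c₃≤ ⊟ a₁≤ ⊟ b₂≤) ⊟ b₃≤ ⊠ c₂≤ ⊠ c₂≤ ⊞ (b₁≤ ⊞ b₁≤) ⊠ c₂≤ ⊠ a₂≤)

    cubic₁-bounded : Bounded (12 ℕ.* e ℕ.^ 3) (cubic₁ N)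
    cubic₁-bounded = weaken
      (ℕₚ.≤-reflexive (solve 1 (λ e →
        e :* (e :+ e) :* (e :+ e) :+ e :* e :* (e :+ e :+ e :+ e) :+ e :* e :* e :+ (e :+ e) :* e :* e :+ e :* e :* e
        := con 12 :* e :^ 3) refl e))
      (a₂≤ ⊠ (c₃≤ ⊟ a₁≤) ⊠ (c₃≤ ⊟ b₂≤) ⊞ a₃≤ ⊠ c₂≤ ⊠ (a₁≤ ⊞ a₁≤ ⊟ b₂≤ ⊟ c₃≤)
        ⊟ a₃≤ ⊠ a₂≤ ⊠ c₁≤ ⊞ (b₃≤ ⊞ b₃≤) ⊠ c₂≤ ⊠ a₂≤ ⊟ b₁≤ ⊠ a₂≤ ⊠ a₂≤)

    cubic₀-bounded : Bounded (12 ℕ.* e ℕ.^ 3) (cubic₀ N)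
    cubic₀-bounded = weaken (ℕₚ.≤-trans
      (ℕₚ.≤-reflexive (solve 1 (λ e → e :* e :* e :+ e :* e :* (e :+ e) :+ e :* e :* e := con 4 :* e :^ 3) refl e))
      (4e³≤12e³ e))
      (c₂≤ ⊠ a₃≤ ⊠ a₃≤ ⊟ a₃≤ ⊠ a₂≤ ⊠ (c₃≤ ⊟ b₂≤) ⊟ b₃≤ ⊠ a₂≤ ⊠ a₂≤)

    cubicPolynomial-height : maxAbsCoeff (cubic₀ N ∷ cubic₁ N ∷ cubic₂ N ∷ cubic₃ N ∷ []) ℕ.≤ 12 ℕ.* e ℕ.^ 3
    cubicPolynomial-height = ℕₚ.⊔-lub (Bounded.bound cubic₀-bounded) (ℕₚ.⊔-lub (Bounded.bound cubic₁-bounded)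
      (ℕₚ.⊔-lub (Bounded.bound cubic₂-bounded) (ℕₚ.⊔-lub (Bounded.bound cubic₃-bounded) ℕ.z≤n)))

  BoundedMatrix-swap : ∀ {e N} → BoundedMatrix e N → BoundedMatrix e (swap N)
  BoundedMatrix-swap bounds = record
    { a₁≤ = b₂≤ ; a₂≤ = b₁≤ ; a₃≤ = b₃≤
    ; b₁≤ = a₂≤ ; b₂≤ = a₁≤ ; b₃≤ = a₃≤
    ; c₁≤ = c₂≤ ; c₂≤ = c₁≤ ; c₃≤ = c₃≤
    }
    where open BoundedMatrix bounds

-- Convergents and the transition matrix

module Convergents (a b : ℕ → ℤ) where
  -- As with shiftedDenominator, the indices start at -3.
  A B C : ℕ → ℤ
  A = solution a b (+ 0) (+ 0) (+ 1)
  B = solution a b (+ 0) (+ 1) (+ 0)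
  C = solution a b (+ 1) (+ 0) (+ 0)

  C≡shiftedDenominator : ∀ n → C n ≡ shiftedDenominator a b n
  C≡shiftedDenominator 0 = ≡.refl
  C≡shiftedDenominator 1 = ≡.refl
  C≡shiftedDenominator 2 = ≡.refl
  C≡shiftedDenominator (suc (suc (suc n))) = ≡.cong₂ ℤ._+_
    (≡.cong₂ (λ x y → a n ℤ.* x ℤ.+ b n ℤ.* y) (C≡shiftedDenominator (suc (suc n))) (C≡shiftedDenominator (suc n)))
    (C≡shiftedDenominator n)

  windowDet : ℕ → ℤ
  windowDet n = det (A (2 ℕ.+ n)) (A (1 ℕ.+ n)) (A n)
                    (B (2 ℕ.+ n)) (B (1 ℕ.+ n)) (B n)
                    (C (2 ℕ.+ n)) (C (1 ℕ.+ n)) (C n)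

  windowDet≡1 : ∀ n → windowDet n ≡ + 1
  windowDet≡1 zero    = ≡.refl
  windowDet≡1 (suc n) = ≡.trans (det-step (a n) (b n)
    (A (2 ℕ.+ n)) (A (1 ℕ.+ n)) (A n) (B (2 ℕ.+ n)) (B (1 ℕ.+ n)) (B n) (C (2 ℕ.+ n)) (C (1 ℕ.+ n)) (C n)) (windowDet≡1 n)

  -- transition k m is M m · (M k)⁻¹, where the rows of M n are the windows of
  -- A, B and C at n; its entries are given by Cramer's rule.
  module _ (k m : ℕ) where
    replaceA replaceB replaceC : (ℕ → ℤ) → ℤ
    replaceA U = det (U (2 ℕ.+ m)) (U (1 ℕ.+ m)) (U m)
                     (B (2 ℕ.+ k)) (B (1 ℕ.+ k)) (B k)
                     (C (2 ℕ.+ k)) (C (1 ℕ.+ k)) (C k)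
    replaceB U = det (A (2 ℕ.+ k)) (A (1 ℕ.+ k)) (A k)
                     (U (2 ℕ.+ m)) (U (1 ℕ.+ m)) (U m)
                     (C (2 ℕ.+ k)) (C (1 ℕ.+ k)) (C k)
    replaceC U = det (A (2 ℕ.+ k)) (A (1 ℕ.+ k)) (A k)
                     (B (2 ℕ.+ k)) (B (1 ℕ.+ k)) (B k)
                     (U (2 ℕ.+ m)) (U (1 ℕ.+ m)) (U m)

    transition : Matrix
    transition = matrix (replaceA A) (replaceB A) (replaceC A)
                        (replaceA B) (replaceB B) (replaceC B)
                        (replaceA C) (replaceB C) (replaceC C)

    combination : (ℕ → ℤ) → ℕ → ℤ
    combination U i = replaceA U ℤ.* A i ℤ.+ replaceB U ℤ.* B i ℤ.+ replaceC U ℤ.* C i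

    transition-window : ∀ U → combination U (2 ℕ.+ k) ≡ U (2 ℕ.+ m) ×
      combination U (1 ℕ.+ k) ≡ U (1 ℕ.+ m) × combination U k ≡ U m
    transition-window U =
      drop-det (cramer₂ u₂ u₁ u₀ x₂ x₁ x₀ y₂ y₁ y₀ z₂ z₁ z₀) ,
      drop-det (cramer₁ u₂ u₁ u₀ x₂ x₁ x₀ y₂ y₁ y₀ z₂ z₁ z₀) ,
      drop-det (cramer₀ u₂ u₁ u₀ x₂ x₁ x₀ y₂ y₁ y₀ z₂ z₁ z₀)
      where
      u₂ = U (2 ℕ.+ m)
      u₁ = U (1 ℕ.+ m)
      u₀ = U m
      x₂ = A (2 ℕ.+ k)
      x₁ = A (1 ℕ.+ k)
      x₀ = A k
      y₂ = B (2 ℕ.+ k)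
      y₁ = B (1 ℕ.+ k)
      y₀ = B k
      z₂ = C (2 ℕ.+ k)
      z₁ = C (1 ℕ.+ k)
      z₀ = C k
      drop-det : ∀ {x u} → x ≡ windowDet k ℤ.* u → x ≡ u
      drop-det {u = u} eq = ≡.trans eq (≡.trans (≡.cong (ℤ._* u) (windowDet≡1 k)) (ℤₚ.*-identityˡ u))

-- Divisibility of a window travels backwards through the recurrence, again because the oldest term
-- has coefficient 1. For the denominators it ends at their initial value 1.
solution-∣ : ∀ {a b X} s → IsSolutionℤ a b X → ∀ n →
  s ℤ∣.∣ X n → s ℤ∣.∣ X (1 ℕ.+ n) → s ℤ∣.∣ X (2 ℕ.+ n) → s ℤ∣.∣ X 0
solution-∣ s sol zero    s∣X₀ s∣X₁ s∣X₂ = s∣X₀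
solution-∣ {a} {b} {X} s sol (suc n) s∣X₁ s∣X₂ s∣X₃ = solution-∣ {a} {b} {X} s sol n s∣X₀ s∣X₁ s∣X₂
  where
  s∣X₀ : s ℤ∣.∣ X n
  s∣X₀ = ℤ∣.∣m+n∣m⇒∣n (≡.subst (s ℤ∣.∣_) (sol n) s∣X₃)
    (ℤ∣.∣m∣n⇒∣m+n (ℤ∣.∣n⇒∣m*n (a n) s∣X₂) (ℤ∣.∣n⇒∣m*n (b n) s∣X₁))

solution-nonneg : ∀ {a b X} → IsSolutionℤ a b X → (∀ n → + 0 ℤ.≤ a n) → (∀ n → + 0 ℤ.≤ b n) →
  + 0 ℤ.≤ X 0 → + 0 ℤ.≤ X 1 → + 0 ℤ.≤ X 2 → ∀ n → + 0 ℤ.≤ X n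
solution-nonneg {a} {b} {X} sol 0≤a 0≤b 0≤X₀ 0≤X₁ 0≤X₂ n = proj₁ (window n)
  where
  0≤* : ∀ {x y} → + 0 ℤ.≤ x → + 0 ℤ.≤ y → + 0 ℤ.≤ x ℤ.* y
  0≤* {+ m} {+ n} _ _ = ≡.subst (+ 0 ℤ.≤_) (ℤₚ.pos-* m n) (ℤ.+≤+ ℕ.z≤n)
  window : ∀ n → + 0 ℤ.≤ X n × + 0 ℤ.≤ X (1 ℕ.+ n) × + 0 ℤ.≤ X (2 ℕ.+ n)
  window zero    = 0≤X₀ , 0≤X₁ , 0≤X₂
  window (suc n) with window n
  ... | p₀ , p₁ , p₂ = p₁ , p₂ , ≡.subst (+ 0 ℤ.≤_) (≡.sym (sol n))
    (ℤₚ.+-mono-≤ (ℤₚ.+-mono-≤ (0≤* (0≤a n) p₂) (0≤* (0≤b n) p₁)) p₀)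

-- The eigenvector given by a repeated pair (α, β)

module Transition {c ℓ₁ ℓ₂ ℓ₃} (R : RealNumbers c ℓ₁ ℓ₂ ℓ₃) where
  open OrderedField R
  open Expansions R
  open Solutions R
  open Independence R
  open Cubic R
  open MinimalPolynomial R
  open Solver using (solve; con; _:=_; _:+_; _:*_; _:-_; :-_)

  Expansion-resp : ∀ {α β a b a′ b′} → (∀ n → a n ≡ a′ n) → (∀ n → b n ≡ b′ n) →
    Expansion α β a b → Expansion α β a′ b′
  Expansion-resp {α} a≡ b≡ e = record
    { 1<α    = 1<α
    ; 0≤β    = 0≤β
    ; β<α    = β<α
    ; 1≤a    = λ n → ≡.subst (+ 1 ℤ.≤_) (a≡ n) (1≤a n)
    ; 0≤b    = λ n → ≡.subst (+ 0 ℤ.≤_) (b≡ n) (0≤b n)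
    ; α-next = λ n → trans (α-next n) (+-congʳ (*-congʳ (fromℤ-cong (a≡ n))))
    ; β-next = λ n → trans (β-next n) (+-congʳ (*-congʳ (fromℤ-cong (b≡ n))))
    }
    where open Expansion e

  module _ {α₀ β₀ a b} (mcf : IsMCF α₀ β₀ a b) where
    open Jacobi mcf
    open Convergents a b

    -- (α₀ , β₀ , 1) · P n is the product of M n with (α n , β n , 1).
    P : ℕ → Carrier
    P zero    = 1#
    P (suc n) = P n * α (suc n)

    0<P : ∀ n → 0# < P n
    0<P zero    = 0<1
    0<P (suc n) = *-pos (0<P n) (0<α n)

    -- The strict inequality is where a non-empty period enters: the offset is `suc h`.
    P<P : ∀ h n → P n < P (suc h ℕ.+ n)
    P<P 0 n = 0<y-x⇒x<y (<-respʳ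
      (trans (solve 3 (λ p α u → p :* (α :- u) := p :* α :- p :* u) refl (P n) (α (suc n)) 1#)
        (+-congˡ (-‿cong (*-identityʳ _))))
      (*-pos (0<P n) (x<y⇒0<y-x (1<α n))))
    P<P (suc h) n = <-trans (P<P h n) (P<P 0 (suc h ℕ.+ n))

    pairingℤ : (ℕ → ℤ) → ℕ → Carrier
    pairingℤ X = pairing α β (fromℤ ∘ X)

    pairing-P : ∀ {X} → IsSolutionℤ a b X → ∀ n → pairingℤ X n ≈ pairingℤ X 0 * P n
    pairing-P sol zero = sym (*-identityʳ _)
    pairing-P {X} sol (suc n) = trans
      (pairing-next {α} {β} {a} {b} {fromℤ ∘ X} n (α-next n) (β-next n) (embed {a} {b} {X} sol))
      (trans (*-congʳ (pairing-P {X} sol n)) (*-assoc _ _ _))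

    pairing-A : pairingℤ A 0 ≈ α₀
    pairing-A = trans (solve 2 (λ x y → con (+ 1) :* x :+ con (+ 0) :* y :+ con (+ 0) := x) refl (α 0) (β 0)) α-start

    pairing-B : pairingℤ B 0 ≈ β₀
    pairing-B = trans (solve 2 (λ x y → con (+ 0) :* x :+ con (+ 1) :* y :+ con (+ 0) := y) refl (α 0) (β 0)) β-start

    pairing-C : pairingℤ C 0 ≈ 1#
    pairing-C = trans (solve 2 (λ x y → con (+ 0) :* x :+ con (+ 0) :* y :+ con (+ 1) := con (+ 1)) refl (α 0) (β 0)) fromℤ-1

    module _ (k m : ℕ) (α≈ : α m ≈ α k) (β≈ : β m ≈ β k) where

      N : Matrix
      N = transition k m

      -- A window at `m` is an integral combination of the windows of A, B, C at `k`. Pairing both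
      -- sides with the common values of α and β turns this into a relation between α₀, β₀ and 1,
      -- since the form at n is its initial value times `P n`.
      row : ∀ {U u} → IsSolutionℤ a b U → pairingℤ U 0 ≈ u →
        (fromℤ (replaceA k m U) * α₀ + fromℤ (replaceB k m U) * β₀ + fromℤ (replaceC k m U)) * P k ≈ u * P m
      row {U} {u} sol start = begin
        (rA * α₀ + rB * β₀ + rC) * P k
          ≈⟨ solve 6 (λ rA rB rC x y p → (rA :* x :+ rB :* y :+ rC) :* p := rA :* (x :* p) :+ rB :* (y :* p) :+ rC :* p) refl
               rA rB rC α₀ β₀ (P k) ⟩
        rA * (α₀ * P k) + rB * (β₀ * P k) + rC * P k
          ≈⟨ +-cong (+-cong (*-congˡ (at-k {A} (λ _ → ≡.refl) pairing-A)) (*-congˡ (at-k {B} (λ _ → ≡.refl) pairing-B)))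
               (*-congˡ (trans (sym (*-identityˡ _)) (at-k {C} (λ _ → ≡.refl) pairing-C))) ⟩
        rA * pairingℤ A k + rB * pairingℤ B k + rC * pairingℤ C k
          ≈⟨ solve 14 (λ rA rB rC A₂ A₁ A₀ B₂ B₁ B₀ C₂ C₁ C₀ α β →
               rA :* (A₂ :* α :+ A₁ :* β :+ A₀) :+ rB :* (B₂ :* α :+ B₁ :* β :+ B₀) :+ rC :* (C₂ :* α :+ C₁ :* β :+ C₀) :=
               (rA :* A₂ :+ rB :* B₂ :+ rC :* C₂) :* α :+ (rA :* A₁ :+ rB :* B₁ :+ rC :* C₁) :* β
                 :+ (rA :* A₀ :+ rB :* B₀ :+ rC :* C₀)) refl rA rB rC
               (fromℤ (A (2 ℕ.+ k))) (fromℤ (A (1 ℕ.+ k))) (fromℤ (A k))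
               (fromℤ (B (2 ℕ.+ k))) (fromℤ (B (1 ℕ.+ k))) (fromℤ (B k))
               (fromℤ (C (2 ℕ.+ k))) (fromℤ (C (1 ℕ.+ k))) (fromℤ (C k)) (α k) (β k) ⟩
        combine-at (2 ℕ.+ k) * α k + combine-at (1 ℕ.+ k) * β k + combine-at k
          ≈⟨ +-cong (+-cong (*-cong (column (2 ℕ.+ k) (proj₁ windows)) (sym α≈))
               (*-cong (column (1 ℕ.+ k) (proj₁ (proj₂ windows))) (sym β≈))) (column k (proj₂ (proj₂ windows))) ⟩
        pairingℤ U m
          ≈⟨ trans (pairing-P {U} sol m) (*-congʳ start) ⟩
        u * P m ∎
        where
        open SetoidReasoning setoid using (begin_; step-≈-⟩; _∎)
        rA = fromℤ (replaceA k m U)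
        rB = fromℤ (replaceB k m U)
        rC = fromℤ (replaceC k m U)
        windows = transition-window k m U
        combine-at : ℕ → Carrier
        combine-at i = rA * fromℤ (A i) + rB * fromℤ (B i) + rC * fromℤ (C i)
        column : ∀ i {u} → combination k m U i ≡ u → combine-at i ≈ fromℤ u
        column i eq = trans (sym (hom 6 (λ p x q y r z → p :* x :+ q :* y :+ r :* z)
            (replaceA k m U ∷ A i ∷ replaceB k m U ∷ B i ∷ replaceC k m U ∷ C i ∷ []))) (fromℤ-cong eq)
        at-k : ∀ {X x} → IsSolutionℤ a b X → pairingℤ X 0 ≈ x → x * P k ≈ pairingℤ X k
        at-k {X} solX startX = sym (trans (pairing-P {X} solX k) (*-congʳ startX))

      eigenvalue-P : eigenvalue N α₀ β₀ * P k ≈ P m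
      eigenvalue-P = trans (row {C} (λ _ → ≡.refl) pairing-C) (*-identityˡ _)

      eigenvector : IsEigenvector N α₀ β₀
      eigenvector = record
        { row-a = scaled {A} (λ _ → ≡.refl) pairing-A
        ; row-b = scaled {B} (λ _ → ≡.refl) pairing-B
        }
        where
        scaled : ∀ {U u} → IsSolutionℤ a b U → pairingℤ U 0 ≈ u → u * eigenvalue N α₀ β₀ ≈
          fromℤ (replaceA k m U) * α₀ + fromℤ (replaceB k m U) * β₀ + fromℤ (replaceC k m U)
        scaled {U} sol start = *-cancelʳ-pos (0<P k) (trans (*-assoc _ _ _)
          (trans (*-congˡ eigenvalue-P) (sym (row {U} sol start))))

      -- Otherwise the integer c₃ is the eigenvalue and divides the window of C
      -- at m, hence all windows of C, so that it is ± 1.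
      transition-nonscalar : P k < P m → ¬ (Matrix.c₁ N ≡ + 0 × Matrix.c₂ N ≡ + 0)
      transition-nonscalar Pk<Pm (c₁≡0 , c₂≡0) = not-unit c₃ unit λ≈c₃
        where
        c₃ = Matrix.c₃ N
        λ≈c₃ : fromℤ c₃ * P k ≈ P m
        λ≈c₃ = trans (*-congʳ (sym (trans
            (+-congʳ (+-cong (*-congʳ (fromℤ-cong c₁≡0)) (*-congʳ (fromℤ-cong c₂≡0))))
            (solve 3 (λ x y s → con (+ 0) :* x :+ con (+ 0) :* y :+ s := s) refl α₀ β₀ (fromℤ c₃)))))
          eigenvalue-P
        c₃∣ : ∀ i {u} → combination k m C i ≡ u → c₃ ℤ∣.∣ u
        c₃∣ i eq = ℤ∣.divides (C i) (≡.trans (≡.sym eq) (≡.trans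
          (≡.cong₂ (λ x y → x ℤ.* A i ℤ.+ y ℤ.* B i ℤ.+ c₃ ℤ.* C i) c₁≡0 c₂≡0)
          (≡.trans (ℤₚ.+-identityˡ _) (ℤₚ.*-comm c₃ (C i)))))
        windows = transition-window k m C
        unit : ∣ c₃ ∣ ≡ 1
        unit = ∣.∣1⇒≡1 (ℤ∣.∣⇒∣ᵤ (solution-∣ {a} {b} {C} c₃ (λ _ → ≡.refl) m
          (c₃∣ k (proj₂ (proj₂ windows))) (c₃∣ (1 ℕ.+ k) (proj₁ (proj₂ windows))) (c₃∣ (2 ℕ.+ k) (proj₁ windows))))
        -- The eigenvalue is the quotient of `P m` by `P k`; it exceeds 1, which excludes 1, and is
        -- positive, which excludes -1.
        not-unit : ∀ s → ∣ s ∣ ≡ 1 → ¬ fromℤ s * P k ≈ P m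
        not-unit (+ 1)    ≡.refl eq = <-irrefl (trans (sym (*-identityˡ _)) (trans (*-congʳ (sym fromℤ-1)) eq)) Pk<Pm
        not-unit -[1+ 0 ] ≡.refl eq = <-irrefl (sym (trans (+-congˡ (sym eq))
            (solve 1 (λ p → p :+ con (-[1+ 0 ]) :* p := con (+ 0)) refl (P k)))) (+-pos (0<P k) (0<P m))

module CubicFromMatrix {c ℓ₁ ℓ₂ ℓ₃} (R : RealNumbers c ℓ₁ ℓ₂ ℓ₃) where
  open OrderedField R
  open Independence R
  open Cubic R
  open MinimalPolynomial R
  open Solver using (solve; con; _:=_; _:+_; _:*_; _:-_; :-_)

  -- The height bound comes after the choice of the minimal polynomial, because being a cubic
  -- irrational is asserted without the unit square hypotheses under which the entries of `N` are
  -- bounded.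
  eigenvector⇒cubic : ∀ {N x y} → Independent x y → IsEigenvector N x y →
    ¬ (Matrix.c₁ N ≡ + 0 × Matrix.c₂ N ≡ + 0) →
    Σ[ cubic-x ∈ IsCubicIrrational x ] (∀ t → BoundedMatrix (6 ℕ.* t ℕ.^ 3) N → H cubic-x ℕ.≤ 3024 ℕ.* t ℕ.^ 9)
  eigenvector⇒cubic {N} {x} {y} independent eigen nonscalar = proj₁ cubic-x , λ t bounds →
    ℕₚ.≤-trans (proj₂ cubic-x) (ℕₚ.≤-trans (cubicPolynomial-height bounds) (12[6t³]³≤3024t⁹ t))
    where
    p : ℤ[X]
    p = cubic₀ N ∷ cubic₁ N ∷ cubic₂ N ∷ cubic₃ N ∷ []
    p≈0 : eval p x ≈ 0#
    p≈0 = trans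
      (solve 5 (λ x f₀ f₁ f₂ f₃ → f₀ :+ x :* (f₁ :+ x :* (f₂ :+ x :* (f₃ :+ x :* con (+ 0)))) :=
        f₀ :+ x :* (f₁ :+ x :* (f₂ :+ x :* f₃))) refl
        x (fromℤ (cubic₀ N)) (fromℤ (cubic₁ N)) (fromℤ (cubic₂ N)) (fromℤ (cubic₃ N)))
      (cubic-vanishes eigen)
    degree : HasDegree p 3
    degree = cubic₃≢0 independent eigen nonscalar , λ where
      (suc (suc (suc (suc n)))) _ → ≡.refl
      3 (ℕ.s≤s (ℕ.s≤s (ℕ.s≤s ())))
      2 (ℕ.s≤s (ℕ.s≤s ()))
      1 (ℕ.s≤s ())
    cubic-x = cubicIrrational p (x-notQuadratic independent eigen nonscalar) p≈0 degree

-- Numerators and denominators in the unit square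

module Denominators {c ℓ₁ ℓ₂ ℓ₃} (R : RealNumbers c ℓ₁ ℓ₂ ℓ₃) {α₀ β₀ a b}
  (mcf : OverReals.IsMCF R α₀ β₀ a b) where
  open OrderedField R
  open Expansions R
  open Solutions R
  open Independence R
  open Convergents a b
  open Jacobi mcf
  open Solver using (solve; con; _:=_; _:+_; _:*_; _:-_; :-_)

  floor≡0 : ∀ {z x} → IsFloorOf z x → 0# < x → x < 1# → z ≡ + 0
  floor≡0 {z} (z≤x , x<1+z) 0<x x<1 = ℤₚ.≤-antisym
    (i<1+j⇒i≤j (fromℤ-cancel-< (≤-<-trans z≤x (<-respʳ (sym fromℤ-1) x<1))))
    (i<1+j⇒i≤j (fromℤ-cancel-< (<-trans 0<x x<1+z)))

  module _ (0<α₀ : 0# < α₀) (α₀<1 : α₀ < 1#) (0<β₀ : 0# < β₀) (β₀<1 : β₀ < 1#) where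

    a₀≡0 : a 0 ≡ + 0
    a₀≡0 = floor≡0 (a-floor 0) (<-respʳ (sym α-start) 0<α₀) (<-respˡ (sym α-start) α₀<1)

    b₀≡0 : b 0 ≡ + 0
    b₀≡0 = floor≡0 (b-floor 0) (<-respʳ (sym β-start) 0<β₀) (<-respˡ (sym β-start) β₀<1)

    -- From index 1 on the signs of the digits come from the algorithm. At index 0 they come from
    -- the unit square, where both digits vanish.
    0≤a : ∀ n → + 0 ℤ.≤ a n
    0≤a zero    = ℤₚ.≤-reflexive (≡.sym a₀≡0)
    0≤a (suc n) = ℤₚ.≤-trans (ℤ.+≤+ ℕ.z≤n) (Expansion.1≤a tail n)

    0≤b : ∀ n → + 0 ℤ.≤ b n
    0≤b zero    = ℤₚ.≤-reflexive (≡.sym b₀≡0)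
    0≤b (suc n) = Expansion.0≤b tail n

    solution-0≤ : ∀ {x₀ x₁ x₂} → + 0 ℤ.≤ x₀ → + 0 ℤ.≤ x₁ → + 0 ℤ.≤ x₂ → ∀ n → + 0 ℤ.≤ solution a b x₀ x₁ x₂ n
    solution-0≤ {x₀} {x₁} {x₂} = solution-nonneg {a} {b} {solution a b x₀ x₁ x₂} (λ _ → ≡.refl) 0≤a 0≤b

    first : ∀ x₀ x₁ x₂ → solution a b x₀ x₁ x₂ 3 ≡ x₀
    first x₀ x₁ x₂ = ≡.trans (≡.cong₂ (λ x y → x ℤ.* x₂ ℤ.+ y ℤ.* x₁ ℤ.+ x₀) a₀≡0 b₀≡0) (ℤₚ.+-identityˡ x₀)

    0≤C : ∀ n → + 0 ℤ.≤ C n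
    0≤C = solution-0≤ (ℤ.+≤+ ℕ.z≤n) (ℤ.+≤+ ℕ.z≤n) (ℤ.+≤+ ℕ.z≤n)

    -- Monotonicity starts at index 3, that is at C₀ = 1: the earlier values are 1, 0, 0, and the
    -- digit `a (suc n)` used here is at least 1.
    C-step : ∀ n → C (3 ℕ.+ n) ℤ.≤ C (4 ℕ.+ n)
    C-step n = ℤₚ.≤-trans (1≤i⇒j≤i*j (Expansion.1≤a tail n) (0≤C (3 ℕ.+ n)))
      (ℤₚ.≤-trans (i≤i+j (0≤i*j (0≤b (suc n)) (0≤C (2 ℕ.+ n)))) (i≤i+j (0≤C (1 ℕ.+ n))))
      where
      i≤i+j : ∀ {i j} → + 0 ℤ.≤ j → i ℤ.≤ i ℤ.+ j
      i≤i+j {i} {j} 0≤j = ≡.subst (ℤ._≤ i ℤ.+ j) (ℤₚ.+-identityʳ i) (ℤₚ.+-monoʳ-≤ i 0≤j)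
      0≤i*j : ∀ {i j} → + 0 ℤ.≤ i → + 0 ℤ.≤ j → + 0 ℤ.≤ i ℤ.* j
      0≤i*j {+ m} {+ n} _ _ = ≡.subst (+ 0 ℤ.≤_) (ℤₚ.pos-* m n) (ℤ.+≤+ ℕ.z≤n)
      1≤i⇒j≤i*j : ∀ {i j} → + 1 ℤ.≤ i → + 0 ℤ.≤ j → j ℤ.≤ i ℤ.* j
      1≤i⇒j≤i*j {+ suc m} {+ n} _ _ = ≡.subst (+ n ℤ.≤_) (ℤₚ.pos-* (suc m) n) (ℤ.+≤+ (ℕₚ.m≤m+n n (m ℕ.* n)))
      1≤i⇒j≤i*j {+ 0} (ℤ.+≤+ ())

    C-mono : ∀ n d → C (3 ℕ.+ n) ℤ.≤ C (3 ℕ.+ (d ℕ.+ n))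
    C-mono n zero    = ℤₚ.≤-refl
    C-mono n (suc d) = ℤₚ.≤-trans (C-mono n d) (C-step (d ℕ.+ n))

    1≤C : ∀ n → + 1 ℤ.≤ C (3 ℕ.+ n)
    1≤C n = ≡.subst (λ i → + 1 ℤ.≤ C (3 ℕ.+ i)) (ℕₚ.+-identityʳ n)
      (≡.subst (ℤ._≤ C (3 ℕ.+ (n ℕ.+ 0))) (first (+ 1) (+ 0) (+ 0)) (C-mono 0 n))

    C≤C : ∀ i n → i ℕ.≤ 3 ℕ.+ n → C i ℤ.≤ C (3 ℕ.+ n)
    C≤C 0 n _ = 1≤C n
    C≤C 1 n _ = 0≤C (3 ℕ.+ n)
    C≤C 2 n _ = 0≤C (3 ℕ.+ n)
    C≤C (suc (suc (suc i))) n (ℕ.s≤s (ℕ.s≤s (ℕ.s≤s i≤n))) =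
      ≡.subst (λ j → C (3 ℕ.+ i) ℤ.≤ C (3 ℕ.+ j)) (ℕₚ.m∸n+n≡m i≤n) (C-mono i (n ℕ.∸ i))

    -- The solution X - x C is orthogonal to the expansion and hence stays
    -- within 1, so that X does not exceed x C + 1 < C + 1.
    module _ {x₁ x₂ x} (0<x : 0# < x) (x<1 : x < 1#)
      (start : pairing α β (fromℤ ∘ solution a b (+ 0) x₁ x₂) 0 ≈ x) (X₁≤1 : ∣ x₁ ∣ ℕ.≤ 1) (X₂≤1 : ∣ x₂ ∣ ℕ.≤ 1) where

      X : ℕ → ℤ
      X = solution a b (+ 0) x₁ x₂

      Z : ℕ → Carrier
      Z n = fromℤ (X n) - x * fromℤ (C n)

      Z-solution : IsSolution a b Z
      Z-solution n = trans
        (+-cong (embed {a} {b} {X} (λ _ → ≡.refl) n) (-‿cong (*-congˡ (embed {a} {b} {C} (λ _ → ≡.refl) n))))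
        (solve 9 (λ a b X₂ X₁ X₀ C₂ C₁ C₀ x →
          a :* X₂ :+ b :* X₁ :+ X₀ :- x :* (a :* C₂ :+ b :* C₁ :+ C₀) :=
          a :* (X₂ :- x :* C₂) :+ b :* (X₁ :- x :* C₁) :+ (X₀ :- x :* C₀)) refl
          (fromℤ (a n)) (fromℤ (b n)) (fromℤ (X (2 ℕ.+ n))) (fromℤ (X (1 ℕ.+ n))) (fromℤ (X n))
          (fromℤ (C (2 ℕ.+ n))) (fromℤ (C (1 ℕ.+ n))) (fromℤ (C n)) x)

      -- Orthogonality is moved to index 1 because boundedness is available for the tail only; its
      -- initial window is therefore Z₁, Z₂, Z₃.
      Z-orthogonal : pairing α β Z 1 ≈ 0#
      Z-orthogonal = trans (pairing-next {α} {β} {a} {b} {Z} 0 (α-next 0) (β-next 0) Z-solution)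
        (trans (*-congʳ (trans
          (solve 5 (λ X₂ X₁ x α β →
            (X₂ :- x :* con (+ 0)) :* α :+ (X₁ :- x :* con (+ 0)) :* β :+ (con (+ 0) :- x :* con (+ 1)) :=
            (X₂ :* α :+ X₁ :* β :+ con (+ 0)) :- x) refl (fromℤ x₂) (fromℤ x₁) x (α 0) (β 0))
          (trans (+-congʳ start) (-‿inverseʳ x)))) (zeroˡ _))

      within-fromℤ : ∀ i → ∣ i ∣ ℕ.≤ 1 → Within (fromℤ (+ 1)) (fromℤ i - x * fromℤ (+ 0))
      within-fromℤ i i≤1 with ∣∣≤⇒Within i i≤1
      ... | lower , upper = ≤-respʳ (+-congˡ i≈) lower , ≤-respʳ (+-congˡ (-‿cong i≈)) upper
        where
        i≈ = solve 2 (λ i x → i := i :- x :* con (+ 0)) refl (fromℤ i) x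

      within-Z₃ : Within (fromℤ (+ 1)) (Z 3)
      within-Z₃ = ≤-respʳ (+-congˡ (sym Z₃≈)) (<⇒≤ (x<y⇒0<y-x (<-respʳ (sym fromℤ-1) x<1))) ,
        ≤-respʳ (+-congˡ (-‿cong (sym Z₃≈))) (≤-respʳ (+-congˡ (sym (-‿involutive x)))
          (+-nonneg (fromℤ-nonneg {+ 1} (ℤ.+≤+ ℕ.z≤n)) (<⇒≤ 0<x)))
        where
        Z₃≈ : Z 3 ≈ - x
        Z₃≈ = trans
          (+-cong (fromℤ-cong (first (+ 0) x₁ x₂)) (-‿cong (*-congˡ (fromℤ-cong (first (+ 1) (+ 0) (+ 0))))))
          (solve 1 (λ x → con (+ 0) :- x :* con (+ 1) := :- x) refl x)

      Z-within : ∀ n → Within (fromℤ (+ 1)) (Z (suc n))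
      Z-within = Orthogonal.bounded tail {Z ∘ suc} (Z-solution ∘ suc) Z-orthogonal (fromℤ-nonneg {+ 1} (ℤ.+≤+ ℕ.z≤n))
        (within-fromℤ x₁ X₁≤1) (within-fromℤ x₂ X₂≤1) within-Z₃

      X≤C : ∀ i n → i ℕ.≤ 3 ℕ.+ n → X i ℤ.≤ C (3 ℕ.+ n)
      X≤C zero    n _    = 0≤C (3 ℕ.+ n)
      -- With T the largest denominator, 1 + T - Xᵢ = (1 - Zᵢ) + x (T - Cᵢ) + T (1 - x). The last
      -- summand is positive, so Xᵢ < T + 1 and, for integers, Xᵢ ≤ T.
      X≤C (suc i) n i≤n = i<1+j⇒i≤j (fromℤ-cancel-< {X (suc i)} (0<y-x⇒x<y (<-respʳ
        (trans (solve 4 (λ T Cᵢ X x → (con (+ 1) :- (X :- x :* Cᵢ)) :+ x :* (T :- Cᵢ) :+ T :* (con (+ 1) :- x) :=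
            con (+ 1) :+ T :- X) refl T (fromℤ (C (suc i))) (fromℤ (X (suc i))) x)
          (+-congʳ (sym (fromℤ-+ (+ 1) (C (3 ℕ.+ n))))))
        (+-nonneg-pos
          (+-nonneg (proj₂ (Z-within i))
            (*-nonneg (<⇒≤ 0<x) (x≤y⇒0≤y-x (fromℤ-mono-≤ (C≤C (suc i) n i≤n)))))
          (*-pos (fromℤ-pos (ℤₚ.<-≤-trans (ℤ.+<+ (ℕ.s≤s ℕ.z≤n)) (1≤C n))) (x<y⇒0<y-x (<-respʳ (sym fromℤ-1) x<1)))))))
        where
        T = fromℤ (C (3 ℕ.+ n))

    nonneg⇒Bounded : ∀ {i j} → + 0 ℤ.≤ i → i ℤ.≤ j → Bounded ∣ j ∣ i
    nonneg⇒Bounded {+ _} {+ _} _ (ℤ.+≤+ i≤j) = bounded i≤j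

    A-bounded : ∀ i n → i ℕ.≤ 3 ℕ.+ n → Bounded ∣ C (3 ℕ.+ n) ∣ (A i)
    A-bounded i n i≤n = nonneg⇒Bounded (solution-0≤ (ℤ.+≤+ ℕ.z≤n) (ℤ.+≤+ ℕ.z≤n) (ℤ.+≤+ ℕ.z≤n) i)
      (X≤C 0<α₀ α₀<1 (Transition.pairing-A R mcf) ℕ.z≤n ℕₚ.≤-refl i n i≤n)

    B-bounded : ∀ i n → i ℕ.≤ 3 ℕ.+ n → Bounded ∣ C (3 ℕ.+ n) ∣ (B i)
    B-bounded i n i≤n = nonneg⇒Bounded (solution-0≤ (ℤ.+≤+ ℕ.z≤n) (ℤ.+≤+ ℕ.z≤n) (ℤ.+≤+ ℕ.z≤n) i)
      (X≤C 0<β₀ β₀<1 (Transition.pairing-B R mcf) ℕₚ.≤-refl ℕ.z≤n i n i≤n)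

    C-bounded : ∀ i n → i ℕ.≤ 3 ℕ.+ n → Bounded ∣ C (3 ℕ.+ n) ∣ (C i)
    C-bounded i n i≤n = nonneg⇒Bounded (0≤C i) (C≤C i n i≤n)

    -- The window at m = `suc n` ends at index 3 + n, and the window at k ends no later, so C (3 +
    -- n), which is the denominator with index m - 1, dominates all entries. This is where the index
    -- h + k - 1 of the theorem comes from.
    transition-bounded : ∀ k n → k ℕ.≤ suc n → BoundedMatrix (6 ℕ.* ∣ C (3 ℕ.+ n) ∣ ℕ.^ 3) (transition k (suc n))
    transition-bounded k n k≤n = record
      { a₁≤ = replaceA-bounded A-bounded ; a₂≤ = replaceB-bounded A-bounded ; a₃≤ = replaceC-bounded A-bounded
      ; b₁≤ = replaceA-bounded B-bounded ; b₂≤ = replaceB-bounded B-bounded ; b₃≤ = replaceC-bounded B-bounded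
      ; c₁≤ = replaceA-bounded C-bounded ; c₂≤ = replaceB-bounded C-bounded ; c₃≤ = replaceC-bounded C-bounded
      }
      where
      t = ∣ C (3 ℕ.+ n) ∣
      AllBounded : (ℕ → ℤ) → Set
      AllBounded U = ∀ i n → i ℕ.≤ 3 ℕ.+ n → Bounded ∣ C (3 ℕ.+ n) ∣ (U i)
      k₂ : 2 ℕ.+ k ℕ.≤ 3 ℕ.+ n
      k₂ = ℕ.s≤s (ℕ.s≤s k≤n)
      k₁ : 1 ℕ.+ k ℕ.≤ 3 ℕ.+ n
      k₁ = ℕₚ.≤-trans (ℕₚ.n≤1+n _) k₂
      k₀ : k ℕ.≤ 3 ℕ.+ n
      k₀ = ℕₚ.≤-trans (ℕₚ.n≤1+n _) k₁
      m₁ : 2 ℕ.+ n ℕ.≤ 3 ℕ.+ n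
      m₁ = ℕₚ.n≤1+n _
      m₀ : 1 ℕ.+ n ℕ.≤ 3 ℕ.+ n
      m₀ = ℕₚ.≤-trans (ℕₚ.n≤1+n _) m₁
      replaceA-bounded : ∀ {U} → AllBounded U → Bounded (6 ℕ.* t ℕ.^ 3) (replaceA k (suc n) U)
      replaceA-bounded U = det-bounded (U _ n ℕₚ.≤-refl) (U _ n m₁) (U _ n m₀)
        (B-bounded _ n k₂) (B-bounded _ n k₁) (B-bounded _ n k₀) (C-bounded _ n k₂) (C-bounded _ n k₁) (C-bounded _ n k₀)
      replaceB-bounded : ∀ {U} → AllBounded U → Bounded (6 ℕ.* t ℕ.^ 3) (replaceB k (suc n) U)
      replaceB-bounded U = det-bounded (A-bounded _ n k₂) (A-bounded _ n k₁) (A-bounded _ n k₀)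
        (U _ n ℕₚ.≤-refl) (U _ n m₁) (U _ n m₀) (C-bounded _ n k₂) (C-bounded _ n k₁) (C-bounded _ n k₀)
      replaceC-bounded : ∀ {U} → AllBounded U → Bounded (6 ℕ.* t ℕ.^ 3) (replaceC k (suc n) U)
      replaceC-bounded U = det-bounded (A-bounded _ n k₂) (A-bounded _ n k₁) (A-bounded _ n k₀)
        (B-bounded _ n k₂) (B-bounded _ n k₁) (B-bounded _ n k₀) (U _ n ℕₚ.≤-refl) (U _ n m₁) (U _ n m₀)

-- From periodic digits to periodic complete quotients

module Periodicity {c ℓ₁ ℓ₂ ℓ₃} (R : RealNumbers c ℓ₁ ℓ₂ ℓ₃) {α₀ β₀ a b}
  (mcf : OverReals.IsMCF R α₀ β₀ a b) (k h : ℕ)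
  (a-periodic : PeriodicFrom k h a) (b-periodic : PeriodicFrom k h b) where
  open OrderedField R
  open Expansions R
  open Independence R
  open Transition R using (Expansion-resp)
  open Jacobi mcf

  shift-digit : ∀ {d} → PeriodicFrom k h d → ∀ n → k ℕ.≤ n → d (h ℕ.+ n) ≡ d n
  shift-digit {d} periodic n k≤n = ≡.trans (≡.cong d (ℕₚ.+-comm h n)) (periodic n k≤n)

  tail-digit : ∀ {d} → PeriodicFrom k h d → ∀ n → d (suc (n ℕ.+ (h ℕ.+ k))) ≡ d (suc (n ℕ.+ k))
  tail-digit {d} periodic n = ≡.trans (≡.cong (d ∘ suc) (≡.trans (≡.sym (ℕₚ.+-assoc n h k))
      (≡.trans (≡.cong (ℕ._+ k) (ℕₚ.+-comm n h)) (ℕₚ.+-assoc h n k))))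
    (≡.trans (≡.cong d (≡.sym (ℕₚ.+-suc h (n ℕ.+ k))))
      (shift-digit {d} periodic (suc (n ℕ.+ k)) (ℕₚ.m≤n⇒m≤1+n (ℕₚ.m≤n+m k n))))

  tail-k : Expansion (λ n → α (suc (n ℕ.+ k))) (λ n → β (suc (n ℕ.+ k)))
    (λ n → a (suc (n ℕ.+ k))) (λ n → b (suc (n ℕ.+ k)))
  tail-k = shift k tail

  tail-h+k : Expansion (λ n → α (suc (n ℕ.+ (h ℕ.+ k)))) (λ n → β (suc (n ℕ.+ (h ℕ.+ k))))
    (λ n → a (suc (n ℕ.+ k))) (λ n → b (suc (n ℕ.+ k)))
  tail-h+k = Expansion-resp (tail-digit {a} a-periodic) (tail-digit {b} b-periodic) (shift (h ℕ.+ k) tail)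

  -- Uniqueness is applied from index `suc k` on, since for k = 0 the index k itself lies before the
  -- range of `tail`. The equal digits at k and the recursion then carry the equality one step back.
  α-periodic : α (h ℕ.+ k) ≈ α k
  α-periodic = *-cancelʳ-pos (0<α k) (begin
    α (h ℕ.+ k) * α (suc k)
      ≈⟨ *-congˡ α′≈ ⟩
    α (h ℕ.+ k) * α (suc (h ℕ.+ k))
      ≈⟨ α-next (h ℕ.+ k) ⟩
    fromℤ (a (h ℕ.+ k)) * α (suc (h ℕ.+ k)) + β (suc (h ℕ.+ k))
      ≈⟨ +-cong (*-cong (fromℤ-cong (shift-digit {a} a-periodic k ℕₚ.≤-refl)) (sym α′≈)) (sym (β-unique tail-k tail-h+k)) ⟩
    fromℤ (a k) * α (suc k) + β (suc k)
      ≈⟨ α-next k ⟨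
    α k * α (suc k) ∎)
    where
    open SetoidReasoning setoid
    α′≈ = α-unique tail-k tail-h+k

  β-periodic : β (h ℕ.+ k) ≈ β k
  β-periodic = *-cancelʳ-pos (0<α k) (begin
    β (h ℕ.+ k) * α (suc k)
      ≈⟨ *-congˡ α′≈ ⟩
    β (h ℕ.+ k) * α (suc (h ℕ.+ k))
      ≈⟨ β-next (h ℕ.+ k) ⟩
    fromℤ (b (h ℕ.+ k)) * α (suc (h ℕ.+ k)) + 1#
      ≈⟨ +-congʳ (*-cong (fromℤ-cong (shift-digit {b} b-periodic k ℕₚ.≤-refl)) (sym α′≈)) ⟩
    fromℤ (b k) * α (suc k) + 1#
      ≈⟨ β-next k ⟨
    β k * α (suc k) ∎)
    where
    open SetoidReasoning setoid
    α′≈ = α-unique tail-k tail-h+k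

toℤ-bound : ∀ {n} (z : ℤ) → + 0 ℤ.≤ z → n ℕ.≤ 3024 ℕ.* ∣ z ∣ ℕ.^ 9 → + n ℤ.≤ + 3024 ℤ.* z ℤ.^ 9
toℤ-bound (+ t) _ n≤ = ℤₚ.≤-trans (ℤ.+≤+ n≤) (ℤₚ.≤-reflexive
  (≡.trans (ℤₚ.pos-* 3024 (t ℕ.^ 9)) (≡.cong (+ 3024 ℤ.*_) (pos-^ 9))))
  where
  pos-^ : ∀ e → + (t ℕ.^ e) ≡ (+ t) ℤ.^ e
  pos-^ zero    = ≡.refl
  pos-^ (suc e) = ≡.trans (ℤₚ.pos-* t (t ℕ.^ e)) (≡.cong (+ t ℤ.*_) (pos-^ e))

theorem16 : ∀ {c ℓ₁ ℓ₂ ℓ₃} (R : RealNumbers c ℓ₁ ℓ₂ ℓ₃) → let open OverReals R in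
    (α₀ β₀ : Carrier) (a b : ℕ → ℤ) (k h : ℕ) → 1 ℕ.≤ h →
    IsMCF α₀ β₀ a b → PeriodicFrom k h a → PeriodicFrom k h b →
    Σ[ cubic-α ∈ IsCubicIrrational α₀ ] Σ[ cubic-β ∈ IsCubicIrrational β₀ ]
    (0# < α₀ → α₀ < 1# → 0# < β₀ → β₀ < 1# →
    + H cubic-α ℤ.≤ + 3024 ℤ.* denominator a b (h ℕ.+ k ℕ.∸ 1) ℤ.^ 9
    × + H cubic-β ℤ.≤ + 3024 ℤ.* denominator a b (h ℕ.+ k ℕ.∸ 1) ℤ.^ 9)
theorem16 R α₀ β₀ a b k (suc h) _ mcf a-periodic b-periodic =
  proj₁ cubic-α , proj₁ cubic-β , λ 0<α₀ α₀<1 0<β₀ β₀<1 →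
    let bounds = transition-bounded 0<α₀ α₀<1 0<β₀ β₀<1 k (h ℕ.+ k) (ℕₚ.m≤n+m k (suc h))
        conclude = λ {n} n≤ → ≡.subst (λ d → + n ℤ.≤ + 3024 ℤ.* d ℤ.^ 9) (C≡shiftedDenominator (3 ℕ.+ (h ℕ.+ k)))
          (toℤ-bound (C (3 ℕ.+ (h ℕ.+ k))) (0≤C 0<α₀ α₀<1 0<β₀ β₀<1 (3 ℕ.+ (h ℕ.+ k))) n≤)
    in conclude (proj₂ cubic-α t bounds) , conclude (proj₂ cubic-β t (BoundedMatrix-swap bounds))
  where
  open Convergents a b
  open Denominators R mcf
  open Independence R using (Jacobi⇒Independent; Independent)
  open Cubic R
  open Periodicity R mcf k (suc h) a-periodic b-periodic
  open Transition R
  open CubicFromMatrix R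
  m = suc h ℕ.+ k
  t = ∣ C (3 ℕ.+ (h ℕ.+ k)) ∣
  independent = Jacobi⇒Independent mcf
  eigen = eigenvector mcf k m α-periodic β-periodic
  nonscalar : ¬ (Matrix.c₁ (transition k m) ≡ + 0 × Matrix.c₂ (transition k m) ≡ + 0)
  nonscalar = transition-nonscalar mcf k m α-periodic β-periodic (P<P mcf h k)
  cubic-α = eigenvector⇒cubic independent eigen nonscalar
  cubic-β = eigenvector⇒cubic (Independent-swap independent) (IsEigenvector-swap eigen)
    (nonscalar ∘ λ (c₂≡0 , c₁≡0) → c₁≡0 , c₂≡0)
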